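{- The following five identities between real numbers hold: \begin{align*} \tan\left(\frac{\pi}{11}\right) + 4\sin\left(\frac{3\pi}{11}\right) &= \sqrt{11},\\ \tan\left(\frac{2\pi}{11}\right) - 4\sin\left(\frac{5\pi}{11}\right) &= -\sqrt{11},\\ \tan\left(\frac{3\pi}{11}\right) + 4\sin\left(\frac{2\pi}{11}\right) &= \sqrt{11},\\ \tan\left(\frac{4\pi}{11}\right) + 4\sin\left(\frac{\pi}{11}\right) &= \sqrt{11},\\ \tan\left(\frac{5\pi}{11}\right) - 4\sin\left(\frac{4\pi}{11}\right) &= \sqrt{11}. \end{align*}
   Context: Angles are in radians; $\sqrt{11}$ denotes the positive square root. -}

module Defs where

import Algebra.Definitions.RawSemiring
open import Data.Empty using (⊥-elim)
open import Data.Integer.Base as ℤ using ()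
import Data.Integer.Properties as ℤₚ
open import Data.Nat.Base as ℕ using (ℕ; zero; suc; _!)
import Data.Nat.Properties as ℕₚ
open import Data.Product.Base using (Σ-syntax; ∃-syntax; _×_; _,_; proj₁; proj₂)
open import Data.Rational.Base as Rat using (ℚ; mkℚ; 0ℚ; 1ℚ; ½; _/_; ∣_∣)
import Data.Rational.Properties as ℚₚ
import Data.Rational.Unnormalised.Base as ℚᵘ
import Data.Rational.Unnormalised.Properties as ℚᵘₚ
open import Data.Rational.Solver using (module +-*-Solver)
open import Data.Sum.Base using (_⊎_; inj₁; inj₂)
open import Relation.Binary.PropositionalEquality
  using (_≡_; refl; sym; trans; cong; cong₂; subst; subst₂)
open import Relation.Nullary using (¬_; yes; no)

module RationalSequences where

  open Rat using (_+_; _*_; _-_; -_; _≤_; _<_)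
  open Algebra.Definitions.RawSemiring Rat.+-*-rawSemiring public using (_^_)
  open +-*-Solver
  open ℚₚ.≤-Reasoning

  IsCauchy : (ℕ → ℚ) → Set
  IsCauchy s = ∀ ε → 0ℚ < ε →
    ∃[ N ] ∀ m n → N ℕ.≤ m → N ℕ.≤ n → ∣ s m - s n ∣ < ε

  IsNull : (ℕ → ℚ) → Set
  IsNull s = ∀ ε → 0ℚ < ε → ∃[ N ] ∀ n → N ℕ.≤ n → ∣ s n ∣ < ε

  Σ< : ℕ → (ℕ → ℚ) → ℚ
  Σ< zero    t = 0ℚ
  Σ< (suc n) t = Σ< n t + t n

  1/_! : ℕ → ℚ
  1/ n ! = (ℤ.+ 1 / (n !)) {{ n ℕₚ.!≢0 }}

  -- Reciprocal extended by inv 0 = 0.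
  inv : ℚ → ℚ
  inv q with q ℚₚ.≟ 0ℚ
  ... | yes _  = 0ℚ
  ... | no q≢0 = (Rat.1/ q) {{ Rat.≢-nonZero q≢0 }}

  sinTerm cosTerm : ℚ → ℕ → ℚ
  sinTerm x k = (- 1ℚ) ^ k * (x ^ suc (2 ℕ.* k) * 1/ suc (2 ℕ.* k) !)
  cosTerm x k = (- 1ℚ) ^ k * (x ^ (2 ℕ.* k) * 1/ (2 ℕ.* k) !)

  sinSum cosSum : ℕ → ℚ → ℚ
  sinSum n x = Σ< n (sinTerm x)
  cosSum n x = Σ< n (cosTerm x)

  ι : ℕ → ℚ
  ι n = ℤ.+ n / 1

  pos* : ∀ {p q} → 0ℚ < p → 0ℚ < q → 0ℚ < p * q
  pos* {p} {q} a b = ℚₚ.positive⁻¹ (p * q)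
    {{ ℚₚ.pos*pos⇒pos p {{ Rat.positive a }} q {{ Rat.positive b }} }}

  nn* : ∀ {p q} → 0ℚ ≤ p → 0ℚ ≤ q → 0ℚ ≤ p * q
  nn* {p} {q} a b = ℚₚ.nonNegative⁻¹ (p * q)
    {{ ℚₚ.nonNeg*nonNeg⇒nonNeg p {{ Rat.nonNegative a }} q {{ Rat.nonNegative b }} }}

  nn+ : ∀ {p q} → 0ℚ ≤ p → 0ℚ ≤ q → 0ℚ ≤ p + q
  nn+ = ℚₚ.+-mono-≤

  sub≥0 : ∀ {p q} → p ≤ q → 0ℚ ≤ q - p
  sub≥0 {p} {q} h = subst (_≤ q - p) (ℚₚ.+-inverseʳ p) (ℚₚ.+-monoˡ-≤ (- p) h)

  ≤-cert : ∀ {p q r} → 0ℚ ≤ r → q - p ≡ r → p ≤ q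
  ≤-cert {p} {q} {r} h e = begin
    p           ≡⟨ sym (ℚₚ.+-identityʳ p) ⟩
    p + 0ℚ      ≤⟨ ℚₚ.+-monoʳ-≤ p h ⟩
    p + r       ≡⟨ cong (p +_) (sym e) ⟩
    p + (q - p) ≡⟨ solve 2 (λ p q → p :+ (q :- p) := q) refl p q ⟩
    q           ∎

  *-monoʳ : ∀ {r p q} → 0ℚ ≤ r → p ≤ q → r * p ≤ r * q
  *-monoʳ {r} h = ℚₚ.*-monoˡ-≤-nonNeg r {{ Rat.nonNegative h }}

  *-monoˡ : ∀ {r p q} → 0ℚ ≤ r → p ≤ q → p * r ≤ q * r
  *-monoˡ {r} h = ℚₚ.*-monoʳ-≤-nonNeg r {{ Rat.nonNegative h }}

  *-mono : ∀ {p q r s} → 0ℚ ≤ p → 0ℚ ≤ r → p ≤ q → r ≤ s → p * r ≤ q * s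
  *-mono p≥0 r≥0 p≤q r≤s =
    ℚₚ.≤-trans (*-monoˡ r≥0 p≤q) (*-monoʳ (ℚₚ.≤-trans p≥0 p≤q) r≤s)

  *-cancelˡ : ∀ {r p q} → 0ℚ < r → r * p ≤ r * q → p ≤ q
  *-cancelˡ {r} h = ℚₚ.*-cancelˡ-≤-pos r {{ Rat.positive h }}

  *-cancelˡ< : ∀ {r p q} → 0ℚ < r → r * p < r * q → p < q
  *-cancelˡ< {r} h = ℚₚ.*-cancelˡ-<-nonNeg r {{ Rat.nonNegative (ℚₚ.<⇒≤ h) }}

  <⇒≱ : ∀ {p q} → p < q → ¬ (q ≤ p)
  <⇒≱ p<q q≤p = ℚₚ.<-irrefl refl (ℚₚ.<-≤-trans p<q q≤p)

  no-gap : ∀ {p q δ} → 0ℚ < δ → p + δ ≤ q → ¬ (q ≤ p)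
  no-gap {p} {q} {δ} δ>0 h q≤p = <⇒≱
    (subst (_< p + δ) (ℚₚ.+-identityʳ p) (ℚₚ.+-monoʳ-< p δ>0)) (ℚₚ.≤-trans h q≤p)

  quotient : ∀ B ε → 0ℚ < B → 0ℚ < ε → Σ[ δ ∈ ℚ ] 0ℚ < δ × B * δ ≡ ε
  quotient B ε B>0 ε>0 = δ , pos* 1/B>0 ε>0 , eq
    where
    instance
      _ = Rat.positive B>0
    1/B : ℚ
    1/B = (Rat.1/ B) {{ ℚₚ.pos⇒nonZero B }}
    δ : ℚ
    δ = 1/B * ε
    1/B>0 : 0ℚ < 1/B
    1/B>0 = ℚₚ.positive⁻¹ 1/B {{ ℚₚ.1/pos⇒pos B }}
    eq : B * δ ≡ ε
    eq = trans (sym (ℚₚ.*-assoc B 1/B ε))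
        (trans (cong (_* ε) (ℚₚ.*-inverseʳ B {{ ℚₚ.pos⇒nonZero B }})) (ℚₚ.*-identityˡ ε))

  ∣∣-≤ : ∀ {x B} → x ≤ B → - x ≤ B → ∣ x ∣ ≤ B
  ∣∣-≤ {x} a b with ℚₚ.∣p∣≡p∨∣p∣≡-p x
  ... | inj₁ e = subst (_≤ _) (sym e) a
  ... | inj₂ e = subst (_≤ _) (sym e) b

  x≤∣x∣ : ∀ x → x ≤ ∣ x ∣
  x≤∣x∣ x with ℚₚ.≤-total 0ℚ x
  ... | inj₁ h = ℚₚ.≤-reflexive (sym (ℚₚ.0≤p⇒∣p∣≡p h))
  ... | inj₂ h = ℚₚ.≤-trans h (ℚₚ.0≤∣p∣ x)

  -x≤∣x∣ : ∀ x → - x ≤ ∣ x ∣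
  -x≤∣x∣ x = subst (- x ≤_) (ℚₚ.∣-p∣≡∣p∣ x) (x≤∣x∣ (- x))

  ∣-∣-sym : ∀ x y → ∣ x - y ∣ ≡ ∣ y - x ∣
  ∣-∣-sym x y = trans (cong ∣_∣ (solve 2 (λ x y → x :- y := :- (y :- x)) refl x y))
                      (ℚₚ.∣-p∣≡∣p∣ (y - x))

  triangle : ∀ x y z → ∣ x - z ∣ ≤ ∣ x - y ∣ + ∣ y - z ∣
  triangle x y z = begin
    ∣ x - z ∣             ≡⟨ cong ∣_∣ (solve 3 (λ x y z → x :- z := (x :- y) :+ (y :- z)) refl x y z) ⟩
    ∣ (x - y) + (y - z) ∣ ≤⟨ ℚₚ.∣p+q∣≤∣p∣+∣q∣ (x - y) (y - z) ⟩
    ∣ x - y ∣ + ∣ y - z ∣ ∎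

  ι-+ : ∀ m n → ι (m ℕ.+ n) ≡ ι m + ι n
  ι-+ m n = ℚₚ.toℚᵘ-injective (begin′
    Rat.toℚᵘ (ι (m ℕ.+ n))             ≈⟨ ℚₚ.toℚᵘ-fromℚᵘ (ℚᵘ.mkℚᵘ (ℤ.+ (m ℕ.+ n)) 0) ⟩
    ℚᵘ.mkℚᵘ (ℤ.+ (m ℕ.+ n)) 0          ≈⟨ ℚᵘ.*≡* (cong (ℤ._* ℤ.+ 1) (trans (ℤₚ.pos-+ m n)
                                          (sym (cong₂ ℤ._+_ (ℤₚ.*-identityʳ (ℤ.+ m)) (ℤₚ.*-identityʳ (ℤ.+ n)))))) ⟩
    ℚᵘ.mkℚᵘ (ℤ.+ m) 0 ℚᵘ.+ ℚᵘ.mkℚᵘ (ℤ.+ n) 0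
      ≈⟨ ℚᵘₚ.≃-sym (ℚᵘₚ.+-cong (ℚₚ.toℚᵘ-fromℚᵘ (ℚᵘ.mkℚᵘ (ℤ.+ m) 0)) (ℚₚ.toℚᵘ-fromℚᵘ (ℚᵘ.mkℚᵘ (ℤ.+ n) 0))) ⟩
    Rat.toℚᵘ (ι m) ℚᵘ.+ Rat.toℚᵘ (ι n)   ≈⟨ ℚᵘₚ.≃-sym (ℚₚ.toℚᵘ-homo-+ (ι m) (ι n)) ⟩
    Rat.toℚᵘ (ι m + ι n)               ∎′)
    where open import Relation.Binary.Reasoning.Setoid ℚᵘₚ.≃-setoid renaming (begin_ to begin′_; _∎ to _∎′) using (step-≈-⟩)

  ι-* : ∀ m n → ι (m ℕ.* n) ≡ ι m * ι n
  ι-* zero    n = sym (ℚₚ.*-zeroˡ (ι n))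
  ι-* (suc m) n = trans (ι-+ n (m ℕ.* n)) (trans (cong (ι n +_) (ι-* m n))
    (trans (solve 2 (λ m n → n :+ m :* n := (con 1ℚ :+ m) :* n) refl (ι m) (ι n))
           (cong (_* ι n) (sym (ι-+ 1 m)))))

  ι-mono : ∀ {m n} → m ℕ.≤ n → ι m ≤ ι n
  ι-mono {m} {n} h with ℕₚ.m≤n⇒∃[o]m+o≡n h
  ... | o , refl = ≤-cert (ℚₚ.nonNegative⁻¹ (ι o) {{ ℚₚ.normalize-nonNeg o 1 }})
    (trans (cong (_- ι m) (ι-+ m o)) (solve 2 (λ m o → (m :+ o) :- m := o) refl (ι m) (ι o)))

  ι≥0 : ∀ n → 0ℚ ≤ ι n
  ι≥0 n = ι-mono {0} {n} ℕ.z≤n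

  ι-^ : ∀ m n → ι (m ℕ.^ n) ≡ ι m ^ n
  ι-^ m zero    = refl
  ι-^ m (suc n) = trans (ι-* m (m ℕ.^ n)) (cong (ι m *_) (ι-^ m n))

  archimedes : ∀ q → ∃[ n ] ∣ q ∣ ≤ ι n
  archimedes (mkℚ a d c) = ℤ.∣ a ∣ , ℚₚ.toℚᵘ-cancel-≤
    (ℚᵘₚ.≤-respʳ-≃ (ℚᵘₚ.≃-sym (ℚₚ.toℚᵘ-fromℚᵘ (ℚᵘ.mkℚᵘ (ℤ.+ ℤ.∣ a ∣) 0)))
      (ℚᵘ.*≤* (ℤₚ.*-monoˡ-≤-nonNeg (ℤ.+ ℤ.∣ a ∣) (ℤ.+≤+ (ℕ.s≤s ℕ.z≤n)))))

  1/!-inverse : ∀ n → 1/ n ! * ι (n !) ≡ 1ℚ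
  1/!-inverse n = go (n !) {{ n ℕₚ.!≢0 }}
    where
    go : ∀ m .{{ _ : ℕ.NonZero m }} → (ℤ.+ 1 / m) * ι m ≡ 1ℚ
    go (suc m) = ℚₚ.toℚᵘ-injective (ℚᵘₚ.≃-trans (ℚₚ.toℚᵘ-homo-* (ℤ.+ 1 / suc m) (ι (suc m)))
      (ℚᵘₚ.≃-trans (ℚᵘₚ.*-cong (ℚₚ.toℚᵘ-fromℚᵘ (ℚᵘ.mkℚᵘ (ℤ.+ 1) m)) (ℚₚ.toℚᵘ-fromℚᵘ (ℚᵘ.mkℚᵘ (ℤ.+ suc m) 0)))
        (ℚᵘ.*≡* (ℤₚ.*-assoc (ℤ.+ 1) (ℤ.+ suc m) (ℤ.+ 1)))))

  1/!≥0 : ∀ n → 0ℚ ≤ 1/ n !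
  1/!≥0 n = ℚₚ.nonNegative⁻¹ (1/ n !) {{ ℚₚ.normalize-nonNeg 1 (n !) {{ n ℕₚ.!≢0 }} }}

  1/!-suc : ∀ n → 1/ n ! ≡ ι (suc n) * 1/ suc n !
  1/!-suc n = ≡.begin
    1/ n !                                       ≡.≡⟨ sym (ℚₚ.*-identityʳ _) ⟩
    1/ n ! * 1ℚ                                  ≡.≡⟨ cong (1/ n ! *_) (sym (1/!-inverse (suc n))) ⟩
    1/ n ! * (1/ suc n ! * ι (suc n ℕ.* n !))    ≡.≡⟨ cong (λ z → 1/ n ! * (1/ suc n ! * z)) (ι-* (suc n) (n !)) ⟩
    1/ n ! * (1/ suc n ! * (ι (suc n) * ι (n !)))
      ≡.≡⟨ solve 4 (λ a b c d → a :* (b :* (c :* d)) := (a :* d) :* (c :* b)) refl (1/ n !) (1/ suc n !) (ι (suc n)) (ι (n !)) ⟩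
    (1/ n ! * ι (n !)) * (ι (suc n) * 1/ suc n !) ≡.≡⟨ cong (_* (ι (suc n) * 1/ suc n !)) (1/!-inverse n) ⟩
    1ℚ * (ι (suc n) * 1/ suc n !)                ≡.≡⟨ ℚₚ.*-identityˡ _ ⟩
    ι (suc n) * 1/ suc n !                       ≡.∎
    where module ≡ = Relation.Binary.PropositionalEquality.≡-Reasoning

  ^≥0 : ∀ {x} → 0ℚ ≤ x → ∀ n → 0ℚ ≤ x ^ n
  ^≥0 h zero    = ℚₚ.nonNegative⁻¹ 1ℚ
  ^≥0 h (suc n) = nn* h (^≥0 h n)

  ∣^∣ : ∀ x n → ∣ x ^ n ∣ ≡ ∣ x ∣ ^ n
  ∣^∣ x zero    = refl
  ∣^∣ x (suc n) = trans (ℚₚ.∣p*q∣≡∣p∣*∣q∣ x (x ^ n)) (cong (∣ x ∣ *_) (∣^∣ x n))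

  1^ : ∀ n → 1ℚ ^ n ≡ 1ℚ
  1^ zero    = refl
  1^ (suc n) = trans (ℚₚ.*-identityˡ _) (1^ n)

  *-^ : ∀ x y n → (x * y) ^ n ≡ x ^ n * y ^ n
  *-^ x y zero    = refl
  *-^ x y (suc n) = trans (cong ((x * y) *_) (*-^ x y n))
    (solve 4 (λ x y p q → (x :* y) :* (p :* q) := (x :* p) :* (y :* q)) refl x y (x ^ n) (y ^ n))

  ^-mono : ∀ {x y} → 0ℚ ≤ x → x ≤ y → ∀ n → x ^ n ≤ y ^ n
  ^-mono a b zero    = ℚₚ.≤-refl
  ^-mono a b (suc n) = *-mono a (^≥0 a n) b (^-mono a b n)

  dominated : ∀ s u v → IsCauchy u → IsCauchy v → ∀ B → 0ℚ < B → ∀ N →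
    (∀ m n → N ℕ.≤ m → N ℕ.≤ n → ∣ s m - s n ∣ ≤ B * (∣ u m - u n ∣ + ∣ v m - v n ∣)) →
    IsCauchy s
  dominated s u v cu cv B B>0 N h ε ε>0 =
    let δ , δ>0 , eq = quotient (B + B) ε (ℚₚ.+-mono-< B>0 B>0) ε>0
        N₁ , h₁ = cu δ δ>0
        N₂ , h₂ = cv δ δ>0
        N₁≤ = ℕₚ.≤-trans (ℕₚ.m≤m+n N₁ N₂) (ℕₚ.m≤n+m (N₁ ℕ.+ N₂) N)
        N₂≤ = ℕₚ.≤-trans (ℕₚ.m≤n+m N₂ N₁) (ℕₚ.m≤n+m (N₁ ℕ.+ N₂) N)
        N≤  = ℕₚ.m≤m+n N (N₁ ℕ.+ N₂)
    in N ℕ.+ (N₁ ℕ.+ N₂) , λ m n m≥ n≥ → begin-strict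
    ∣ s m - s n ∣
      ≤⟨ h m n (ℕₚ.≤-trans N≤ m≥) (ℕₚ.≤-trans N≤ n≥) ⟩
    B * (∣ u m - u n ∣ + ∣ v m - v n ∣)
      <⟨ ℚₚ.*-monoʳ-<-pos B {{ Rat.positive B>0 }} (ℚₚ.+-mono-<
           (h₁ m n (ℕₚ.≤-trans N₁≤ m≥) (ℕₚ.≤-trans N₁≤ n≥))
           (h₂ m n (ℕₚ.≤-trans N₂≤ m≥) (ℕₚ.≤-trans N₂≤ n≥))) ⟩
    B * (δ + δ)
      ≡⟨ solve 2 (λ B δ → B :* (δ :+ δ) := (B :+ B) :* δ) refl B δ ⟩
    (B + B) * δ
      ≡⟨ eq ⟩
    ε ∎

  0<1 : 0ℚ < 1ℚ
  0<1 = ℚₚ.positive⁻¹ 1ℚ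

  bounded : ∀ {s} → IsCauchy s → ∃[ b ] ∃[ N ] (∀ n → N ℕ.≤ n → ∣ s n ∣ ≤ ι b)
  bounded {s} cs with cs 1ℚ 0<1
  ... | N , h with archimedes (s N)
  ... | b , hb = suc b , N , λ n n≥ → begin
    ∣ s n ∣                 ≡⟨ cong ∣_∣ (solve 2 (λ x y → x := (x :- y) :+ y) refl (s n) (s N)) ⟩
    ∣ (s n - s N) + s N ∣   ≤⟨ ℚₚ.∣p+q∣≤∣p∣+∣q∣ (s n - s N) (s N) ⟩
    ∣ s n - s N ∣ + ∣ s N ∣ ≤⟨ ℚₚ.+-mono-≤ (ℚₚ.<⇒≤ (h n N n≥ ℕₚ.≤-refl)) hb ⟩
    1ℚ + ι b                ≡⟨ sym (ι-+ 1 b) ⟩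
    ι (suc b)               ∎

  const-cauchy : ∀ q → IsCauchy (λ _ → q)
  const-cauchy q ε ε>0 = 0 , λ _ _ _ _ → subst (_< ε) (cong ∣_∣ (sym (ℚₚ.+-inverseʳ q))) ε>0

  +-cauchy : ∀ s t → IsCauchy s → IsCauchy t → IsCauchy (λ n → s n + t n)
  +-cauchy s t cs ct = dominated (λ n → s n + t n) s t cs ct 1ℚ 0<1 0 λ m n _ _ → begin
    ∣ (s m + t m) - (s n + t n) ∣
      ≡⟨ cong ∣_∣ (solve 4 (λ a b c d → (a :+ b) :- (c :+ d) := (a :- c) :+ (b :- d)) refl
           (s m) (t m) (s n) (t n)) ⟩
    ∣ (s m - s n) + (t m - t n) ∣
      ≤⟨ ℚₚ.∣p+q∣≤∣p∣+∣q∣ (s m - s n) (t m - t n) ⟩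
    ∣ s m - s n ∣ + ∣ t m - t n ∣
      ≡⟨ sym (ℚₚ.*-identityˡ _) ⟩
    1ℚ * (∣ s m - s n ∣ + ∣ t m - t n ∣) ∎

  neg-cauchy : ∀ s → IsCauchy s → IsCauchy (λ n → - s n)
  neg-cauchy s cs ε ε>0 = proj₁ (cs ε ε>0) , λ m n m≥ n≥ → subst (_< ε)
    (trans (sym (ℚₚ.∣-p∣≡∣p∣ (s m - s n)))
           (cong ∣_∣ (solve 2 (λ a b → :- (a :- b) := :- a :- :- b) refl (s m) (s n))))
    (proj₂ (cs ε ε>0) m n m≥ n≥)

  ∣ab-cd∣ : ∀ a b c d {B} → ∣ a ∣ ≤ B → ∣ d ∣ ≤ B →
    ∣ a * b - c * d ∣ ≤ B * (∣ a - c ∣ + ∣ b - d ∣)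
  ∣ab-cd∣ a b c d {B} a≤B d≤B = begin
    ∣ a * b - c * d ∣
      ≡⟨ cong ∣_∣ (solve 4 (λ a b c d → a :* b :- c :* d := d :* (a :- c) :+ a :* (b :- d)) refl a b c d) ⟩
    ∣ d * (a - c) + a * (b - d) ∣
      ≤⟨ ℚₚ.∣p+q∣≤∣p∣+∣q∣ (d * (a - c)) (a * (b - d)) ⟩
    ∣ d * (a - c) ∣ + ∣ a * (b - d) ∣
      ≡⟨ cong₂ _+_ (ℚₚ.∣p*q∣≡∣p∣*∣q∣ d (a - c)) (ℚₚ.∣p*q∣≡∣p∣*∣q∣ a (b - d)) ⟩
    ∣ d ∣ * ∣ a - c ∣ + ∣ a ∣ * ∣ b - d ∣
      ≤⟨ ℚₚ.+-mono-≤ (*-monoˡ (ℚₚ.0≤∣p∣ (a - c)) d≤B) (*-monoˡ (ℚₚ.0≤∣p∣ (b - d)) a≤B) ⟩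
    B * ∣ a - c ∣ + B * ∣ b - d ∣
      ≡⟨ sym (ℚₚ.*-distribˡ-+ B ∣ a - c ∣ ∣ b - d ∣) ⟩
    B * (∣ a - c ∣ + ∣ b - d ∣) ∎

  common-bound : ∀ p q → 0ℚ ≤ p → 0ℚ ≤ q → Σ[ B ∈ ℚ ] 0ℚ < B × p ≤ B × q ≤ B
  common-bound p q p≥0 q≥0 = B , B>0 , p≤B , q≤B
    where
    B : ℚ
    B = 1ℚ + (p + q)
    B>0 : 0ℚ < B
    B>0 = ℚₚ.+-mono-<-≤ {0ℚ} {1ℚ} {0ℚ} {p + q} 0<1 (nn+ {p} {q} p≥0 q≥0)
    p≤B : p ≤ B
    p≤B = ≤-cert {p} {B} {1ℚ + q} (nn+ {1ℚ} {q} (ℚₚ.<⇒≤ 0<1) q≥0)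
      (solve 2 (λ p q → (con 1ℚ :+ (p :+ q)) :- p := con 1ℚ :+ q) refl p q)
    q≤B : q ≤ B
    q≤B = ≤-cert {q} {B} {1ℚ + p} (nn+ {1ℚ} {p} (ℚₚ.<⇒≤ 0<1) p≥0)
      (solve 2 (λ p q → (con 1ℚ :+ (p :+ q)) :- q := con 1ℚ :+ p) refl p q)

  *-cauchy : ∀ s t → IsCauchy s → IsCauchy t → IsCauchy (λ n → s n * t n)
  *-cauchy s t cs ct =
    let b₁ , N₁ , h₁ = bounded cs
        b₂ , N₂ , h₂ = bounded ct
        B , B>0 , b₁≤B , b₂≤B = common-bound (ι b₁) (ι b₂) (ι≥0 b₁) (ι≥0 b₂)
    in dominated (λ n → s n * t n) s t cs ct B B>0 (N₁ ℕ.+ N₂)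
      λ m n m≥ n≥ → ∣ab-cd∣ (s m) (t m) (s n) (t n)
        (ℚₚ.≤-trans (h₁ m (ℕₚ.≤-trans (ℕₚ.m≤m+n N₁ N₂) m≥)) b₁≤B)
        (ℚₚ.≤-trans (h₂ n (ℕₚ.≤-trans (ℕₚ.m≤n+m N₂ N₁) n≥)) b₂≤B)

  inv-inverse : ∀ {q} → 0ℚ < ∣ q ∣ → q * inv q ≡ 1ℚ
  inv-inverse {q} h with q ℚₚ.≟ 0ℚ
  ... | yes refl = ⊥-elim (ℚₚ.<-irrefl refl h)
  ... | no q≢0   = ℚₚ.*-inverseʳ q {{ Rat.≢-nonZero q≢0 }}

  inv-cauchy : ∀ s → IsCauchy s → ∀ δ → 0ℚ < δ → ∀ N → (∀ n → N ℕ.≤ n → δ ≤ ∣ s n ∣) →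
    IsCauchy (λ n → inv (s n))
  inv-cauchy s cs δ δ>0 N h =
    dominated (λ n → inv (s n)) s s cs cs (β * β) (pos* β>0 β>0) N λ m n m≥ n≥ → begin
      ∣ inv (s m) - inv (s n) ∣
        ≡⟨ cong ∣_∣ (eq (s m) (s n) (s>0 m m≥) (s>0 n n≥)) ⟩
      ∣ (inv (s m) * inv (s n)) * (s n - s m) ∣
        ≡⟨ ℚₚ.∣p*q∣≡∣p∣*∣q∣ (inv (s m) * inv (s n)) (s n - s m) ⟩
      ∣ inv (s m) * inv (s n) ∣ * ∣ s n - s m ∣
        ≡⟨ cong₂ _*_ (ℚₚ.∣p*q∣≡∣p∣*∣q∣ (inv (s m)) (inv (s n))) (∣-∣-sym (s n) (s m)) ⟩
      (∣ inv (s m) ∣ * ∣ inv (s n) ∣) * ∣ s m - s n ∣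
        ≤⟨ *-mono (nn* (ℚₚ.0≤∣p∣ (inv (s m))) (ℚₚ.0≤∣p∣ (inv (s n)))) (ℚₚ.0≤∣p∣ (s m - s n))
             (*-mono (ℚₚ.0≤∣p∣ (inv (s m))) (ℚₚ.0≤∣p∣ (inv (s n))) (bound m m≥) (bound n n≥))
             (≤-cert (ℚₚ.0≤∣p∣ (s m - s n))
               (solve 1 (λ a → (a :+ a) :- a := a) refl ∣ s m - s n ∣)) ⟩
      (β * β) * (∣ s m - s n ∣ + ∣ s m - s n ∣) ∎
    where
    β : ℚ
    β = proj₁ (quotient δ 1ℚ δ>0 0<1)
    β>0 : 0ℚ < β
    β>0 = proj₁ (proj₂ (quotient δ 1ℚ δ>0 0<1))
    δβ≡1 : δ * β ≡ 1ℚ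
    δβ≡1 = proj₂ (proj₂ (quotient δ 1ℚ δ>0 0<1))
    s>0 : ∀ n → N ℕ.≤ n → 0ℚ < ∣ s n ∣
    s>0 n n≥ = ℚₚ.<-≤-trans δ>0 (h n n≥)
    eq : ∀ a b → 0ℚ < ∣ a ∣ → 0ℚ < ∣ b ∣ → inv a - inv b ≡ (inv a * inv b) * (b - a)
    eq a b a>0 b>0 = sym (trans
      (solve 4 (λ a b p q → (p :* q) :* (b :- a) := p :* (b :* q) :- q :* (a :* p)) refl a b (inv a) (inv b))
      (cong₂ _-_ (trans (cong (inv a *_) (inv-inverse b>0)) (ℚₚ.*-identityʳ (inv a)))
                 (trans (cong (inv b *_) (inv-inverse a>0)) (ℚₚ.*-identityʳ (inv b)))))
    bound : ∀ n → N ℕ.≤ n → ∣ inv (s n) ∣ ≤ β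
    bound n n≥ = *-cancelˡ δ>0 (begin
      δ * ∣ inv (s n) ∣       ≤⟨ *-monoˡ (ℚₚ.0≤∣p∣ (inv (s n))) (h n n≥) ⟩
      ∣ s n ∣ * ∣ inv (s n) ∣ ≡⟨ sym (ℚₚ.∣p*q∣≡∣p∣*∣q∣ (s n) (inv (s n))) ⟩
      ∣ s n * inv (s n) ∣     ≡⟨ cong ∣_∣ (inv-inverse (s>0 n n≥)) ⟩
      1ℚ                      ≡⟨ sym δβ≡1 ⟩
      δ * β                   ∎)

  geometric : (s : ℕ → ℚ) → ∀ K c → 0ℚ ≤ K → 0ℚ ≤ c → c ≤ 1ℚ →
    (∀ n → ∣ s (suc n) - s n ∣ ≤ K * (1ℚ - c) ^ n) →
    ∀ N k → c * ∣ s (k ℕ.+ N) - s N ∣ ≤ K * (1ℚ - c) ^ N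
  geometric s K c K≥0 c≥0 c≤1 h N k = begin
    c * ∣ s (k ℕ.+ N) - s N ∣       ≤⟨ go k ⟩
    K * (r ^ N - r ^ (k ℕ.+ N))     ≤⟨ *-monoʳ K≥0 (≤-cert (^≥0 (sub≥0 c≤1) (k ℕ.+ N))
                                          (solve 2 (λ a b → a :- (a :- b) := b) refl (r ^ N) (r ^ (k ℕ.+ N)))) ⟩
    K * r ^ N                       ∎
    where
    r : ℚ
    r = 1ℚ - c
    go : ∀ k → c * ∣ s (k ℕ.+ N) - s N ∣ ≤ K * (r ^ N - r ^ (k ℕ.+ N))
    go zero = ℚₚ.≤-reflexive (trans
      (cong (λ z → c * ∣ z ∣) (ℚₚ.+-inverseʳ (s N)))
      (solve 3 (λ c K a → c :* con 0ℚ := K :* (a :- a)) refl c K (r ^ N)))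
    go (suc k) = begin
      c * ∣ s (suc k ℕ.+ N) - s N ∣
        ≤⟨ *-monoʳ c≥0 (triangle (s (suc k ℕ.+ N)) (s (k ℕ.+ N)) (s N)) ⟩
      c * (∣ s (suc k ℕ.+ N) - s (k ℕ.+ N) ∣ + ∣ s (k ℕ.+ N) - s N ∣)
        ≡⟨ ℚₚ.*-distribˡ-+ c ∣ s (suc k ℕ.+ N) - s (k ℕ.+ N) ∣ ∣ s (k ℕ.+ N) - s N ∣ ⟩
      c * ∣ s (suc k ℕ.+ N) - s (k ℕ.+ N) ∣ + c * ∣ s (k ℕ.+ N) - s N ∣
        ≤⟨ ℚₚ.+-mono-≤ (*-monoʳ c≥0 (h (k ℕ.+ N))) (go k) ⟩
      c * (K * r ^ (k ℕ.+ N)) + K * (r ^ N - r ^ (k ℕ.+ N))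
        ≡⟨ solve 4 (λ c K a b → c :* (K :* b) :+ K :* (a :- b) := K :* (a :- (con 1ℚ :- c) :* b)) refl
             c K (r ^ N) (r ^ (k ℕ.+ N)) ⟩
      K * (r ^ N - r ^ (suc k ℕ.+ N)) ∎

  ^-vanishes : ∀ c → 0ℚ < c → c ≤ 1ℚ → ∀ δ → 0ℚ < δ → ∃[ n ] (1ℚ - c) ^ n < δ
  ^-vanishes c c>0 c≤1 δ δ>0 =
    let β , _ , cδβ≡1 = quotient (c * δ) 1ℚ (pos* c>0 δ>0) 0<1
        n , β≤n = archimedes β
    in n , ℚₚ.≰⇒> λ δ≤r → <⇒≱ δ>0 (begin
    δ                              ≡⟨ solve 2 (λ δ x → δ := (δ :+ x) :- x) refl δ 1ℚ ⟩
    (δ + 1ℚ) - 1ℚ                  ≤⟨ ℚₚ.+-monoˡ-≤ (- 1ℚ) (begin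
      δ + 1ℚ                         ≡⟨ cong (δ +_) (sym cδβ≡1) ⟩
      δ + (c * δ) * β                ≤⟨ ℚₚ.+-monoʳ-≤ δ (*-monoʳ (ℚₚ.<⇒≤ (pos* c>0 δ>0))
                                          (ℚₚ.≤-trans (x≤∣x∣ β) β≤n)) ⟩
      δ + (c * δ) * ι n              ≡⟨ solve 3 (λ c δ n → δ :+ (c :* δ) :* n := δ :* (con 1ℚ :+ n :* c)) refl c δ (ι n) ⟩
      δ * (1ℚ + ι n * c)             ≤⟨ *-monoˡ (nn+ (ℚₚ.<⇒≤ 0<1) (nn* (ι≥0 n) c≥0)) δ≤r ⟩
      (1ℚ - c) ^ n * (1ℚ + ι n * c)  ≤⟨ bernoulli n ⟩
      1ℚ                             ∎) ⟩
    0ℚ                             ∎)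
    where
    c≥0 : 0ℚ ≤ c
    c≥0 = ℚₚ.<⇒≤ c>0
    bernoulli : ∀ n → (1ℚ - c) ^ n * (1ℚ + ι n * c) ≤ 1ℚ
    bernoulli zero = ℚₚ.≤-reflexive (solve 1 (λ c → con 1ℚ :* (con 1ℚ :+ con 0ℚ :* c) := con 1ℚ) refl c)
    bernoulli (suc n) = ℚₚ.≤-trans (≤-cert (nn* (^≥0 (sub≥0 c≤1) n) (nn* (ι≥0 (suc n)) (nn* c≥0 c≥0)))
      (trans (cong (λ z → p * (1ℚ + ι n * c) - (1ℚ - c) * p * (1ℚ + z * c)) (ι-+ 1 n))
      (trans (solve 3 (λ p n c → p :* (con 1ℚ :+ n :* c) :- (con 1ℚ :- c) :* p :* (con 1ℚ :+ (con 1ℚ :+ n) :* c)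
                              := p :* ((con 1ℚ :+ n) :* (c :* c))) refl p (ι n) c)
             (cong (λ z → p * (z * (c * c))) (sym (ι-+ 1 n))))))
      (bernoulli n)
      where
      p : ℚ
      p = (1ℚ - c) ^ n

  geometric-cauchy : (s : ℕ → ℚ) → ∀ K c → 0ℚ < K → 0ℚ < c → c ≤ 1ℚ →
    (∀ n → ∣ s (suc n) - s n ∣ ≤ K * (1ℚ - c) ^ n) → IsCauchy s
  geometric-cauchy s K c K>0 c>0 c≤1 h ε ε>0 = N , λ m n m≥ n≥ → *-cancelˡ< c>0 (begin-strict
    c * ∣ s m - s n ∣                       ≤⟨ *-monoʳ c≥0 (triangle (s m) (s N) (s n)) ⟩
    c * (∣ s m - s N ∣ + ∣ s N - s n ∣)     ≡⟨ cong (λ z → c * (∣ s m - s N ∣ + z)) (∣-∣-sym (s N) (s n)) ⟩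
    c * (∣ s m - s N ∣ + ∣ s n - s N ∣)     ≡⟨ ℚₚ.*-distribˡ-+ c ∣ s m - s N ∣ ∣ s n - s N ∣ ⟩
    c * ∣ s m - s N ∣ + c * ∣ s n - s N ∣   <⟨ ℚₚ.+-mono-< (close m m≥) (close n n≥) ⟩
    K * δ + K * δ                           ≡⟨ sym (ℚₚ.*-distribʳ-+ δ K K) ⟩
    (K + K) * δ                             ≡⟨ eq ⟩
    c * ε                                   ∎)
    where
    δ : ℚ
    δ = proj₁ (quotient (K + K) (c * ε) (ℚₚ.+-mono-< K>0 K>0) (pos* c>0 ε>0))
    δ>0 : 0ℚ < δ
    δ>0 = proj₁ (proj₂ (quotient (K + K) (c * ε) (ℚₚ.+-mono-< K>0 K>0) (pos* c>0 ε>0)))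
    eq : (K + K) * δ ≡ c * ε
    eq = proj₂ (proj₂ (quotient (K + K) (c * ε) (ℚₚ.+-mono-< K>0 K>0) (pos* c>0 ε>0)))
    N : ℕ
    N = proj₁ (^-vanishes c c>0 c≤1 δ δ>0)
    r<δ : (1ℚ - c) ^ N < δ
    r<δ = proj₂ (^-vanishes c c>0 c≤1 δ δ>0)
    c≥0 : 0ℚ ≤ c
    c≥0 = ℚₚ.<⇒≤ c>0
    close : ∀ m → N ℕ.≤ m → c * ∣ s m - s N ∣ < K * δ
    close m m≥ = ℚₚ.≤-<-trans
      (subst (λ i → c * ∣ s i - s N ∣ ≤ K * (1ℚ - c) ^ N) (ℕₚ.m∸n+n≡m m≥)
        (geometric s K c (ℚₚ.<⇒≤ K>0) c≥0 c≤1 h N (m ℕ.∸ N)))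
      (ℚₚ.*-monoʳ-<-pos K {{ Rat.positive K>0 }} r<δ)

  shift-cauchy : ∀ {s} k → IsCauchy (λ n → s (k ℕ.+ n)) → IsCauchy s
  shift-cauchy {s} k h ε ε>0 with h ε ε>0
  ... | N , g = k ℕ.+ N , λ m n m≥ n≥ →
    subst₂ (λ i j → ∣ s i - s j ∣ < ε)
      (ℕₚ.m+[n∸m]≡n (ℕₚ.≤-trans (ℕₚ.m≤m+n k N) m≥)) (ℕₚ.m+[n∸m]≡n (ℕₚ.≤-trans (ℕₚ.m≤m+n k N) n≥))
      (g (m ℕ.∸ k) (n ℕ.∸ k) (shift m≥) (shift n≥))
    where
    shift : ∀ {i} → k ℕ.+ N ℕ.≤ i → N ℕ.≤ i ℕ.∸ k
    shift {i} h = ℕₚ.m+n≤o⇒m≤o∸n N (subst (ℕ._≤ i) (ℕₚ.+-comm k N) h)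

  Dominated : (ℚ → ℕ → ℚ) → Set
  Dominated t = ∀ b → Σ[ M ∈ ℚ ] 0ℚ < M
    × (∀ k a → ∣ a ∣ ≤ ι b → ∣ t a k ∣ ≤ M * ½ ^ k)
    × (∀ k a a′ → ∣ a ∣ ≤ ι b → ∣ a′ ∣ ≤ ι b → ∣ t a k - t a′ k ∣ ≤ (M * ∣ a - a′ ∣) * ½ ^ k)

  ½≥0 : 0ℚ ≤ ½
  ½≥0 = ℚₚ.nonNegative⁻¹ ½

  ½>0 : 0ℚ < ½
  ½>0 = ℚₚ.positive⁻¹ ½

  ½≤1 : ½ ≤ 1ℚ
  ½≤1 = ℚₚ.≤ᵇ⇒≤ _

  Σ<-step : ∀ n t → Σ< (suc n) t - Σ< n t ≡ t n
  Σ<-step n t = solve 2 (λ s x → (s :+ x) :- s := x) refl (Σ< n t) (t n)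

  Σ<-step₂ : ∀ n t u → (Σ< (suc n) t - Σ< (suc n) u) - (Σ< n t - Σ< n u) ≡ t n - u n
  Σ<-step₂ n t u = solve 4 (λ s x r y → ((s :+ x) :- (r :+ y)) :- (s :- r) := x :- y) refl
    (Σ< n t) (t n) (Σ< n u) (u n)

  Σ<-tail : ∀ t M → 0ℚ ≤ M → (∀ k → ∣ t k ∣ ≤ M * ½ ^ k) →
    ∀ {N m} → N ℕ.≤ m → ½ * ∣ Σ< m t - Σ< N t ∣ ≤ M * ½ ^ N
  Σ<-tail t M M≥0 h {N} {m} N≤m =
    subst (λ i → ½ * ∣ Σ< i t - Σ< N t ∣ ≤ M * ½ ^ N) (ℕₚ.m∸n+n≡m N≤m)
      (geometric (λ n → Σ< n t) M ½ M≥0 ½≥0 ½≤1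
        (λ n → subst (λ z → ∣ z ∣ ≤ M * ½ ^ n) (sym (Σ<-step n t)) (h n)) N (m ℕ.∸ N))

  Σ<-lipschitz : ∀ t u K → 0ℚ ≤ K → (∀ k → ∣ t k - u k ∣ ≤ K * ½ ^ k) →
    ∀ n → ½ * ∣ Σ< n t - Σ< n u ∣ ≤ K
  Σ<-lipschitz t u K K≥0 h n = begin
    ½ * ∣ Σ< n t - Σ< n u ∣
      ≡⟨ cong (λ z → ½ * ∣ z ∣) (solve 1 (λ x → x := x :- (con 0ℚ :- con 0ℚ)) refl (Σ< n t - Σ< n u)) ⟩
    ½ * ∣ (Σ< n t - Σ< n u) - (0ℚ - 0ℚ) ∣
      ≡⟨ cong (λ i → ½ * ∣ (Σ< i t - Σ< i u) - (0ℚ - 0ℚ) ∣) (sym (ℕₚ.+-identityʳ n)) ⟩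
    ½ * ∣ (Σ< (n ℕ.+ 0) t - Σ< (n ℕ.+ 0) u) - (0ℚ - 0ℚ) ∣
      ≤⟨ geometric (λ n → Σ< n t - Σ< n u) K ½ K≥0 ½≥0 ½≤1
           (λ n → subst (λ z → ∣ z ∣ ≤ K * ½ ^ n) (sym (Σ<-step₂ n t u)) (h n)) 0 n ⟩
    K * 1ℚ
      ≡⟨ ℚₚ.*-identityʳ K ⟩
    K ∎

  series-cauchy : ∀ t s → Dominated t → IsCauchy s → IsCauchy (λ n → Σ< n (t (s n)))
  series-cauchy t s dom cs ε ε>0 =
    let b , N₁ , bdd = bounded cs
        M , M>0 , small , lip = dom b
        δ , δ>0 , eq = quotient ((M + M) + M) (½ * ε)
                         (ℚₚ.+-mono-< (ℚₚ.+-mono-< M>0 M>0) M>0) (pos* ½>0 ε>0)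
        N₂ , ½^N₂<δ = ^-vanishes ½ ½>0 ½≤1 δ δ>0
        N₃ , close = cs δ δ>0
        M≥0 = ℚₚ.<⇒≤ M>0
        N₁≤ = ℕₚ.m≤m+n N₁ (N₂ ℕ.+ N₃)
        N₂≤ = ℕₚ.≤-trans (ℕₚ.m≤m+n N₂ N₃) (ℕₚ.m≤n+m (N₂ ℕ.+ N₃) N₁)
        N₃≤ = ℕₚ.≤-trans (ℕₚ.m≤n+m N₃ N₂) (ℕₚ.m≤n+m (N₂ ℕ.+ N₃) N₁)
    in N₁ ℕ.+ (N₂ ℕ.+ N₃) , λ m n m≥ n≥ →
      let ∣sm∣≤b = bdd m (ℕₚ.≤-trans N₁≤ m≥)
          ∣sn∣≤b = bdd n (ℕₚ.≤-trans N₁≤ n≥)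
          A = Σ< m (t (s m))
          B = Σ< N₂ (t (s m))
          C = Σ< N₂ (t (s n))
          D = Σ< n (t (s n))
      in *-cancelˡ< ½>0 (begin-strict
        ½ * ∣ A - D ∣
          ≤⟨ *-monoʳ ½≥0 (ℚₚ.≤-trans (triangle A C D) (ℚₚ.+-monoˡ-≤ ∣ C - D ∣ (triangle A B C))) ⟩
        ½ * ((∣ A - B ∣ + ∣ B - C ∣) + ∣ C - D ∣)
          ≡⟨ cong (λ z → ½ * ((∣ A - B ∣ + ∣ B - C ∣) + z)) (∣-∣-sym C D) ⟩
        ½ * ((∣ A - B ∣ + ∣ B - C ∣) + ∣ D - C ∣)
          ≡⟨ solve 4 (λ h x y z → h :* ((x :+ y) :+ z) := (h :* x :+ h :* y) :+ h :* z) refl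
               ½ (∣ A - B ∣) (∣ B - C ∣) (∣ D - C ∣) ⟩
        (½ * ∣ A - B ∣ + ½ * ∣ B - C ∣) + ½ * ∣ D - C ∣
          ≤⟨ ℚₚ.+-mono-≤ (ℚₚ.+-mono-≤
               (Σ<-tail (t (s m)) M M≥0 (λ k → small k (s m) ∣sm∣≤b) (ℕₚ.≤-trans N₂≤ m≥))
               (Σ<-lipschitz (t (s m)) (t (s n)) (M * ∣ s m - s n ∣) (nn* M≥0 (ℚₚ.0≤∣p∣ (s m - s n)))
                 (λ k → lip k (s m) (s n) ∣sm∣≤b ∣sn∣≤b) N₂))
               (Σ<-tail (t (s n)) M M≥0 (λ k → small k (s n) ∣sn∣≤b) (ℕₚ.≤-trans N₂≤ n≥)) ⟩
        (M * ½ ^ N₂ + M * ∣ s m - s n ∣) + M * ½ ^ N₂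
          <⟨ ℚₚ.+-mono-< (ℚₚ.+-mono-< (scale M>0 ½^N₂<δ)
               (scale M>0 (close m n (ℕₚ.≤-trans N₃≤ m≥) (ℕₚ.≤-trans N₃≤ n≥))))
               (scale M>0 ½^N₂<δ) ⟩
        (M * δ + M * δ) + M * δ
          ≡⟨ solve 2 (λ M δ → (M :* δ :+ M :* δ) :+ M :* δ := ((M :+ M) :+ M) :* δ) refl M δ ⟩
        ((M + M) + M) * δ
          ≡⟨ eq ⟩
        ½ * ε ∎)
    where
    scale : ∀ {r p q} → 0ℚ < r → p < q → r * p < r * q
    scale {r} r>0 = ℚₚ.*-monoʳ-<-pos r {{ Rat.positive r>0 }}

  ^≤^!  : ∀ c j → suc c ℕ.^ j ℕ.≤ suc c ℕ.^ suc c ℕ.* j !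
  ^≤^! c zero = ℕₚ.≤-trans (ℕₚ.m^n>0 (suc c) (suc c)) (ℕₚ.≤-reflexive (sym (ℕₚ.*-identityʳ _)))
  ^≤^! c (suc j) with ℕₚ.≤-total (suc c) (suc j)
  ... | inj₁ c≤j = ℕₚ.≤-trans (ℕₚ.*-mono-≤ c≤j (^≤^! c j)) (ℕₚ.≤-reflexive
          (trans (sym (ℕₚ.*-assoc (suc j) (suc c ℕ.^ suc c) (j !)))
          (trans (cong (ℕ._* j !) (ℕₚ.*-comm (suc j) (suc c ℕ.^ suc c)))
                 (ℕₚ.*-assoc (suc c ℕ.^ suc c) (suc j) (j !)))))
  ... | inj₂ j≤c = ℕₚ.≤-trans (ℕₚ.^-monoʳ-≤ (suc c) j≤c)
          (ℕₚ.m≤m*n (suc c ℕ.^ suc c) (suc j !) {{ suc j ℕₚ.!≢0 }})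

  ^-lipschitz : ∀ {B} → 1ℚ ≤ B → ∀ a a′ → ∣ a ∣ ≤ B → ∣ a′ ∣ ≤ B →
    ∀ j → ∣ a ^ j - a′ ^ j ∣ ≤ (B + B) ^ j * ∣ a - a′ ∣
  ^-lipschitz {B} 1≤B a a′ a≤B a′≤B = go
    where
    d : ℚ
    d = ∣ a - a′ ∣
    d≥0 : 0ℚ ≤ d
    d≥0 = ℚₚ.0≤∣p∣ (a - a′)
    B≥0 : 0ℚ ≤ B
    B≥0 = ℚₚ.≤-trans (ℚₚ.<⇒≤ 0<1) 1≤B
    pow : ∀ j → ∣ a′ ^ j ∣ ≤ (B + B) ^ j
    pow j = ℚₚ.≤-trans (ℚₚ.≤-reflexive (∣^∣ a′ j))
      (^-mono (ℚₚ.0≤∣p∣ a′) (ℚₚ.≤-trans a′≤B (≤-cert B≥0 (solve 1 (λ B → (B :+ B) :- B := B) refl B))) j)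
    go : ∀ j → ∣ a ^ j - a′ ^ j ∣ ≤ (B + B) ^ j * d
    go zero    = nn* {1ℚ} (ℚₚ.<⇒≤ 0<1) d≥0
    go (suc j) = begin
      ∣ a * a ^ j - a′ * a′ ^ j ∣
        ≡⟨ cong ∣_∣ (solve 4 (λ a a′ p q → a :* p :- a′ :* q := a :* (p :- q) :+ q :* (a :- a′)) refl
             a a′ (a ^ j) (a′ ^ j)) ⟩
      ∣ a * (a ^ j - a′ ^ j) + a′ ^ j * (a - a′) ∣
        ≤⟨ ℚₚ.∣p+q∣≤∣p∣+∣q∣ (a * (a ^ j - a′ ^ j)) (a′ ^ j * (a - a′)) ⟩
      ∣ a * (a ^ j - a′ ^ j) ∣ + ∣ a′ ^ j * (a - a′) ∣
        ≡⟨ cong₂ _+_ (ℚₚ.∣p*q∣≡∣p∣*∣q∣ a (a ^ j - a′ ^ j)) (ℚₚ.∣p*q∣≡∣p∣*∣q∣ (a′ ^ j) (a - a′)) ⟩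
      ∣ a ∣ * ∣ a ^ j - a′ ^ j ∣ + ∣ a′ ^ j ∣ * d
        ≤⟨ ℚₚ.+-mono-≤ (*-mono (ℚₚ.0≤∣p∣ a) (ℚₚ.0≤∣p∣ (a ^ j - a′ ^ j)) a≤B (go j))
             (*-monoˡ d≥0 (pow j)) ⟩
      B * ((B + B) ^ j * d) + (B + B) ^ j * d
        ≤⟨ ≤-cert (nn* (sub≥0 1≤B) (nn* (^≥0 (nn+ B≥0 B≥0) j) d≥0))
             (solve 3 (λ B p d → ((B :+ B) :* p) :* d :- (B :* (p :* d) :+ p :* d)
                              := (B :- con 1ℚ) :* (p :* d)) refl B ((B + B) ^ j) d) ⟩
      (B + B) ^ suc j * d ∎

  ½^-anti : ∀ {m n} → m ℕ.≤ n → ½ ^ n ≤ ½ ^ m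
  ½^-anti {m} {n} m≤n = subst (λ i → ½ ^ i ≤ ½ ^ m) (ℕₚ.m∸n+n≡m m≤n) (go (n ℕ.∸ m))
    where
    go : ∀ o → ½ ^ (o ℕ.+ m) ≤ ½ ^ m
    go zero    = ℚₚ.≤-refl
    go (suc o) = ℚₚ.≤-trans (≤-cert (nn* ½≥0 (^≥0 ½≥0 (o ℕ.+ m)))
      (solve 1 (λ p → p :- con ½ :* p := con ½ :* p) refl (½ ^ (o ℕ.+ m)))) (go o)

  ∣sign∣ : ∀ k x → ∣ (- 1ℚ) ^ k * x ∣ ≡ ∣ x ∣
  ∣sign∣ k x = trans (ℚₚ.∣p*q∣≡∣p∣*∣q∣ ((- 1ℚ) ^ k) x)
    (trans (cong (_* ∣ x ∣) (trans (∣^∣ (- 1ℚ) k) (1^ k))) (ℚₚ.*-identityˡ ∣ x ∣))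

  ∣*∣ : ∀ x {u} → 0ℚ ≤ u → ∣ x * u ∣ ≡ ∣ x ∣ * u
  ∣*∣ x {u} u≥0 = trans (ℚₚ.∣p*q∣≡∣p∣*∣q∣ x u) (cong (∣ x ∣ *_) (ℚₚ.0≤p⇒∣p∣≡p u≥0))

  taylor-dominated : (j : ℕ → ℕ) → (∀ k → k ℕ.≤ j k) →
    Dominated (λ a k → (- 1ℚ) ^ k * (a ^ j k * 1/ j k !))
  taylor-dominated j k≤j b = M , M>0 , small , lip
    where
    c : ℕ
    c = 3 ℕ.+ 4 ℕ.* b
    B M : ℚ
    B = 1ℚ + ι b
    M = ι (suc c ℕ.^ suc c)
    M>0 : 0ℚ < M
    M>0 = ℚₚ.<-≤-trans 0<1 (ι-mono {1} {suc c ℕ.^ suc c} (ℕₚ.m^n>0 (suc c) (suc c)))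
    M≥0 : 0ℚ ≤ M
    M≥0 = ℚₚ.<⇒≤ M>0
    1≤B : 1ℚ ≤ B
    1≤B = ≤-cert (ι≥0 b) (solve 1 (λ b → (con 1ℚ :+ b) :- con 1ℚ := b) refl (ι b))
    b≤B : ι b ≤ B
    b≤B = ≤-cert (ℚₚ.<⇒≤ 0<1) (solve 1 (λ b → (con 1ℚ :+ b) :- b := con 1ℚ) refl (ι b))
    B≥0 : 0ℚ ≤ B
    B≥0 = ℚₚ.≤-trans (ι≥0 b) b≤B
    2B : B + B ≡ ½ * ι (suc c)
    2B = sym (trans (cong (½ *_) (trans (ι-+ 4 (4 ℕ.* b)) (cong (ι 4 +_) (ι-* 4 b))))
      (solve 1 (λ b → con ½ :* (con (ι 4) :+ con (ι 4) :* b) := (con 1ℚ :+ b) :+ (con 1ℚ :+ b)) refl (ι b)))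
    power : ∀ i → (B + B) ^ i * 1/ i ! ≤ M * ½ ^ i
    power i = begin
      (B + B) ^ i * 1/ i !               ≡⟨ cong (λ z → z ^ i * 1/ i !) 2B ⟩
      (½ * ι (suc c)) ^ i * 1/ i !       ≡⟨ cong (_* 1/ i !) (*-^ ½ (ι (suc c)) i) ⟩
      (½ ^ i * ι (suc c) ^ i) * 1/ i !   ≡⟨ cong (λ z → (½ ^ i * z) * 1/ i !) (sym (ι-^ (suc c) i)) ⟩
      (½ ^ i * ι (suc c ℕ.^ i)) * 1/ i ! ≤⟨ *-monoˡ (1/!≥0 i) (*-monoʳ (^≥0 ½≥0 i) (ι-mono (^≤^! c i))) ⟩
      (½ ^ i * ι (suc c ℕ.^ suc c ℕ.* i !)) * 1/ i !
                                         ≡⟨ cong (λ z → (½ ^ i * z) * 1/ i !) (ι-* (suc c ℕ.^ suc c) (i !)) ⟩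
      (½ ^ i * (M * ι (i !))) * 1/ i !
        ≡⟨ solve 4 (λ h M f u → (h :* (M :* f)) :* u := (M :* h) :* (u :* f)) refl (½ ^ i) M (ι (i !)) (1/ i !) ⟩
      (M * ½ ^ i) * (1/ i ! * ι (i !))   ≡⟨ cong ((M * ½ ^ i) *_) (1/!-inverse i) ⟩
      (M * ½ ^ i) * 1ℚ                   ≡⟨ ℚₚ.*-identityʳ _ ⟩
      M * ½ ^ i                          ∎
    small : ∀ k a → ∣ a ∣ ≤ ι b → ∣ (- 1ℚ) ^ k * (a ^ j k * 1/ j k !) ∣ ≤ M * ½ ^ k
    small k a a≤b = begin
      ∣ (- 1ℚ) ^ k * (a ^ j k * 1/ j k !) ∣ ≡⟨ ∣sign∣ k _ ⟩
      ∣ a ^ j k * 1/ j k ! ∣                ≡⟨ ∣*∣ (a ^ j k) (1/!≥0 (j k)) ⟩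
      ∣ a ^ j k ∣ * 1/ j k !                ≡⟨ cong (_* 1/ j k !) (∣^∣ a (j k)) ⟩
      ∣ a ∣ ^ j k * 1/ j k !                ≤⟨ *-monoˡ (1/!≥0 (j k)) (^-mono (ℚₚ.0≤∣p∣ a)
                                                (ℚₚ.≤-trans a≤b (ℚₚ.≤-trans b≤B
                                                  (≤-cert B≥0 (solve 1 (λ B → (B :+ B) :- B := B) refl B)))) (j k)) ⟩
      (B + B) ^ j k * 1/ j k !              ≤⟨ power (j k) ⟩
      M * ½ ^ j k                           ≤⟨ *-monoʳ M≥0 (½^-anti (k≤j k)) ⟩
      M * ½ ^ k                             ∎
    lip : ∀ k a a′ → ∣ a ∣ ≤ ι b → ∣ a′ ∣ ≤ ι b →
      ∣ (- 1ℚ) ^ k * (a ^ j k * 1/ j k !) - (- 1ℚ) ^ k * (a′ ^ j k * 1/ j k !) ∣ ≤ (M * ∣ a - a′ ∣) * ½ ^ k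
    lip k a a′ a≤b a′≤b = begin
      ∣ (- 1ℚ) ^ k * (a ^ j k * 1/ j k !) - (- 1ℚ) ^ k * (a′ ^ j k * 1/ j k !) ∣
        ≡⟨ cong ∣_∣ (solve 4 (λ s p q u → s :* (p :* u) :- s :* (q :* u) := s :* ((p :- q) :* u)) refl
             ((- 1ℚ) ^ k) (a ^ j k) (a′ ^ j k) (1/ j k !)) ⟩
      ∣ (- 1ℚ) ^ k * ((a ^ j k - a′ ^ j k) * 1/ j k !) ∣
        ≡⟨ ∣sign∣ k _ ⟩
      ∣ (a ^ j k - a′ ^ j k) * 1/ j k ! ∣
        ≡⟨ ∣*∣ (a ^ j k - a′ ^ j k) (1/!≥0 (j k)) ⟩
      ∣ a ^ j k - a′ ^ j k ∣ * 1/ j k !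
        ≤⟨ *-monoˡ (1/!≥0 (j k)) (^-lipschitz 1≤B a a′ (ℚₚ.≤-trans a≤b b≤B) (ℚₚ.≤-trans a′≤b b≤B) (j k)) ⟩
      ((B + B) ^ j k * ∣ a - a′ ∣) * 1/ j k !
        ≡⟨ solve 3 (λ p d u → (p :* d) :* u := d :* (p :* u)) refl ((B + B) ^ j k) ∣ a - a′ ∣ (1/ j k !) ⟩
      ∣ a - a′ ∣ * ((B + B) ^ j k * 1/ j k !)
        ≤⟨ *-monoʳ (ℚₚ.0≤∣p∣ (a - a′)) (ℚₚ.≤-trans (power (j k)) (*-monoʳ M≥0 (½^-anti (k≤j k)))) ⟩
      ∣ a - a′ ∣ * (M * ½ ^ k)
        ≡⟨ solve 3 (λ d M h → d :* (M :* h) := (M :* d) :* h) refl ∣ a - a′ ∣ M (½ ^ k) ⟩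
      (M * ∣ a - a′ ∣) * ½ ^ k ∎

  sin-cauchy : ∀ s → IsCauchy s → IsCauchy (λ n → sinSum n (s n))
  sin-cauchy s = series-cauchy sinTerm s
    (taylor-dominated (λ k → suc (2 ℕ.* k)) (λ k → ℕₚ.m≤n⇒m≤1+n (ℕₚ.m≤n*m k 2)))

  cos-cauchy : ∀ s → IsCauchy s → IsCauchy (λ n → cosSum n (s n))
  cos-cauchy s = series-cauchy cosTerm s
    (taylor-dominated (λ k → 2 ℕ.* k) (λ k → ℕₚ.m≤n*m k 2))

  sqrt11Approx : ℕ → ℚ
  sqrt11Approx zero    = ι 3
  sqrt11Approx (suc n) = sqrt11Approx n + (ι 11 - sqrt11Approx n * sqrt11Approx n) * (ℤ.+ 1 / 7)

  sqrt11-range : ∀ n → ι 3 ≤ sqrt11Approx n × sqrt11Approx n ≤ ι 4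
  sqrt11-range zero    = ℚₚ.≤-refl , ℚₚ.≤ᵇ⇒≤ _
  sqrt11-range (suc n) =
    let 3≤x , x≤4 = sqrt11-range n in
    ≤-cert (nn* 1/7≥0 (nn+ (nn* (sub≥0 3≤x) (sub≥0 x≤4)) (ι≥0 2)))
      (solve 1 (λ x → (x :+ (con (ι 11) :- x :* x) :* con (ℤ.+ 1 / 7)) :- con (ι 3)
                   := con (ℤ.+ 1 / 7) :* ((x :- con (ι 3)) :* (con (ι 4) :- x) :+ con (ι 2))) refl (sqrt11Approx n))
    , ≤-cert (nn* 1/7≥0 (nn+ (nn* (sub≥0 3≤x) (sub≥0 3≤x)) (nn+ (sub≥0 x≤4) (ι≥0 4))))
      (solve 1 (λ x → con (ι 4) :- (x :+ (con (ι 11) :- x :* x) :* con (ℤ.+ 1 / 7))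
                   := con (ℤ.+ 1 / 7) :* ((x :- con (ι 3)) :* (x :- con (ι 3)) :+ ((con (ι 4) :- x) :+ con (ι 4))))
         refl (sqrt11Approx n))
    where
    1/7≥0 : 0ℚ ≤ ℤ.+ 1 / 7
    1/7≥0 = ℚₚ.≤ᵇ⇒≤ _

  sqrt11-cauchy : IsCauchy sqrt11Approx
  sqrt11-cauchy = geometric-cauchy sqrt11Approx 1ℚ (ℤ.+ 6 / 7) 0<1
    (ℚₚ.positive⁻¹ (ℤ.+ 6 / 7)) (ℚₚ.≤ᵇ⇒≤ _) step
    where
    e : ℚ
    e = ℤ.+ 1 / 7
    e≥0 : 0ℚ ≤ e
    e≥0 = ℚₚ.≤ᵇ⇒≤ _
    contract : ∀ a b → ι 3 ≤ a → a ≤ ι 4 → ι 3 ≤ b → b ≤ ι 4 →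
      ∣ (b + (ι 11 - b * b) * e) - (a + (ι 11 - a * a) * e) ∣ ≤ ∣ b - a ∣ * e
    contract a b 3≤a a≤4 3≤b b≤4 = begin
      ∣ (b + (ι 11 - b * b) * e) - (a + (ι 11 - a * a) * e) ∣
        ≡⟨ cong ∣_∣ (solve 2 (λ a b →
             (b :+ (con (ι 11) :- b :* b) :* con e) :- (a :+ (con (ι 11) :- a :* a) :* con e)
             := (b :- a) :* (con 1ℚ :- (a :+ b) :* con e)) refl a b) ⟩
      ∣ (b - a) * (1ℚ - (a + b) * e) ∣
        ≡⟨ ℚₚ.∣p*q∣≡∣p∣*∣q∣ (b - a) (1ℚ - (a + b) * e) ⟩
      ∣ b - a ∣ * ∣ 1ℚ - (a + b) * e ∣
        ≤⟨ *-monoʳ (ℚₚ.0≤∣p∣ (b - a)) (∣∣-≤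
             (≤-cert (nn* e≥0 (nn+ (sub≥0 3≤a) (sub≥0 3≤b)))
               (solve 2 (λ a b → con e :- (con 1ℚ :- (a :+ b) :* con e)
                              := con e :* ((a :- con (ι 3)) :+ (b :- con (ι 3)))) refl a b))
             (≤-cert (nn* e≥0 (nn+ (sub≥0 a≤4) (sub≥0 b≤4)))
               (solve 2 (λ a b → con e :- (:- (con 1ℚ :- (a :+ b) :* con e))
                              := con e :* ((con (ι 4) :- a) :+ (con (ι 4) :- b))) refl a b))) ⟩
      ∣ b - a ∣ * e ∎
    step : ∀ n → ∣ sqrt11Approx (suc n) - sqrt11Approx n ∣ ≤ 1ℚ * (1ℚ - (ℤ.+ 6 / 7)) ^ n
    step zero    = ℚₚ.≤ᵇ⇒≤ _
    step (suc n) = begin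
      ∣ sqrt11Approx (suc (suc n)) - sqrt11Approx (suc n) ∣
        ≤⟨ contract (sqrt11Approx n) (sqrt11Approx (suc n))
             (proj₁ (sqrt11-range n)) (proj₂ (sqrt11-range n))
             (proj₁ (sqrt11-range (suc n))) (proj₂ (sqrt11-range (suc n))) ⟩
      ∣ sqrt11Approx (suc n) - sqrt11Approx n ∣ * e
        ≤⟨ *-monoˡ e≥0 (step n) ⟩
      (1ℚ * (1ℚ - (ℤ.+ 6 / 7)) ^ n) * e
        ≡⟨ solve 1 (λ p → (con 1ℚ :* p) :* con e := con 1ℚ :* (con (1ℚ - (ℤ.+ 6 / 7)) :* p)) refl
             ((1ℚ - (ℤ.+ 6 / 7)) ^ n) ⟩
      1ℚ * (1ℚ - (ℤ.+ 6 / 7)) ^ suc n ∎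

  sqrt11-null : IsNull (λ n → ι 11 - sqrt11Approx n * sqrt11Approx n)
  sqrt11-null ε ε>0 = proj₁ c , λ n n≥ → *-cancelˡ< {ℤ.+ 1 / 7} (ℚₚ.positive⁻¹ (ℤ.+ 1 / 7))
    (subst (_< (ℤ.+ 1 / 7) * ε) (sym (eq (sqrt11Approx n)))
      (proj₂ c (suc n) n (ℕₚ.m≤n⇒m≤1+n n≥) n≥))
    where
    c = sqrt11-cauchy ((ℤ.+ 1 / 7) * ε) (pos* {ℤ.+ 1 / 7} (ℚₚ.positive⁻¹ (ℤ.+ 1 / 7)) ε>0)
    eq : ∀ x → (ℤ.+ 1 / 7) * ∣ ι 11 - x * x ∣ ≡ ∣ (x + (ι 11 - x * x) * (ℤ.+ 1 / 7)) - x ∣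
    eq x = sym (trans
      (cong ∣_∣ (solve 2 (λ x z → (x :+ z :* con (ℤ.+ 1 / 7)) :- x := z :* con (ℤ.+ 1 / 7)) refl x (ι 11 - x * x)))
      (trans (∣*∣ (ι 11 - x * x) {ℤ.+ 1 / 7} (ℚₚ.≤ᵇ⇒≤ _)) (ℚₚ.*-comm (∣ ι 11 - x * x ∣) (ℤ.+ 1 / 7))))

  halfπApprox : ℕ → ℚ
  halfπApprox zero    = 1ℚ
  halfπApprox (suc n) = halfπApprox n + cosSum n (halfπApprox n)

  private

    9/10 ρ : ℚ
    9/10 = ℤ.+ 9 / 10
    ρ    = 1ℚ - 9/10

    coeff : ℕ → ℚ
    coeff j = 1/ (2 ℕ.* (3 ℕ.+ j)) !

    coeff≥0 : ∀ j → 0ℚ ≤ coeff j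
    coeff≥0 j = 1/!≥0 (2 ℕ.* (3 ℕ.+ j))

    coeff-suc : ∀ j → ι 56 * coeff (suc j) ≤ coeff j
    coeff-suc j = begin
      ι 56 * coeff (suc j)
        ≡⟨ cong (λ i → ι 56 * 1/ i !) (ℕₚ.*-suc 2 (3 ℕ.+ j)) ⟩
      ι 56 * 1/ suc (suc n) !
        ≤⟨ *-monoˡ (1/!≥0 (suc (suc n))) (ι-mono {56} {suc n ℕ.* suc (suc n)}
             (ℕₚ.*-mono-≤ {7} {suc n} {8} {suc (suc n)} (ℕ.s≤s 6≤n) (ℕ.s≤s (ℕ.s≤s 6≤n)))) ⟩
      ι (suc n ℕ.* suc (suc n)) * 1/ suc (suc n) !
        ≡⟨ cong (_* 1/ suc (suc n) !) (ι-* (suc n) (suc (suc n))) ⟩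
      (ι (suc n) * ι (suc (suc n))) * 1/ suc (suc n) !
        ≡⟨ ℚₚ.*-assoc (ι (suc n)) (ι (suc (suc n))) (1/ suc (suc n) !) ⟩
      ι (suc n) * (ι (suc (suc n)) * 1/ suc (suc n) !)
        ≡⟨ cong (ι (suc n) *_) (sym (1/!-suc (suc n))) ⟩
      ι (suc n) * 1/ suc n !
        ≡⟨ sym (1/!-suc n) ⟩
      1/ n ! ∎
      where
      n : ℕ
      n = 2 ℕ.* (3 ℕ.+ j)
      6≤n : 6 ℕ.≤ n
      6≤n = ℕₚ.*-monoʳ-≤ 2 (ℕₚ.m≤m+n 3 j)

    ≤2⇒sq≤4 : ∀ {x} → 0ℚ ≤ x → x ≤ ι 2 → x * x ≤ ι 4
    ≤2⇒sq≤4 x≥0 x≤2 = *-mono x≥0 x≥0 x≤2 x≤2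

    module _ (x : ℚ) (x≥0 : 0ℚ ≤ x) (x≤2 : x ≤ ι 2) where

      pow : ℕ → ℚ
      pow j = x ^ (2 ℕ.* (3 ℕ.+ j))

      pow≥0 : ∀ j → 0ℚ ≤ pow j
      pow≥0 j = ^≥0 x≥0 (2 ℕ.* (3 ℕ.+ j))

      pow-suc : ∀ j → pow (suc j) ≡ (x * x) * pow j
      pow-suc j = trans (cong (x ^_) (ℕₚ.*-suc 2 (3 ℕ.+ j))) (sym (ℚₚ.*-assoc x x (pow j)))

      bound : ℚ
      bound = x ^ 4 * (ℤ.+ 1 / 180)

      bound≥0 : 0ℚ ≤ bound
      bound≥0 = nn* {x ^ 4} {ℤ.+ 1 / 180} (^≥0 x≥0 4) (ℚₚ.≤ᵇ⇒≤ _)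

      term-size : ∀ j → pow j * coeff j ≤ bound * ρ ^ j
      term-size zero = ≤-cert
        (nn* (nn* (sub≥0 (≤2⇒sq≤4 x≥0 x≤2)) (^≥0 x≥0 4)) (coeff≥0 0))
        (solve 1 (λ x →
          let x⁴ = x :* (x :* (x :* (x :* con 1ℚ))) in
          (x⁴ :* con (ℤ.+ 1 / 180)) :* con 1ℚ :- (x :* (x :* x⁴)) :* con (coeff 0)
          := ((con (ι 4) :- x :* x) :* x⁴) :* con (coeff 0)) refl x)
      term-size (suc j) = begin
        pow (suc j) * coeff (suc j)
          ≡⟨ cong (_* coeff (suc j)) (pow-suc j) ⟩
        ((x * x) * pow j) * coeff (suc j)
          ≤⟨ *-monoˡ (coeff≥0 (suc j)) (*-monoˡ (pow≥0 j) (≤2⇒sq≤4 x≥0 x≤2)) ⟩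
        (ι 4 * pow j) * coeff (suc j)
          ≡⟨ solve 2 (λ p v → (con (ι 4) :* p) :* v := (con (ℤ.+ 1 / 14) :* p) :* (con (ι 56) :* v)) refl
               (pow j) (coeff (suc j)) ⟩
        ((ℤ.+ 1 / 14) * pow j) * (ι 56 * coeff (suc j))
          ≤⟨ *-monoʳ (nn* {ℤ.+ 1 / 14} (ℚₚ.≤ᵇ⇒≤ _) (pow≥0 j)) (coeff-suc j) ⟩
        ((ℤ.+ 1 / 14) * pow j) * coeff j
          ≡⟨ ℚₚ.*-assoc (ℤ.+ 1 / 14) (pow j) (coeff j) ⟩
        (ℤ.+ 1 / 14) * (pow j * coeff j)
          ≤⟨ *-monoˡ (nn* (pow≥0 j) (coeff≥0 j)) (ℚₚ.≤ᵇ⇒≤ {ℤ.+ 1 / 14} {ρ} _) ⟩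
        ρ * (pow j * coeff j)
          ≤⟨ *-monoʳ {ρ} (ℚₚ.≤ᵇ⇒≤ _) (term-size j) ⟩
        ρ * (bound * ρ ^ j)
          ≡⟨ solve 3 (λ r b p → r :* (b :* p) := b :* (r :* p)) refl ρ bound (ρ ^ j) ⟩
        bound * ρ ^ suc j ∎

      ∣term∣ : ∀ j → ∣ cosTerm x (3 ℕ.+ j) ∣ ≤ bound * ρ ^ j
      ∣term∣ j = begin
        ∣ (- 1ℚ) ^ (3 ℕ.+ j) * (pow j * coeff j) ∣ ≡⟨ ∣sign∣ (3 ℕ.+ j) (pow j * coeff j) ⟩
        ∣ pow j * coeff j ∣                        ≡⟨ ℚₚ.0≤p⇒∣p∣≡p (nn* (pow≥0 j) (coeff≥0 j)) ⟩
        pow j * coeff j                            ≤⟨ term-size j ⟩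
        bound * ρ ^ j                              ∎

      tail : ℕ → ℚ
      tail j = cosSum (3 ℕ.+ j) x - cosSum 3 x

      tail-size : ∀ j → 9/10 * ∣ tail j ∣ ≤ bound
      tail-size j = begin
        9/10 * ∣ cosSum (3 ℕ.+ j) x - cosSum 3 x ∣
          ≡⟨ cong (λ i → 9/10 * ∣ cosSum (3 ℕ.+ i) x - cosSum 3 x ∣) (sym (ℕₚ.+-identityʳ j)) ⟩
        9/10 * ∣ cosSum (3 ℕ.+ (j ℕ.+ 0)) x - cosSum 3 x ∣
          ≤⟨ geometric (λ j → cosSum (3 ℕ.+ j) x) bound 9/10 bound≥0 (ℚₚ.≤ᵇ⇒≤ _) (ℚₚ.≤ᵇ⇒≤ _)
               (λ j → subst (λ z → ∣ z ∣ ≤ bound * ρ ^ j) (sym (Σ<-step (3 ℕ.+ j) (cosTerm x))) (∣term∣ j)) 0 j ⟩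
        bound * 1ℚ
          ≡⟨ ℚₚ.*-identityʳ bound ⟩
        bound ∎

    quartic : ℚ → ℚ
    quartic x = (1ℚ - ½ * (x * x)) + (ℤ.+ 1 / 24) * x ^ 4

    cosSum₃ : ∀ x → cosSum 3 x ≡ quartic x
    cosSum₃ = solve 1 (λ x →
      let x⁴ = x :* (x :* (x :* (x :* con 1ℚ))) in
      ((con 0ℚ :+ con ((- 1ℚ) ^ 0) :* (con 1ℚ :* con (1/ 0 !)))
        :+ con ((- 1ℚ) ^ 1) :* ((x :* (x :* con 1ℚ)) :* con (1/ 2 !)))
        :+ con ((- 1ℚ) ^ 2) :* (x⁴ :* con (1/ 4 !))
      := (con 1ℚ :- con ½ :* (x :* x)) :+ con (ℤ.+ 1 / 24) :* x⁴) refl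

    cosSum-split : ∀ x x≥0 x≤2 j → cosSum (3 ℕ.+ j) x ≡ quartic x + tail x x≥0 x≤2 j
    cosSum-split x x≥0 x≤2 j = trans
      (solve 2 (λ a b → a := b :+ (a :- b)) refl (cosSum (3 ℕ.+ j) x) (cosSum 3 x))
      (cong (_+ tail x x≥0 x≤2 j) (cosSum₃ x))

    module _ (x : ℚ) (1≤x : 1ℚ ≤ x) (x≤2 : x ≤ ι 2) where

      x≥0 : 0ℚ ≤ x
      x≥0 = ℚₚ.≤-trans (ℚₚ.<⇒≤ 0<1) 1≤x

      step-range : ∀ j → 1ℚ ≤ x + cosSum (3 ℕ.+ j) x × x + cosSum (3 ℕ.+ j) x ≤ ι 2
      step-range j = subst (λ z → 1ℚ ≤ x + z × x + z ≤ ι 2) (sym (cosSum-split x x≥0 x≤2 j)) (lower , upper)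
        where
        T b x⁴ u : ℚ
        T  = tail x x≥0 x≤2 j
        b  = bound x x≥0 x≤2
        x⁴ = x ^ 4
        u  = ℤ.+ 10 / 9
        x⁴≥0 : 0ℚ ≤ x⁴
        x⁴≥0 = ^≥0 x≥0 4
        u≥0 : 0ℚ ≤ u
        u≥0 = ℚₚ.≤ᵇ⇒≤ _
        9/10≥0 : 0ℚ ≤ 9/10
        9/10≥0 = ℚₚ.≤ᵇ⇒≤ _
        T≤ : 9/10 * T ≤ b
        T≤ = ℚₚ.≤-trans (*-monoʳ {9/10} 9/10≥0 (x≤∣x∣ T)) (tail-size x x≥0 x≤2 j)
        T≥ : 9/10 * (- T) ≤ b
        T≥ = ℚₚ.≤-trans (*-monoʳ {9/10} 9/10≥0 (-x≤∣x∣ T)) (tail-size x x≥0 x≤2 j)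
        lower : 1ℚ ≤ x + (quartic x + T)
        lower = ≤-cert
          (nn+ (nn+ (nn* (nn* ½≥0 x≥0) (sub≥0 x≤2))
                    (nn* {ℤ.+ 23 / 648} (ℚₚ.≤ᵇ⇒≤ _) x⁴≥0))
               (nn* {u} u≥0 (sub≥0 T≥)))
          (solve 3 (λ x q T →
             (x :+ (((con 1ℚ :- con ½ :* (x :* x)) :+ con (ℤ.+ 1 / 24) :* q) :+ T)) :- con 1ℚ
             := ((con ½ :* x) :* (con (ι 2) :- x) :+ con (ℤ.+ 23 / 648) :* q)
                :+ con u :* (q :* con (ℤ.+ 1 / 180) :- con 9/10 :* (:- T))) refl x x⁴ T)
        upper : x + (quartic x + T) ≤ ι 2
        upper = ≤-cert
          (nn+ (nn+ (nn* {ℤ.+ 7 / 3240} (ℚₚ.≤ᵇ⇒≤ _) x⁴≥0)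
                    (nn* {u} u≥0 (sub≥0 T≤)))
               (nn+ (nn* {ℤ.+ 1 / 20} (ℚₚ.≤ᵇ⇒≤ _)
                      (nn* (nn* (sub≥0 1≤x) (sub≥0 x≤2))
                           (nn+ (nn* x≥0 x≥0) (nn+ (nn* (ι≥0 3) x≥0) (ι≥0 7)))))
                    (nn* ½≥0 (nn+ (sq≥0 (x - (ℤ.+ 7 / 4))) (ℚₚ.≤ᵇ⇒≤ {0ℚ} {ℤ.+ 27 / 80} _)))))
          (solve 2 (λ x T →
             let x⁴ = x :* (x :* (x :* (x :* con 1ℚ))) in
             con (ι 2) :- (x :+ (((con 1ℚ :- con ½ :* (x :* x)) :+ con (ℤ.+ 1 / 24) :* x⁴) :+ T))
             := (con (ℤ.+ 7 / 3240) :* x⁴ :+ con u :* (x⁴ :* con (ℤ.+ 1 / 180) :- con 9/10 :* T))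
                :+ (con (ℤ.+ 1 / 20) :* (((x :- con 1ℚ) :* (con (ι 2) :- x))
                       :* (x :* x :+ (con (ι 3) :* x :+ con (ι 7))))
                    :+ con ½ :* ((x :- con (ℤ.+ 7 / 4)) :* (x :- con (ℤ.+ 7 / 4)) :+ con (ℤ.+ 27 / 80))))
             refl x T)
          where
          sq≥0 : ∀ z → 0ℚ ≤ z * z
          sq≥0 z with ℚₚ.≤-total 0ℚ z
          ... | inj₁ h = nn* h h
          ... | inj₂ h = subst (0ℚ ≤_) (solve 1 (λ z → (:- z) :* (:- z) := z :* z) refl z)
                           (nn* (ℚₚ.neg-antimono-≤ h) (ℚₚ.neg-antimono-≤ h))

    module _ (x y : ℚ) (1≤x : 1ℚ ≤ x) (x≤2 : x ≤ ι 2) (1≤y : 1ℚ ≤ y) (y≤2 : y ≤ ι 2) where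

      private
        x⁺ : 0ℚ ≤ x
        x⁺ = x≥0 x 1≤x x≤2
        y⁺ : 0ℚ ≤ y
        y⁺ = x≥0 y 1≤y y≤2

      d : ℚ
      d = ∣ x - y ∣

      d≥0 : 0ℚ ≤ d
      d≥0 = ℚₚ.0≤∣p∣ (x - y)

      ∣sq-sq∣ : ∣ x * x - y * y ∣ ≤ ι 4 * d
      ∣sq-sq∣ = begin
        ∣ x * x - y * y ∣       ≡⟨ cong ∣_∣ (solve 2 (λ x y → x :* x :- y :* y := (x :+ y) :* (x :- y)) refl x y) ⟩
        ∣ (x + y) * (x - y) ∣   ≡⟨ ℚₚ.∣p*q∣≡∣p∣*∣q∣ (x + y) (x - y) ⟩
        ∣ x + y ∣ * d           ≡⟨ cong (_* d) (ℚₚ.0≤p⇒∣p∣≡p (nn+ x⁺ y⁺)) ⟩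
        (x + y) * d             ≤⟨ *-monoˡ d≥0 (ℚₚ.+-mono-≤ x≤2 y≤2) ⟩
        ι 4 * d                 ∎

      ∣pow-suc∣ : ∀ p q → 0ℚ ≤ q →
        ∣ (x * x) * p - (y * y) * q ∣ ≤ ι 4 * ∣ p - q ∣ + q * (ι 4 * d)
      ∣pow-suc∣ p q q≥0 = begin
        ∣ (x * x) * p - (y * y) * q ∣
          ≡⟨ cong ∣_∣ (solve 4 (λ a b p q → a :* p :- b :* q := a :* (p :- q) :+ q :* (a :- b)) refl
               (x * x) (y * y) p q) ⟩
        ∣ (x * x) * (p - q) + q * (x * x - y * y) ∣
          ≤⟨ ℚₚ.∣p+q∣≤∣p∣+∣q∣ ((x * x) * (p - q)) (q * (x * x - y * y)) ⟩
        ∣ (x * x) * (p - q) ∣ + ∣ q * (x * x - y * y) ∣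
          ≡⟨ cong₂ _+_
               (trans (ℚₚ.∣p*q∣≡∣p∣*∣q∣ (x * x) (p - q)) (cong (_* ∣ p - q ∣) (ℚₚ.0≤p⇒∣p∣≡p (nn* x⁺ x⁺))))
               (trans (ℚₚ.∣p*q∣≡∣p∣*∣q∣ q (x * x - y * y)) (cong (_* ∣ x * x - y * y ∣) (ℚₚ.0≤p⇒∣p∣≡p q≥0))) ⟩
        (x * x) * ∣ p - q ∣ + q * ∣ x * x - y * y ∣
          ≤⟨ ℚₚ.+-mono-≤ (*-monoˡ (ℚₚ.0≤∣p∣ (p - q)) (≤2⇒sq≤4 x⁺ x≤2)) (*-monoʳ q≥0 ∣sq-sq∣) ⟩
        ι 4 * ∣ p - q ∣ + q * (ι 4 * d) ∎

      diff : ℕ → ℚ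
      diff j = ∣ pow x x⁺ x≤2 j - pow y y⁺ y≤2 j ∣

      diff₀ : diff 0 ≤ ι 192 * d
      diff₀ = begin
        ∣ x ^ 6 - y ^ 6 ∣
          ≡⟨ cong ∣_∣ (solve 2 (λ x y →
               let x⁶ = x :* (x :* (x :* (x :* (x :* (x :* con 1ℚ)))))
                   y⁶ = y :* (y :* (y :* (y :* (y :* (y :* con 1ℚ))))) in
               x⁶ :- y⁶ := (x :* x) :* ((x :* x) :* (x :* x)) :- (y :* y) :* ((y :* y) :* (y :* y))) refl x y) ⟩
        ∣ (x * x) * ((x * x) * (x * x)) - (y * y) * ((y * y) * (y * y)) ∣
          ≤⟨ ∣pow-suc∣ ((x * x) * (x * x)) ((y * y) * (y * y)) (nn* y²≥0 y²≥0) ⟩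
        ι 4 * ∣ (x * x) * (x * x) - (y * y) * (y * y) ∣ + ((y * y) * (y * y)) * (ι 4 * d)
          ≤⟨ ℚₚ.+-mono-≤
               (*-monoʳ {ι 4} (ι≥0 4) (ℚₚ.≤-trans (∣pow-suc∣ (x * x) (y * y) y²≥0)
                 (ℚₚ.+-mono-≤ (*-monoʳ {ι 4} (ι≥0 4) ∣sq-sq∣) (*-monoˡ 4d≥0 y²≤4))))
               (*-monoˡ 4d≥0 (*-mono y²≥0 y²≥0 y²≤4 y²≤4)) ⟩
        ι 4 * (ι 4 * (ι 4 * d) + ι 4 * (ι 4 * d)) + (ι 4 * ι 4) * (ι 4 * d)
          ≡⟨ solve 1 (λ d → let k = con (ι 4) in
               k :* (k :* (k :* d) :+ k :* (k :* d)) :+ (k :* k) :* (k :* d) := con (ι 192) :* d) refl d ⟩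
        ι 192 * d ∎
        where
        y²≥0 : 0ℚ ≤ y * y
        y²≥0 = nn* y⁺ y⁺
        y²≤4 : y * y ≤ ι 4
        y²≤4 = ≤2⇒sq≤4 y⁺ y≤2
        4d≥0 : 0ℚ ≤ ι 4 * d
        4d≥0 = nn* {ι 4} (ι≥0 4) d≥0

      slope : ℚ
      slope = (ℤ.+ 4 / 15) * d

      slope≥0 : 0ℚ ≤ slope
      slope≥0 = nn* {ℤ.+ 4 / 15} (ℚₚ.≤ᵇ⇒≤ _) d≥0

      pow-bound : ∀ j → pow y y⁺ y≤2 j * coeff j ≤ (ℤ.+ 4 / 45) * ρ ^ j
      pow-bound j = ℚₚ.≤-trans (term-size y y⁺ y≤2 j) (*-monoˡ (^≥0 {ρ} (ℚₚ.≤ᵇ⇒≤ _) j)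
        (*-monoˡ {ℤ.+ 1 / 180} {y ^ 4} {ι 16} (ℚₚ.≤ᵇ⇒≤ _) (^-mono y⁺ y≤2 4)))

      diff-size : ∀ j → diff j * coeff j ≤ slope * ρ ^ j
      diff-size zero = begin
        diff 0 * coeff 0          ≤⟨ *-monoˡ (coeff≥0 0) diff₀ ⟩
        (ι 192 * d) * coeff 0     ≡⟨ solve 1 (λ d → (con (ι 192) :* d) :* con (coeff 0)
                                                 := (con (ℤ.+ 4 / 15) :* d) :* con 1ℚ) refl d ⟩
        slope * 1ℚ                ∎
      diff-size (suc j) = begin
        diff (suc j) * coeff (suc j)
          ≡⟨ cong (_* coeff (suc j)) (cong₂ (λ a b → ∣ a - b ∣) (pow-suc x x⁺ x≤2 j) (pow-suc y y⁺ y≤2 j)) ⟩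
        ∣ (x * x) * p - (y * y) * q ∣ * coeff (suc j)
          ≤⟨ *-monoˡ (coeff≥0 (suc j)) (∣pow-suc∣ p q q≥0) ⟩
        (ι 4 * diff j + q * (ι 4 * d)) * coeff (suc j)
          ≡⟨ solve 4 (λ D q d v → (con (ι 4) :* D :+ q :* (con (ι 4) :* d)) :* v
                       := con (ℤ.+ 1 / 14) :* ((D :+ q :* d) :* (con (ι 56) :* v))) refl
               (diff j) q d (coeff (suc j)) ⟩
        (ℤ.+ 1 / 14) * ((diff j + q * d) * (ι 56 * coeff (suc j)))
          ≤⟨ *-monoʳ {ℤ.+ 1 / 14} (ℚₚ.≤ᵇ⇒≤ _)
               (*-monoʳ (nn+ (ℚₚ.0≤∣p∣ (p - pow y y⁺ y≤2 j)) (nn* q≥0 d≥0)) (coeff-suc j)) ⟩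
        (ℤ.+ 1 / 14) * ((diff j + q * d) * coeff j)
          ≡⟨ solve 4 (λ D q d v → con (ℤ.+ 1 / 14) :* ((D :+ q :* d) :* v)
                       := con (ℤ.+ 1 / 14) :* (D :* v :+ d :* (q :* v))) refl
               (diff j) q d (coeff j) ⟩
        (ℤ.+ 1 / 14) * (diff j * coeff j + d * (q * coeff j))
          ≤⟨ *-monoʳ {ℤ.+ 1 / 14} (ℚₚ.≤ᵇ⇒≤ _)
               (ℚₚ.+-mono-≤ (diff-size j) (*-monoʳ d≥0 (pow-bound j))) ⟩
        (ℤ.+ 1 / 14) * (slope * ρ ^ j + d * ((ℤ.+ 4 / 45) * ρ ^ j))
          ≤⟨ ≤-cert (nn* {ℤ.+ 4 / 3150} (ℚₚ.≤ᵇ⇒≤ _) (nn* d≥0 (^≥0 {ρ} (ℚₚ.≤ᵇ⇒≤ _) j)))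
               (solve 2 (λ d r →
                  (con (ℤ.+ 4 / 15) :* d) :* (con ρ :* r)
                    :- con (ℤ.+ 1 / 14) :* ((con (ℤ.+ 4 / 15) :* d) :* r :+ d :* (con (ℤ.+ 4 / 45) :* r))
                  := con (ℤ.+ 4 / 3150) :* (d :* r)) refl d (ρ ^ j)) ⟩
        slope * ρ ^ suc j ∎
        where
        p q : ℚ
        p = pow x x⁺ x≤2 j
        q = pow y y⁺ y≤2 j
        q≥0 : 0ℚ ≤ q
        q≥0 = pow≥0 y y⁺ y≤2 j

      ∣term-term∣ : ∀ j → ∣ cosTerm x (3 ℕ.+ j) - cosTerm y (3 ℕ.+ j) ∣ ≤ slope * ρ ^ j
      ∣term-term∣ j = begin
        ∣ s * (p * coeff j) - s * (q * coeff j) ∣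
          ≡⟨ cong ∣_∣ (solve 4 (λ s p q v → s :* (p :* v) :- s :* (q :* v) := s :* ((p :- q) :* v)) refl
               s p q (coeff j)) ⟩
        ∣ s * ((p - q) * coeff j) ∣ ≡⟨ ∣sign∣ (3 ℕ.+ j) ((p - q) * coeff j) ⟩
        ∣ (p - q) * coeff j ∣       ≡⟨ ∣*∣ (p - q) (coeff≥0 j) ⟩
        ∣ p - q ∣ * coeff j         ≤⟨ diff-size j ⟩
        slope * ρ ^ j               ∎
        where
        s p q : ℚ
        s = (- 1ℚ) ^ (3 ℕ.+ j)
        p = pow x x⁺ x≤2 j
        q = pow y y⁺ y≤2 j

      tail-tail : ℕ → ℚ
      tail-tail j = (cosSum (3 ℕ.+ j) x - cosSum (3 ℕ.+ j) y) - (cosSum 3 x - cosSum 3 y)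

      tail-tail-size : ∀ j → 9/10 * ∣ tail-tail j ∣ ≤ slope
      tail-tail-size j = begin
        9/10 * ∣ tail-tail j ∣
          ≡⟨ cong (λ i → 9/10 * ∣ tail-tail i ∣) (sym (ℕₚ.+-identityʳ j)) ⟩
        9/10 * ∣ tail-tail (j ℕ.+ 0) ∣
          ≤⟨ geometric (λ j → cosSum (3 ℕ.+ j) x - cosSum (3 ℕ.+ j) y) slope 9/10 slope≥0
               (ℚₚ.≤ᵇ⇒≤ _) (ℚₚ.≤ᵇ⇒≤ _)
               (λ j → subst (λ z → ∣ z ∣ ≤ slope * ρ ^ j)
                 (sym (Σ<-step₂ (3 ℕ.+ j) (cosTerm x) (cosTerm y))) (∣term-term∣ j)) 0 j ⟩
        slope * 1ℚ
          ≡⟨ ℚₚ.*-identityʳ slope ⟩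
        slope ∎

      -- For the quartic part x ↦ x + quartic x the difference quotient is weight.
      weight : ℚ
      weight = 1ℚ - (½ * (x + y)) * (1ℚ - (ℤ.+ 1 / 12) * (x * x + y * y))

      ∣weight∣ : ∣ weight ∣ ≤ ℤ.+ 2 / 3
      ∣weight∣ = ∣∣-≤
        (≤-cert
          (nn+ (nn* {ℤ.+ 1 / 24} (ℚₚ.≤ᵇ⇒≤ _)
                 (nn* (nn+ (sub≥0 1≤x) (sub≥0 1≤y)) (nn+ (nn+ sq-x sq-y) (ι≥0 4))))
               (nn* {ℤ.+ 1 / 12} (ℚₚ.≤ᵇ⇒≤ _) (nn+ sq-x sq-y)))
          (solve 2 (λ x y →
            con (ℤ.+ 2 / 3) :- (con 1ℚ :- (con ½ :* (x :+ y)) :* (con 1ℚ :- con (ℤ.+ 1 / 12) :* (x :* x :+ y :* y)))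
            := con (ℤ.+ 1 / 24) :* (((x :- con 1ℚ) :+ (y :- con 1ℚ))
                   :* (((con (ι 4) :- x :* x) :+ (con (ι 4) :- y :* y)) :+ con (ι 4)))
               :+ con (ℤ.+ 1 / 12) :* ((con (ι 4) :- x :* x) :+ (con (ι 4) :- y :* y))) refl x y))
        (≤-cert
          (nn+ (nn* {ℤ.+ 5 / 12} (ℚₚ.≤ᵇ⇒≤ _) (nn+ (sub≥0 x≤2) (sub≥0 y≤2)))
               (nn* {ℤ.+ 1 / 24} (ℚₚ.≤ᵇ⇒≤ _) (nn* (nn+ x⁺ y⁺) (nn+ (sub≥0 1≤x²) (sub≥0 1≤y²)))))
          (solve 2 (λ x y →
            con (ℤ.+ 2 / 3) :- (:- (con 1ℚ :- (con ½ :* (x :+ y)) :* (con 1ℚ :- con (ℤ.+ 1 / 12) :* (x :* x :+ y :* y))))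
            := con (ℤ.+ 5 / 12) :* ((con (ι 2) :- x) :+ (con (ι 2) :- y))
               :+ con (ℤ.+ 1 / 24) :* ((x :+ y) :* ((x :* x :- con 1ℚ) :+ (y :* y :- con 1ℚ)))) refl x y))
        where
        sq-x : 0ℚ ≤ ι 4 - x * x
        sq-x = sub≥0 (≤2⇒sq≤4 x⁺ x≤2)
        sq-y : 0ℚ ≤ ι 4 - y * y
        sq-y = sub≥0 (≤2⇒sq≤4 y⁺ y≤2)
        1≤x² : 1ℚ ≤ x * x
        1≤x² = *-mono {1ℚ} {x} {1ℚ} {x} (ℚₚ.<⇒≤ 0<1) (ℚₚ.<⇒≤ 0<1) 1≤x 1≤x
        1≤y² : 1ℚ ≤ y * y
        1≤y² = *-mono {1ℚ} {y} {1ℚ} {y} (ℚₚ.<⇒≤ 0<1) (ℚₚ.<⇒≤ 0<1) 1≤y 1≤y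

      contraction : ∀ j →
        ∣ (x + cosSum (3 ℕ.+ j) x) - (y + cosSum (3 ℕ.+ j) y) ∣ ≤ (ℤ.+ 29 / 30) * d
      contraction j = *-cancelˡ {9/10} (ℚₚ.positive⁻¹ 9/10) (begin
        9/10 * ∣ (x + A) - (y + B) ∣
          ≡⟨ cong (λ z → 9/10 * ∣ z ∣) (trans
               (solve 6 (λ x y A B C D →
                  (x :+ A) :- (y :+ B) := ((x :+ C) :- (y :+ D)) :+ ((A :- B) :- (C :- D))) refl
                  x y A B (cosSum 3 x) (cosSum 3 y))
               (cong (_+ T) (trans (cong₂ (λ a b → (x + a) - (y + b)) (cosSum₃ x) (cosSum₃ y))
                 (solve 2 (λ x y →
                    let x⁴ = x :* (x :* (x :* (x :* con 1ℚ)))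
                        y⁴ = y :* (y :* (y :* (y :* con 1ℚ)))
                        e  = con (ℤ.+ 1 / 24) in
                    (x :+ ((con 1ℚ :- con ½ :* (x :* x)) :+ e :* x⁴))
                      :- (y :+ ((con 1ℚ :- con ½ :* (y :* y)) :+ e :* y⁴))
                    := (x :- y) :* (con 1ℚ :- (con ½ :* (x :+ y))
                         :* (con 1ℚ :- con (ℤ.+ 1 / 12) :* (x :* x :+ y :* y)))) refl x y)))) ⟩
        9/10 * ∣ (x - y) * weight + T ∣
          ≤⟨ *-monoʳ {9/10} 9/10≥0 (ℚₚ.∣p+q∣≤∣p∣+∣q∣ ((x - y) * weight) T) ⟩
        9/10 * (∣ (x - y) * weight ∣ + ∣ T ∣)
          ≡⟨ cong (λ z → 9/10 * (z + ∣ T ∣)) (ℚₚ.∣p*q∣≡∣p∣*∣q∣ (x - y) weight) ⟩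
        9/10 * (d * ∣ weight ∣ + ∣ T ∣)
          ≡⟨ ℚₚ.*-distribˡ-+ 9/10 (d * ∣ weight ∣) (∣ T ∣) ⟩
        9/10 * (d * ∣ weight ∣) + 9/10 * ∣ T ∣
          ≤⟨ ℚₚ.+-mono-≤ (*-monoʳ {9/10} 9/10≥0 (*-monoʳ d≥0 ∣weight∣)) (tail-tail-size j) ⟩
        9/10 * (d * (ℤ.+ 2 / 3)) + (ℤ.+ 4 / 15) * d
          ≤⟨ ≤-cert (nn* {ℤ.+ 1 / 300} (ℚₚ.≤ᵇ⇒≤ _) d≥0)
               (solve 1 (λ d → con 9/10 :* (con (ℤ.+ 29 / 30) :* d)
                   :- (con 9/10 :* (d :* con (ℤ.+ 2 / 3)) :+ con (ℤ.+ 4 / 15) :* d)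
                   := con (ℤ.+ 1 / 300) :* d) refl d) ⟩
        9/10 * ((ℤ.+ 29 / 30) * d) ∎)
        where
        A B T : ℚ
        A = cosSum (3 ℕ.+ j) x
        B = cosSum (3 ℕ.+ j) y
        T = tail-tail j
        9/10≥0 : 0ℚ ≤ 9/10
        9/10≥0 = ℚₚ.≤ᵇ⇒≤ _

  halfπ-range : ∀ n → 1ℚ ≤ halfπApprox (3 ℕ.+ n) × halfπApprox (3 ℕ.+ n) ≤ ι 2
  halfπ-range zero    = ℚₚ.≤ᵇ⇒≤ _ , ℚₚ.≤ᵇ⇒≤ _
  halfπ-range (suc n) = step-range (halfπApprox (3 ℕ.+ n)) (proj₁ (halfπ-range n)) (proj₂ (halfπ-range n)) n

  halfπ-cauchy : IsCauchy halfπApprox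
  halfπ-cauchy = shift-cauchy {halfπApprox} 3
    (geometric-cauchy h (ι 6) (ℤ.+ 1 / 60) (ℚₚ.positive⁻¹ (ι 6)) (ℚₚ.positive⁻¹ (ℤ.+ 1 / 60))
      (ℚₚ.≤ᵇ⇒≤ _) step)
    where
    h : ℕ → ℚ
    h n = halfπApprox (3 ℕ.+ n)
    r : ℚ
    r = 1ℚ - (ℤ.+ 1 / 60)
    step : ∀ n → ∣ h (suc n) - h n ∣ ≤ ι 6 * r ^ n
    step zero    = ℚₚ.≤ᵇ⇒≤ _
    step (suc n) = begin
      ∣ (b + cosSum (4 ℕ.+ n) b) - (a + cosSum (3 ℕ.+ n) a) ∣
        ≡⟨ cong ∣_∣ (solve 5 (λ b S t a A → (b :+ (S :+ t)) :- (a :+ A) := ((b :+ S) :- (a :+ A)) :+ t) refl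
             b (cosSum (3 ℕ.+ n) b) (cosTerm b (3 ℕ.+ n)) a (cosSum (3 ℕ.+ n) a)) ⟩
      ∣ ((b + cosSum (3 ℕ.+ n) b) - (a + cosSum (3 ℕ.+ n) a)) + cosTerm b (3 ℕ.+ n) ∣
        ≤⟨ ℚₚ.∣p+q∣≤∣p∣+∣q∣ ((b + cosSum (3 ℕ.+ n) b) - (a + cosSum (3 ℕ.+ n) a)) (cosTerm b (3 ℕ.+ n)) ⟩
      ∣ (b + cosSum (3 ℕ.+ n) b) - (a + cosSum (3 ℕ.+ n) a) ∣ + ∣ cosTerm b (3 ℕ.+ n) ∣
        ≤⟨ ℚₚ.+-mono-≤
             (ℚₚ.≤-trans (contraction b a 1≤b b≤2 1≤a a≤2 n)
               (*-monoʳ {ℤ.+ 29 / 30} (ℚₚ.≤ᵇ⇒≤ _) (step n)))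
             (ℚₚ.≤-trans (∣term∣ b b≥0 b≤2 n)
               (*-mono (bound≥0 b b≥0 b≤2) (^≥0 {ρ} (ℚₚ.≤ᵇ⇒≤ _) n)
                 (*-monoˡ {ℤ.+ 1 / 180} {b ^ 4} {ι 16} (ℚₚ.≤ᵇ⇒≤ _) (^-mono b≥0 b≤2 4))
                 (^-mono {ρ} {r} (ℚₚ.≤ᵇ⇒≤ _) (ℚₚ.≤ᵇ⇒≤ _) n))) ⟩
      (ℤ.+ 29 / 30) * (ι 6 * r ^ n) + (ℤ.+ 4 / 45) * r ^ n
        ≤⟨ ≤-cert (nn* {ℤ.+ 1 / 90} (ℚₚ.≤ᵇ⇒≤ _) (^≥0 {r} (ℚₚ.≤ᵇ⇒≤ _) n))
             (solve 1 (λ p → con (ι 6) :* (con r :* p)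
                 :- (con (ℤ.+ 29 / 30) :* (con (ι 6) :* p) :+ con (ℤ.+ 4 / 45) :* p)
                 := con (ℤ.+ 1 / 90) :* p) refl (r ^ n)) ⟩
      ι 6 * r ^ suc n ∎
      where
      a b : ℚ
      a = h n
      b = h (suc n)
      1≤a : 1ℚ ≤ a
      1≤a = proj₁ (halfπ-range n)
      a≤2 : a ≤ ι 2
      a≤2 = proj₂ (halfπ-range n)
      1≤b : 1ℚ ≤ b
      1≤b = proj₁ (halfπ-range (suc n))
      b≤2 : b ≤ ι 2
      b≤2 = proj₂ (halfπ-range (suc n))
      b≥0 : 0ℚ ≤ b
      b≥0 = x≥0 b 1≤b b≤2

  cos-halfπ-null : IsNull (λ n → cosSum n (halfπApprox n))
  cos-halfπ-null ε ε>0 = proj₁ (halfπ-cauchy ε ε>0) , λ n n≥ →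
    subst (_< ε)
      (cong ∣_∣ (solve 2 (λ a b → (a :+ b) :- a := b) refl (halfπApprox n) (cosSum n (halfπApprox n))))
      (proj₂ (halfπ-cauchy ε ε>0) (suc n) n (ℕₚ.m≤n⇒m≤1+n n≥) n≥)

open RationalSequences using
  ( IsCauchy; IsNull; sinSum; cosSum; inv
  ; const-cauchy; +-cauchy; neg-cauchy; *-cauchy; inv-cauchy; sin-cauchy; cos-cauchy
  ; halfπApprox; halfπ-cauchy; halfπ-range; cos-halfπ-null
  ; sqrt11Approx; sqrt11-cauchy; sqrt11-range; sqrt11-null
  ; ≤-cert; sub≥0; no-gap; x≤∣x∣; -x≤∣x∣; ∣-∣-sym; inv-inverse )

-- Real numbers are considered up to _≃_; there is no quotient.
record ℝ : Set where
  constructor mkℝ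
  field
    seq    : ℕ → ℚ
    cauchy : IsCauchy seq

open ℝ public

infix  4 _≃_ _<_ _≤_ _#_
infixl 6 _+_ _-_
infixl 7 _*_
infix  8 -_
infix  9 _π/11

_≃_ : ℝ → ℝ → Set
x ≃ y = IsNull (λ n → seq x n Rat.- seq y n)

_<_ : ℝ → ℝ → Set
x < y = Σ[ δ ∈ ℚ ] 0ℚ Rat.< δ × ∃[ N ] (∀ n → N ℕ.≤ n → seq x n Rat.+ δ Rat.≤ seq y n)

_≤_ : ℝ → ℝ → Set
x ≤ y = ¬ (y < x)

-- Apartness, the constructive form of x ≠ y.
_#_ : ℝ → ℝ → Set
x # y = x < y ⊎ y < x

fromℚ : ℚ → ℝ
fromℚ q = mkℝ (λ _ → q) (const-cauchy q)

fromℕ : ℕ → ℝ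
fromℕ n = fromℚ (ℤ.+ n / 1)

_+_ : ℝ → ℝ → ℝ
x + y = mkℝ (λ n → seq x n Rat.+ seq y n) (+-cauchy (seq x) (seq y) (cauchy x) (cauchy y))

-_ : ℝ → ℝ
- x = mkℝ (λ n → Rat.- seq x n) (neg-cauchy (seq x) (cauchy x))

_-_ : ℝ → ℝ → ℝ
x - y = x + - y

_*_ : ℝ → ℝ → ℝ
x * y = mkℝ (λ n → seq x n Rat.* seq y n) (*-cauchy (seq x) (seq y) (cauchy x) (cauchy y))

#0⇒bounded-away : ∀ x → x # fromℕ 0 →
  Σ[ δ ∈ ℚ ] 0ℚ Rat.< δ × ∃[ N ] (∀ n → N ℕ.≤ n → δ Rat.≤ ∣ seq x n ∣)
#0⇒bounded-away x (inj₁ (δ , δ>0 , N , h)) = δ , δ>0 , N , λ n n≥ →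
  ℚₚ.≤-trans
    (≤-cert (sub≥0 (h n n≥))
      (solve 2 (λ x δ → :- x :- δ := con 0ℚ :- (x :+ δ)) refl (seq x n) δ))
    (-x≤∣x∣ (seq x n))
  where open +-*-Solver
#0⇒bounded-away x (inj₂ (δ , δ>0 , N , h)) = δ , δ>0 , N , λ n n≥ →
  ℚₚ.≤-trans (subst (Rat._≤ seq x n) (ℚₚ.+-identityˡ δ) (h n n≥))
    (x≤∣x∣ (seq x n))

inverse : (x : ℝ) → x # fromℕ 0 → ℝ
inverse x x#0 = mkℝ (λ n → inv (seq x n))
  (let δ , δ>0 , N , h = #0⇒bounded-away x x#0 in
   inv-cauchy (seq x) (cauchy x) δ δ>0 N h)

*-inverse : ∀ x x#0 → x * inverse x x#0 ≃ fromℕ 1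
*-inverse x x#0 ε ε>0 =
  let δ , δ>0 , N , h = #0⇒bounded-away x x#0 in
  N , λ n n≥ → subst (λ z → ∣ z Rat.- 1ℚ ∣ Rat.< ε)
    (sym (inv-inverse (ℚₚ.<-≤-trans δ>0 (h n n≥)))) ε>0

-- Partial sums of the Taylor series, with the n-th partial sum evaluated at the
-- n-th approximation of x.  On bounded sets the partial sums converge uniformly
-- and are Lipschitz with a common constant, so this diagonal sequence has the
-- same limit as the series at x.
sin cos : ℝ → ℝ
sin x = mkℝ (λ n → sinSum n (seq x n)) (sin-cauchy (seq x) (cauchy x))
cos x = mkℝ (λ n → cosSum n (seq x n)) (cos-cauchy (seq x) (cauchy x))

tan : (x : ℝ) → cos x # fromℕ 0 → ℝ
tan x cosx#0 = sin x * inverse (cos x) cosx#0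

-- π/2 is the least positive zero of the cosine.  It is obtained as the limit of
-- h₀ = 1, hₙ₊₁ = hₙ + cosSum n hₙ; the three lemmas below pin it down, since the
-- cosine is strictly decreasing on [0,2].
half-π : ℝ
half-π = mkℝ halfπApprox halfπ-cauchy

π : ℝ
π = fromℕ 2 * half-π

cos-half-π : cos half-π ≃ fromℕ 0
cos-half-π ε ε>0 =
  let N , h = cos-halfπ-null ε ε>0 in
  N , λ n n≥ → subst (λ z → ∣ z ∣ Rat.< ε) (sym (ℚₚ.+-identityʳ (seq (cos half-π) n))) (h n n≥)

1≤half-π : fromℕ 1 ≤ half-π
1≤half-π (δ , δ>0 , N , h) = no-gap δ>0
  (h (3 ℕ.+ N) (ℕₚ.m≤n+m N 3)) (proj₁ (halfπ-range N))

half-π≤2 : half-π ≤ fromℕ 2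
half-π≤2 (δ , δ>0 , N , h) = no-gap δ>0
  (h (3 ℕ.+ N) (ℕₚ.m≤n+m N 3)) (proj₂ (halfπ-range N))

_π/11 : ℕ → ℝ
k π/11 = fromℚ (ℤ.+ k / 11) * π

-- The limit of s₀ = 3, sₙ₊₁ = sₙ + (11 - sₙ²) / 7; the two lemmas below
-- characterise it as the positive square root of 11.
√11 : ℝ
√11 = mkℝ sqrt11Approx sqrt11-cauchy

√11>0 : fromℕ 0 < √11
√11>0 = ℤ.+ 3 / 1 , ℚₚ.positive⁻¹ (ℤ.+ 3 / 1) , 0 , λ n _ → proj₁ (sqrt11-range n)

√11² : √11 * √11 ≃ fromℕ 11
√11² ε ε>0 =
  let N , h = sqrt11-null ε ε>0 in
  N , λ n n≥ → subst (Rat._< ε) (∣-∣-sym (ℤ.+ 11 / 1) (seq (√11 * √11) n)) (h n n≥)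

{-# OPTIONS --safe #-}
module Submission where

-- Put θ = π/11 and x = cos θ.  Then sin kθ = sin θ · U k and cos kθ = T k for
-- Chebyshev polynomials in x, and sin 6θ = sin 5θ together with sin θ ≠ 0 gives
-- U 6 = U 5, a quintic equation for x.  Modulo this equation, the Gauss sum
-- g = 2 (sin θ + sin 2θ + sin 3θ - sin 4θ + sin 5θ) satisfies g² = 11, and each
-- sin kθ ± 4 sin jθ cos kθ of the theorem equals ± g cos kθ.  The sign of g
-- follows from g cos θ = sin θ + 4 sin 3θ cos θ > 0.
--
-- The addition formulas come from the Cauchy product of the exponential terms
-- xᵏ/k!, which are dominated by a geometric series of ratio 1/4.  The sine is
-- positive on (0,2] because its series alternates with decreasing terms, and
-- cos x = sin (π/2) sin (π/2 - x) carries this over to the cosine.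

import Defs
open import Algebra.Bundles using (CommutativeRing)
import Algebra.Solver.Ring
import Algebra.Solver.Ring.AlmostCommutativeRing as ACR
open import Data.Integer.Base as ℤ using ()
import Data.Integer.Properties as ℤₚ
import Data.Maybe.Base as Maybe
open import Data.Nat.Base as ℕ using (ℕ; zero; suc; _!)
import Data.Nat.Properties as ℕₚ
open import Data.Product.Base using (Σ-syntax; ∃-syntax; _×_; _,_; proj₁; proj₂)
open import Data.Rational.Base as Rat using (ℚ; 0ℚ; 1ℚ; ½; _/_; ∣_∣)
import Data.Rational.Properties as ℚₚ
open import Data.Rational.Solver using (module +-*-Solver)
import Data.Rational.Unnormalised.Base as ℚᵘ
import Data.Rational.Unnormalised.Properties as ℚᵘₚ
open import Data.Sum.Base using (inj₂)
open import Level using (0ℓ)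
import Relation.Binary.PropositionalEquality as ≡
import Relation.Binary.Reasoning.Setoid
open import Relation.Nullary.Decidable using (dec⇒maybe)

-- Addition formulas, parity and positivity for the rational partial sums

module PartialSums where

  open ≡ using (_≡_; refl; sym; trans; cong; cong₂; subst)
  open Rat using (_+_; _*_; _-_; -_; _≤_; _<_)
  open Defs.RationalSequences
  open +-*-Solver
  open ℚₚ.≤-Reasoning

  *-cancelˡ-≡ : ∀ {r p q} → 0ℚ < r → r * p ≡ r * q → p ≡ q
  *-cancelˡ-≡ r>0 e = ℚₚ.≤-antisym
    (*-cancelˡ r>0 (ℚₚ.≤-reflexive e)) (*-cancelˡ r>0 (ℚₚ.≤-reflexive (sym e)))

  -- Finite sums and convolutions

  Σ<-cong : ∀ {t u} → (∀ k → t k ≡ u k) → ∀ n → Σ< n t ≡ Σ< n u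
  Σ<-cong h zero    = refl
  Σ<-cong h (suc n) = cong₂ _+_ (Σ<-cong h n) (h n)

  Σ<-head : ∀ n t → Σ< (suc n) t ≡ t 0 + Σ< n (λ k → t (suc k))
  Σ<-head zero    t = ℚₚ.+-comm 0ℚ (t 0)
  Σ<-head (suc n) t = trans (cong (_+ t (suc n)) (Σ<-head n t))
    (ℚₚ.+-assoc (t 0) (Σ< n (λ k → t (suc k))) (t (suc n)))

  Σ<-+ : ∀ t u n → Σ< n (λ k → t k + u k) ≡ Σ< n t + Σ< n u
  Σ<-+ t u zero    = refl
  Σ<-+ t u (suc n) = trans (cong (_+ (t n + u n)) (Σ<-+ t u n))
    (solve 4 (λ a b c d → (a :+ b) :+ (c :+ d) := (a :+ c) :+ (b :+ d)) refl (Σ< n t) (Σ< n u) (t n) (u n))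

  -- The n-th coefficient of the Cauchy product, the sum of `a i * b j` over i + j = n. The
  -- recursion strips `a` from the left.
  conv : (ℕ → ℚ) → (ℕ → ℚ) → ℕ → ℚ
  conv a b zero    = a 0 * b 0
  conv a b (suc n) = a 0 * b (suc n) + conv (λ k → a (suc k)) b n

  -- A factor depending only on i + j can be distributed inside the antidiagonal. It is applied with
  -- `c` the index itself, for the binomial theorem, and with `c` a sign, for the addition formulas.
  conv-split : ∀ c (a b a₁ b₁ a₂ b₂ : ℕ → ℚ) n →
    (∀ i j → i ℕ.+ j ≡ n → c * (a i * b j) ≡ a₁ i * b₁ j + a₂ i * b₂ j) →
    c * conv a b n ≡ conv a₁ b₁ n + conv a₂ b₂ n
  conv-split c a b a₁ b₁ a₂ b₂ zero    h = h 0 0 refl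
  conv-split c a b a₁ b₁ a₂ b₂ (suc n) h = trans (ℚₚ.*-distribˡ-+ c _ _)
    (trans (cong₂ _+_ (h 0 (suc n) refl)
             (conv-split c _ b _ b₁ _ b₂ n λ i j e → h (suc i) j (cong suc e)))
      (solve 4 (λ p q r s → (p :+ q) :+ (r :+ s) := (p :+ r) :+ (q :+ s)) refl
        (a₁ 0 * b₁ (suc n)) (a₂ 0 * b₂ (suc n)) (conv _ b₁ n) (conv _ b₂ n)))

  conv-cong : ∀ {a a′ b b′ : ℕ → ℚ} → (∀ k → a k ≡ a′ k) → (∀ k → b k ≡ b′ k) →
    ∀ n → conv a b n ≡ conv a′ b′ n
  conv-cong ha hb zero    = cong₂ _*_ (ha 0) (hb 0)
  conv-cong ha hb (suc n) = cong₂ _+_ (cong₂ _*_ (ha 0) (hb (suc n))) (conv-cong (λ k → ha (suc k)) hb n)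

  -- The mirror image of the defining recursion, needed when the shift falls on the second sequence.
  conv-last : ∀ a b n → conv a b (suc n) ≡ conv a (λ k → b (suc k)) n + a (suc n) * b 0
  conv-last a b zero    = refl
  conv-last a b (suc n) = trans (cong (a 0 * b (suc (suc n)) +_) (conv-last (λ k → a (suc k)) b n))
    (sym (ℚₚ.+-assoc (a 0 * b (suc (suc n))) (conv (λ k → a (suc k)) (λ k → b (suc k)) n) (a (suc (suc n)) * b 0)))

  conv-scaleˡ : ∀ c a b n → conv (λ k → c * a k) b n ≡ c * conv a b n
  conv-scaleˡ c a b zero    = ℚₚ.*-assoc c (a 0) (b 0)
  conv-scaleˡ c a b (suc n) = trans (cong₂ _+_ (ℚₚ.*-assoc c (a 0) (b (suc n))) (conv-scaleˡ c _ b n))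
    (sym (ℚₚ.*-distribˡ-+ c (a 0 * b (suc n)) (conv _ b n)))

  conv-scaleʳ : ∀ c a b n → conv a (λ k → c * b k) n ≡ c * conv a b n
  conv-scaleʳ c a b zero    = solve 3 (λ c a b → a :* (c :* b) := c :* (a :* b)) refl c (a 0) (b 0)
  conv-scaleʳ c a b (suc n) = trans
    (cong (a 0 * (c * b (suc n)) +_) (conv-scaleʳ c (λ k → a (suc k)) b n))
    (solve 4 (λ c a b v → a :* (c :* b) :+ c :* v := c :* (a :* b :+ v)) refl
      c (a 0) (b (suc n)) (conv (λ k → a (suc k)) b n))

  -- The binomial theorem for exponential terms

  expTerm : ℚ → ℕ → ℚ
  expTerm x k = x ^ k * 1/ k !

  expTerm-suc : ∀ x k → ι (suc k) * expTerm x (suc k) ≡ x * expTerm x k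
  expTerm-suc x k = trans
    (solve 4 (λ i x p u → i :* ((x :* p) :* u) := x :* (p :* (i :* u))) refl (ι (suc k)) x (x ^ k) (1/ suc k !))
    (cong (λ z → x * (x ^ k * z)) (sym (1/!-suc k)))

  -- Both sides satisfy (n+1) e(n+1) = (x+y) e(n). For the convolution the factor n+1 = i+j is split
  -- into i and j, and each part lowers the index of one of the two exponential terms.
  binomial : ∀ x y n → expTerm (x + y) n ≡ conv (expTerm x) (expTerm y) n
  binomial x y zero    = refl
  binomial x y (suc n) = *-cancelˡ-≡ (ℚₚ.<-≤-trans 0<1 (ι-mono {1} {suc n} (ℕ.s≤s ℕ.z≤n)))
    (begin-equality
      ι (suc n) * expTerm (x + y) (suc n)
        ≡⟨ expTerm-suc (x + y) n ⟩
      (x + y) * expTerm (x + y) n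
        ≡⟨ cong ((x + y) *_) (binomial x y n) ⟩
      (x + y) * conv e f n
        ≡⟨ ℚₚ.*-distribʳ-+ (conv e f n) x y ⟩
      x * conv e f n + y * conv e f n
        ≡⟨ cong₂ _+_ (sym left) (sym right) ⟩
      conv (λ i → ι i * e i) f (suc n) + conv e (λ j → ι j * f j) (suc n)
        ≡⟨ sym (conv-split (ι (suc n)) e f (λ i → ι i * e i) f e (λ j → ι j * f j) (suc n) λ i j i+j≡ →
             trans (cong (λ z → ι z * (e i * f j)) (sym i+j≡))
            (trans (cong (_* (e i * f j)) (ι-+ i j))
              (solve 4 (λ i j u v → (i :+ j) :* (u :* v) := (i :* u) :* v :+ u :* (j :* v)) refl
                (ι i) (ι j) (e i) (f j)))) ⟩
      ι (suc n) * conv e f (suc n) ∎)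
    where
    e f : ℕ → ℚ
    e = expTerm x
    f = expTerm y
    -- The term with i = 0 has weight `ι 0` and drops out; in the others the weight turns
    -- `e (suc k)` into `x * e k`. For `right` the same happens at the other end.
    left : conv (λ i → ι i * e i) f (suc n) ≡ x * conv e f n
    left = trans (cong₂ _+_
        (solve 2 (λ u v → (con 0ℚ :* u) :* v := con 0ℚ) refl (e 0) (f (suc n)))
        (trans (conv-cong {b = f} (expTerm-suc x) (λ _ → refl) n) (conv-scaleˡ x e f n)))
      (ℚₚ.+-identityˡ _)
    right : conv e (λ j → ι j * f j) (suc n) ≡ y * conv e f n
    right = trans (conv-last e (λ j → ι j * f j) n)
      (trans (cong₂ _+_
        (trans (conv-cong {a = e} (λ _ → refl) (expTerm-suc y) n) (conv-scaleʳ y e f n))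
        (solve 2 (λ u v → u :* (con 0ℚ :* v) := con 0ℚ) refl (e (suc n)) (f 0)))
      (ℚₚ.+-identityʳ _))

  -- The real and imaginary parts of the powers of the imaginary unit.
  cosSign sinSign : ℕ → ℚ
  cosSign zero    = 1ℚ
  cosSign (suc k) = - sinSign k
  sinSign zero    = 0ℚ
  sinSign (suc k) = cosSign k

  -- Multiplying by the imaginary unit exchanges the two parts up to sign, so both rules are proved
  -- by one mutual induction.
  cosSign-+ : ∀ i j → cosSign (i ℕ.+ j) ≡ cosSign i * cosSign j - sinSign i * sinSign j
  sinSign-+ : ∀ i j → sinSign (i ℕ.+ j) ≡ sinSign i * cosSign j + cosSign i * sinSign j
  cosSign-+ zero    j = solve 2 (λ u v → u := con 1ℚ :* u :- con 0ℚ :* v) refl (cosSign j) (sinSign j)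
  cosSign-+ (suc i) j = trans (cong -_ (sinSign-+ i j))
    (solve 4 (λ a b c d → :- (b :* c :+ a :* d) := (:- b) :* c :- a :* d) refl
      (cosSign i) (sinSign i) (cosSign j) (sinSign j))
  sinSign-+ zero    j = solve 2 (λ u v → v := con 0ℚ :* u :+ con 1ℚ :* v) refl (cosSign j) (sinSign j)
  sinSign-+ (suc i) j = trans (cosSign-+ i j)
    (solve 4 (λ a b c d → a :* c :- b :* d := a :* c :+ (:- b) :* d) refl
      (cosSign i) (sinSign i) (cosSign j) (sinSign j))

  even-signs : ∀ k → cosSign (2 ℕ.* k) ≡ (- 1ℚ) ^ k × sinSign (2 ℕ.* k) ≡ 0ℚ
  even-signs zero    = refl , refl
  even-signs (suc k) = subst (λ m → cosSign m ≡ (- 1ℚ) ^ suc k × sinSign m ≡ 0ℚ) (sym (ℕₚ.*-suc 2 k))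
    ( trans (cong -_ (proj₁ (even-signs k))) (solve 1 (λ p → :- p := (:- con 1ℚ) :* p) refl ((- 1ℚ) ^ k))
    , cong -_ (proj₂ (even-signs k)) )

  ∣signs∣≤1 : ∀ k → ∣ cosSign k ∣ ≤ 1ℚ × ∣ sinSign k ∣ ≤ 1ℚ
  ∣signs∣≤1 zero    = ℚₚ.≤ᵇ⇒≤ _ , ℚₚ.≤ᵇ⇒≤ _
  ∣signs∣≤1 (suc k) = subst (_≤ 1ℚ) (sym (ℚₚ.∣-p∣≡∣p∣ (sinSign k))) (proj₂ (∣signs∣≤1 k)) , proj₁ (∣signs∣≤1 k)

  -- Sine and cosine sums as signed exponential sums

  cosCoeff sinCoeff : ℚ → ℕ → ℚ
  cosCoeff x k = cosSign k * expTerm x k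
  sinCoeff x k = sinSign k * expTerm x k

  -- Terms of odd index vanish because `sinSign` is 0 at even numbers. With zeros inserted, sine and
  -- cosine share one index and one truncation 2n, which makes their Cauchy products comparable.
  cosSum≡ : ∀ n x → cosSum n x ≡ Σ< (2 ℕ.* n) (cosCoeff x)
  cosSum≡ zero    x = refl
  cosSum≡ (suc n) x = trans
    (cong₂ _+_ (cosSum≡ n x) (cong (_* expTerm x (2 ℕ.* n)) (sym (proj₁ (even-signs n)))))
    (trans (trans (solve 2 (λ a u → a := a :+ con 0ℚ :* u) refl _ (expTerm x (suc (2 ℕ.* n))))
      (cong (λ z → Σ< (suc (2 ℕ.* n)) (cosCoeff x) + (- z) * expTerm x (suc (2 ℕ.* n)))
        (sym (proj₂ (even-signs n)))))
      (cong (λ m → Σ< m (cosCoeff x)) (sym (ℕₚ.*-suc 2 n))))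

  sinSum≡ : ∀ n x → sinSum n x ≡ Σ< (2 ℕ.* n) (sinCoeff x)
  sinSum≡ zero    x = refl
  sinSum≡ (suc n) x = trans
    (cong₂ _+_
      (trans (sinSum≡ n x) (trans
        (solve 2 (λ a u → a := a :+ con 0ℚ :* u) refl _ (expTerm x (2 ℕ.* n)))
        (cong (λ z → Σ< (2 ℕ.* n) (sinCoeff x) + z * expTerm x (2 ℕ.* n)) (sym (proj₂ (even-signs n))))))
      (cong (_* expTerm x (suc (2 ℕ.* n))) (sym (proj₁ (even-signs n)))))
    (cong (λ m → Σ< m (sinCoeff x)) (sym (ℕₚ.*-suc 2 n)))

  -- The error of a truncated Cauchy product

  Σ<-scale : ∀ c t n → Σ< n (λ k → c * t k) ≡ c * Σ< n t
  Σ<-scale c t zero    = sym (ℚₚ.*-zeroʳ c)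
  Σ<-scale c t (suc n) = trans (cong (_+ c * t n) (Σ<-scale c t n)) (sym (ℚₚ.*-distribˡ-+ c (Σ< n t) (t n)))

  -- In the triangle i + j ≤ n the row of `a 0` meets `b 0` up to `b n`; the remaining rows form the
  -- triangle of the shifted sequence, one size smaller.
  Σ<-conv : ∀ a b n → Σ< (suc n) (conv a b) ≡ a 0 * Σ< (suc n) b + Σ< n (conv (λ k → a (suc k)) b)
  Σ<-conv a b n = begin-equality
    Σ< (suc n) (conv a b)
      ≡⟨ Σ<-head n (conv a b) ⟩
    a 0 * b 0 + Σ< n (λ k → a 0 * b (suc k) + conv a′ b k)
      ≡⟨ cong (a 0 * b 0 +_) (Σ<-+ (λ k → a 0 * b (suc k)) (conv a′ b) n) ⟩
    a 0 * b 0 + (Σ< n (λ k → a 0 * b (suc k)) + Σ< n (conv a′ b))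
      ≡⟨ cong (λ z → a 0 * b 0 + (z + Σ< n (conv a′ b))) (Σ<-scale (a 0) (λ k → b (suc k)) n) ⟩
    a 0 * b 0 + (a 0 * Σ< n (λ k → b (suc k)) + Σ< n (conv a′ b))
      ≡⟨ solve 4 (λ a b s v → a :* b :+ (a :* s :+ v) := a :* (b :+ s) :+ v) refl
           (a 0) (b 0) (Σ< n (λ k → b (suc k))) (Σ< n (conv a′ b)) ⟩
    a 0 * (b 0 + Σ< n (λ k → b (suc k))) + Σ< n (conv a′ b)
      ≡⟨ cong (λ z → a 0 * z + Σ< n (conv a′ b)) (sym (Σ<-head n b)) ⟩
    a 0 * Σ< (suc n) b + Σ< n (conv a′ b) ∎
    where
    a′ : ℕ → ℚ
    a′ k = a (suc k)

  -- The error of the Cauchy product has size n * ¼ ^ n. The ratio ¼ = ½ * ½ leaves a factor ½ ^ n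
  -- to absorb n and another one to tend to 0. The factor ¾ = 1 - ¼ comes from summing the geometric
  -- series.
  ¼ ¾ : ℚ
  ¼ = ℤ.+ 1 / 4
  ¾ = ℤ.+ 3 / 4

  ¼^≥0 : ∀ k → 0ℚ ≤ ¼ ^ k
  ¼^≥0 = ^≥0 {¼} (ℚₚ.≤ᵇ⇒≤ _)

  -- The difference is the sum over i < n of `a i` times a tail of `b` starting at n - i, and each
  -- such product is at most K L ¼ ^ n up to the factor ¾. The induction strips `a 0`; the offset
  -- `m` keeps the length of the `b`-sum fixed while n decreases.
  cauchy-product : ∀ (b : ℕ → ℚ) L → 0ℚ ≤ L → (∀ k → ∣ b k ∣ ≤ L * ¼ ^ k) →
    ∀ n m (a : ℕ → ℚ) K → 0ℚ ≤ K → (∀ k → ∣ a k ∣ ≤ K * ¼ ^ k) →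
    ¾ * ∣ Σ< n a * Σ< (m ℕ.+ n) b - Σ< n (conv a b) ∣ ≤ ι n * (K * (L * ¼ ^ n))
  cauchy-product b L L≥0 hb zero m a K K≥0 ha = ℚₚ.≤-reflexive
    (trans (cong (λ z → ¾ * ∣ z ∣) (solve 1 (λ s → con 0ℚ :* s :- con 0ℚ := con 0ℚ) refl (Σ< (m ℕ.+ 0) b)))
           (solve 1 (λ k → con 0ℚ := con 0ℚ :* k) refl (K * (L * ¼ ^ 0))))
  cauchy-product b L L≥0 hb (suc n) m a K K≥0 ha = begin
    ¾ * ∣ Σ< (suc n) a * B - Σ< (suc n) (conv a b) ∣
      ≡⟨ cong (λ z → ¾ * ∣ z ∣) (trans
           (cong₂ (λ p q → p * B - q) (Σ<-head n a) (Σ<-conv a b n))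
           (solve 5 (λ a s B B′ v → (a :+ s) :* B :- (a :* B′ :+ v) := a :* (B :- B′) :+ (s :* B :- v)) refl
             (a 0) (Σ< n a′) B B′ (Σ< n (conv a′ b)))) ⟩
    ¾ * ∣ a 0 * (B - B′) + R ∣
      ≤⟨ *-monoʳ {¾} (ℚₚ.≤ᵇ⇒≤ _) (ℚₚ.≤-trans (ℚₚ.∣p+q∣≤∣p∣+∣q∣ (a 0 * (B - B′)) R)
           (ℚₚ.≤-reflexive (cong (_+ ∣ R ∣) (ℚₚ.∣p*q∣≡∣p∣*∣q∣ (a 0) (B - B′))))) ⟩
    ¾ * (∣ a 0 ∣ * ∣ B - B′ ∣ + ∣ R ∣)
      ≡⟨ solve 4 (λ c x y z → c :* (x :* y :+ z) := x :* (c :* y) :+ c :* z) refl ¾ (∣ a 0 ∣) (∣ B - B′ ∣) (∣ R ∣) ⟩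
    ∣ a 0 ∣ * (¾ * ∣ B - B′ ∣) + ¾ * ∣ R ∣
      ≤⟨ ℚₚ.+-mono-≤
           (*-mono (ℚₚ.0≤∣p∣ (a 0)) (nn* {¾} (ℚₚ.≤ᵇ⇒≤ _) (ℚₚ.0≤∣p∣ (B - B′))) (ha 0) tail)
           rest ⟩
    (K * 1ℚ) * (L * ¼ ^ suc n) + ι n * ((K * ¼) * (L * ¼ ^ n))
      ≡⟨ solve 5 (λ k l n c p → (k :* con 1ℚ) :* (l :* (c :* p)) :+ n :* ((k :* c) :* (l :* p))
                             := (con 1ℚ :+ n) :* (k :* (l :* (c :* p)))) refl K L (ι n) ¼ (¼ ^ n) ⟩
    (1ℚ + ι n) * (K * (L * ¼ ^ suc n))
      ≡⟨ cong (_* (K * (L * ¼ ^ suc n))) (sym (ι-+ 1 n)) ⟩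
    ι (suc n) * (K * (L * ¼ ^ suc n)) ∎
    where
    a′ : ℕ → ℚ
    a′ k = a (suc k)
    B B′ R : ℚ
    B  = Σ< (m ℕ.+ suc n) b
    B′ = Σ< (suc n) b
    R  = Σ< n a′ * B - Σ< n (conv a′ b)
    tail : ¾ * ∣ B - B′ ∣ ≤ L * ¼ ^ suc n
    tail = geometric (λ n → Σ< n b) L ¾ L≥0 (ℚₚ.≤ᵇ⇒≤ _) (ℚₚ.≤ᵇ⇒≤ _)
      (λ n → subst (λ z → ∣ z ∣ ≤ L * ¼ ^ n) (sym (Σ<-step n b)) (hb n)) (suc n) m
    rest : ¾ * ∣ R ∣ ≤ ι n * ((K * ¼) * (L * ¼ ^ n))
    rest = subst (λ i → ¾ * ∣ Σ< n a′ * Σ< i b - Σ< n (conv a′ b) ∣ ≤ ι n * ((K * ¼) * (L * ¼ ^ n)))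
      (sym (ℕₚ.+-suc m n))
      (cauchy-product b L L≥0 hb n (suc m) a′ (K * ¼) (nn* {K} {¼} K≥0 (ℚₚ.≤ᵇ⇒≤ _))
        (λ k → ℚₚ.≤-trans (ha (suc k)) (ℚₚ.≤-reflexive (sym (ℚₚ.*-assoc K ¼ (¼ ^ k))))))

  ι*½^≤1 : ∀ n → ι n * ½ ^ n ≤ 1ℚ
  ι*½^≤1 zero    = ℚₚ.≤ᵇ⇒≤ _
  ι*½^≤1 (suc n) = begin
    ι (suc n) * ½ ^ suc n              ≡⟨ cong (_* ½ ^ suc n) (ι-+ 1 n) ⟩
    (1ℚ + ι n) * ½ ^ suc n             ≡⟨ solve 2 (λ n p → (con 1ℚ :+ n) :* (con ½ :* p) := con ½ :* (p :+ n :* p)) refl (ι n) (½ ^ n) ⟩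
    ½ * (½ ^ n + ι n * ½ ^ n)          ≤⟨ *-monoʳ ½≥0 (ℚₚ.+-mono-≤ (½^-anti {0} {n} ℕ.z≤n) (ι*½^≤1 n)) ⟩
    ½ * (1ℚ + 1ℚ)                      ≡⟨⟩
    1ℚ                                 ∎

  product-error : ∀ a b K → 0ℚ ≤ K → (∀ k → ∣ a k ∣ ≤ K * ¼ ^ k) → (∀ k → ∣ b k ∣ ≤ K * ¼ ^ k) →
    ∀ n → ¾ * ∣ Σ< n a * Σ< n b - Σ< n (conv a b) ∣ ≤ (K * K) * ½ ^ n
  product-error a b K K≥0 ha hb n = begin
    ¾ * ∣ Σ< n a * Σ< n b - Σ< n (conv a b) ∣
      ≤⟨ cauchy-product b K K≥0 hb n 0 a K K≥0 ha ⟩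
    ι n * (K * (K * ¼ ^ n))
      ≡⟨ cong (λ z → ι n * (K * (K * z))) (*-^ ½ ½ n) ⟩
    ι n * (K * (K * (½ ^ n * ½ ^ n)))
      ≡⟨ solve 3 (λ n k h → n :* (k :* (k :* (h :* h))) := (n :* h) :* ((k :* k) :* h)) refl (ι n) K (½ ^ n) ⟩
    (ι n * ½ ^ n) * ((K * K) * ½ ^ n)
      ≤⟨ *-monoˡ (nn* (nn* K≥0 K≥0) (^≥0 ½≥0 n)) (ι*½^≤1 n) ⟩
    1ℚ * ((K * K) * ½ ^ n)
      ≡⟨ ℚₚ.*-identityˡ _ ⟩
    (K * K) * ½ ^ n ∎

  -- The general Taylor bound has ratio ½. Applied to 2x and multiplied by ½ ^ k it gives ratio ¼
  -- for x. The sign is inserted only to match the alternating form of `taylor-dominated`.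
  expTerm-bound : ∀ b → Σ[ K ∈ ℚ ] 0ℚ < K × (∀ x → ∣ x ∣ ≤ ι b → ∀ k → ∣ expTerm x k ∣ ≤ K * ¼ ^ k)
  expTerm-bound b =
    let K , K>0 , small , _ = taylor-dominated (λ k → k) (λ _ → ℕₚ.≤-refl) (2 ℕ.* b) in
    K , K>0 , λ x x≤b k → begin
      ∣ expTerm x k ∣
        ≡⟨ cong ∣_∣ (scaled x k) ⟩
      ∣ ½ ^ k * ((ι 2 * x) ^ k * 1/ k !) ∣
        ≡⟨ trans (ℚₚ.∣p*q∣≡∣p∣*∣q∣ (½ ^ k) _)
             (cong₂ _*_ (ℚₚ.0≤p⇒∣p∣≡p (^≥0 ½≥0 k)) (sym (∣sign∣ k ((ι 2 * x) ^ k * 1/ k !)))) ⟩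
      ½ ^ k * ∣ (- 1ℚ) ^ k * ((ι 2 * x) ^ k * 1/ k !) ∣
        ≤⟨ *-monoʳ (^≥0 ½≥0 k) (small k (ι 2 * x) (begin
             ∣ ι 2 * x ∣         ≡⟨ ℚₚ.∣p*q∣≡∣p∣*∣q∣ (ι 2) x ⟩
             ι 2 * ∣ x ∣         ≤⟨ *-monoʳ {ι 2} (ι≥0 2) x≤b ⟩
             ι 2 * ι b           ≡⟨ sym (ι-* 2 b) ⟩
             ι (2 ℕ.* b)         ∎)) ⟩
      ½ ^ k * (K * ½ ^ k)
        ≡⟨ solve 2 (λ h K → h :* (K :* h) := K :* (h :* h)) refl (½ ^ k) K ⟩
      K * (½ ^ k * ½ ^ k)
        ≡⟨ cong (K *_) (sym (*-^ ½ ½ k)) ⟩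
      K * ¼ ^ k ∎
    where
    scaled : ∀ x k → expTerm x k ≡ ½ ^ k * ((ι 2 * x) ^ k * 1/ k !)
    scaled x k = trans
      (cong (λ z → z ^ k * 1/ k !) (solve 1 (λ x → x := con ½ :* (con (ι 2) :* x)) refl x))
      (trans (cong (_* 1/ k !) (*-^ ½ (ι 2 * x) k)) (ℚₚ.*-assoc (½ ^ k) ((ι 2 * x) ^ k) (1/ k !)))

  -- Approximate addition formulas on bounded sets

  module _ (b : ℕ) where

    private
      K : ℚ
      K = proj₁ (expTerm-bound b)
      K≥0 : 0ℚ ≤ K
      K≥0 = ℚₚ.<⇒≤ (proj₁ (proj₂ (expTerm-bound b)))

      signed : ∀ s x k → ∣ s ∣ ≤ 1ℚ → ∣ x ∣ ≤ ι b → ∣ s * expTerm x k ∣ ≤ K * ¼ ^ k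
      signed s x k s≤1 x≤b = begin
        ∣ s * expTerm x k ∣     ≡⟨ ℚₚ.∣p*q∣≡∣p∣*∣q∣ s (expTerm x k) ⟩
        ∣ s ∣ * ∣ expTerm x k ∣ ≤⟨ *-monoˡ (ℚₚ.0≤∣p∣ (expTerm x k)) s≤1 ⟩
        1ℚ * ∣ expTerm x k ∣    ≡⟨ ℚₚ.*-identityˡ _ ⟩
        ∣ expTerm x k ∣         ≤⟨ proj₂ (proj₂ (expTerm-bound b)) x x≤b k ⟩
        K * ¼ ^ k               ∎

      cos-signed : ∀ x → ∣ x ∣ ≤ ι b → ∀ k → ∣ cosCoeff x k ∣ ≤ K * ¼ ^ k
      cos-signed x x≤b k = signed (cosSign k) x k (proj₁ (∣signs∣≤1 k)) x≤b

      sin-signed : ∀ x → ∣ x ∣ ≤ ι b → ∀ k → ∣ sinCoeff x k ∣ ≤ K * ¼ ^ k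
      sin-signed x x≤b k = signed (sinSign k) x k (proj₂ (∣signs∣≤1 k)) x≤b

    addition-bound : ℚ
    addition-bound = K * K + K * K

    -- By `binomial` and the rules for signs, the coefficients of x + y are exact combinations of
    -- convolutions. The only error is that of two truncated Cauchy products, each contributing one
    -- summand `K * K`.
    cosSum-+ : ∀ x y → ∣ x ∣ ≤ ι b → ∣ y ∣ ≤ ι b → ∀ n →
      ¾ * ∣ cosSum n (x + y) - (cosSum n x * cosSum n y - sinSum n x * sinSum n y) ∣
        ≤ addition-bound * ½ ^ (2 ℕ.* n)
    cosSum-+ x y x≤b y≤b n = begin
      ¾ * ∣ cosSum n (x + y) - (cosSum n x * cosSum n y - sinSum n x * sinSum n y) ∣
        ≡⟨ cong (λ z → ¾ * ∣ z ∣) (trans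
             (cong₂ _-_ expand (cong₂ _-_ (cong₂ _*_ (cosSum≡ n x) (cosSum≡ n y))
                                          (cong₂ _*_ (sinSum≡ n x) (sinSum≡ n y))))
             (solve 4 (λ c s p q → (c :- s) :- (p :- q) := (q :- s) :- (p :- c)) refl CC SS (C x * C y) (S x * S y))) ⟩
      ¾ * ∣ (S x * S y - SS) - (C x * C y - CC) ∣
        ≤⟨ two-errors (S x * S y - SS) (C x * C y - CC) ⟩
      ¾ * ∣ S x * S y - SS ∣ + ¾ * ∣ C x * C y - CC ∣
        ≤⟨ ℚₚ.+-mono-≤
             (product-error (sinCoeff x) (sinCoeff y) K K≥0 (sin-signed x x≤b) (sin-signed y y≤b) N)
             (product-error (cosCoeff x) (cosCoeff y) K K≥0 (cos-signed x x≤b) (cos-signed y y≤b) N) ⟩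
      (K * K) * ½ ^ N + (K * K) * ½ ^ N
        ≡⟨ sym (ℚₚ.*-distribʳ-+ (½ ^ N) (K * K) (K * K)) ⟩
      addition-bound * ½ ^ N ∎
      where
      N : ℕ
      N = 2 ℕ.* n
      C S : ℚ → ℚ
      C x = Σ< N (cosCoeff x)
      S x = Σ< N (sinCoeff x)
      CC SS : ℚ
      CC = Σ< N (conv (cosCoeff x) (cosCoeff y))
      SS = Σ< N (conv (sinCoeff x) (sinCoeff y))
      two-errors : ∀ p q → ¾ * ∣ p - q ∣ ≤ ¾ * ∣ p ∣ + ¾ * ∣ q ∣
      two-errors p q = begin
        ¾ * ∣ p - q ∣           ≤⟨ *-monoʳ {¾} (ℚₚ.≤ᵇ⇒≤ _) (ℚₚ.∣p-q∣≤∣p∣+∣q∣ p q) ⟩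
        ¾ * (∣ p ∣ + ∣ q ∣)     ≡⟨ ℚₚ.*-distribˡ-+ ¾ (∣ p ∣) (∣ q ∣) ⟩
        ¾ * ∣ p ∣ + ¾ * ∣ q ∣   ∎
      coeff : ∀ k → cosCoeff (x + y) k ≡ conv (cosCoeff x) (cosCoeff y) k + - 1ℚ * conv (sinCoeff x) (sinCoeff y) k
      coeff k = trans (cong (cosSign k *_) (binomial x y k))
        (trans (conv-split (cosSign k) (expTerm x) (expTerm y) (cosCoeff x) (cosCoeff y)
                 -- `conv-split` produces a sum, so the minus sign of `cosSign-+` is moved into the
                 -- first factor and pulled out again by `conv-scaleˡ`.
                 (λ i → - 1ℚ * sinCoeff x i) (sinCoeff y) k λ i j i+j≡ →
                 trans (cong (λ m → cosSign m * (expTerm x i * expTerm y j)) (sym i+j≡))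
                 (trans (cong (_* (expTerm x i * expTerm y j)) (cosSign-+ i j))
                   (solve 6 (λ a b c d e f → (a :* c :- b :* d) :* (e :* f)
                      := (a :* e) :* (c :* f) :+ (con (- 1ℚ) :* (b :* e)) :* (d :* f)) refl
                      (cosSign i) (sinSign i) (cosSign j) (sinSign j) (expTerm x i) (expTerm y j))))
               (cong (conv (cosCoeff x) (cosCoeff y) k +_) (conv-scaleˡ (- 1ℚ) (sinCoeff x) (sinCoeff y) k)))
      expand : cosSum n (x + y) ≡ CC - SS
      expand = trans (cosSum≡ n (x + y)) (trans (Σ<-cong coeff N)
        (trans (Σ<-+ (conv (cosCoeff x) (cosCoeff y)) (λ k → - 1ℚ * conv (sinCoeff x) (sinCoeff y) k) N)
        (trans (cong (CC +_) (Σ<-scale (- 1ℚ) (conv (sinCoeff x) (sinCoeff y)) N))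
          (solve 2 (λ c s → c :+ con (- 1ℚ) :* s := c :- s) refl CC SS))))

    sinSum-+ : ∀ x y → ∣ x ∣ ≤ ι b → ∣ y ∣ ≤ ι b → ∀ n →
      ¾ * ∣ sinSum n (x + y) - (sinSum n x * cosSum n y + cosSum n x * sinSum n y) ∣
        ≤ addition-bound * ½ ^ (2 ℕ.* n)
    sinSum-+ x y x≤b y≤b n = begin
      ¾ * ∣ sinSum n (x + y) - (sinSum n x * cosSum n y + cosSum n x * sinSum n y) ∣
        ≡⟨ cong (λ z → ¾ * ∣ z ∣) (trans
             (cong₂ _-_ expand (cong₂ _+_ (cong₂ _*_ (sinSum≡ n x) (cosSum≡ n y))
                                          (cong₂ _*_ (cosSum≡ n x) (sinSum≡ n y))))
             (solve 4 (λ c s p q → (c :+ s) :- (p :+ q) := :- ((p :- c) :+ (q :- s))) refl SC CS (S x * C y) (C x * S y))) ⟩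
      ¾ * ∣ - ((S x * C y - SC) + (C x * S y - CS)) ∣
        ≤⟨ two-errors (S x * C y - SC) (C x * S y - CS) ⟩
      ¾ * ∣ S x * C y - SC ∣ + ¾ * ∣ C x * S y - CS ∣
        ≤⟨ ℚₚ.+-mono-≤
             (product-error (sinCoeff x) (cosCoeff y) K K≥0 (sin-signed x x≤b) (cos-signed y y≤b) N)
             (product-error (cosCoeff x) (sinCoeff y) K K≥0 (cos-signed x x≤b) (sin-signed y y≤b) N) ⟩
      (K * K) * ½ ^ N + (K * K) * ½ ^ N
        ≡⟨ sym (ℚₚ.*-distribʳ-+ (½ ^ N) (K * K) (K * K)) ⟩
      addition-bound * ½ ^ N ∎
      where
      N : ℕ
      N = 2 ℕ.* n
      C S : ℚ → ℚ
      C x = Σ< N (cosCoeff x)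
      S x = Σ< N (sinCoeff x)
      SC CS : ℚ
      SC = Σ< N (conv (sinCoeff x) (cosCoeff y))
      CS = Σ< N (conv (cosCoeff x) (sinCoeff y))
      two-errors : ∀ p q → ¾ * ∣ - (p + q) ∣ ≤ ¾ * ∣ p ∣ + ¾ * ∣ q ∣
      two-errors p q = begin
        ¾ * ∣ - (p + q) ∣       ≡⟨ cong (¾ *_) (ℚₚ.∣-p∣≡∣p∣ (p + q)) ⟩
        ¾ * ∣ p + q ∣           ≤⟨ *-monoʳ {¾} (ℚₚ.≤ᵇ⇒≤ _) (ℚₚ.∣p+q∣≤∣p∣+∣q∣ p q) ⟩
        ¾ * (∣ p ∣ + ∣ q ∣)     ≡⟨ ℚₚ.*-distribˡ-+ ¾ (∣ p ∣) (∣ q ∣) ⟩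
        ¾ * ∣ p ∣ + ¾ * ∣ q ∣   ∎
      coeff : ∀ k → sinCoeff (x + y) k ≡ conv (sinCoeff x) (cosCoeff y) k + conv (cosCoeff x) (sinCoeff y) k
      coeff k = trans (cong (sinSign k *_) (binomial x y k))
        (conv-split (sinSign k) (expTerm x) (expTerm y) (sinCoeff x) (cosCoeff y)
                 (cosCoeff x) (sinCoeff y) k λ i j i+j≡ →
                 trans (cong (λ m → sinSign m * (expTerm x i * expTerm y j)) (sym i+j≡))
                 (trans (cong (_* (expTerm x i * expTerm y j)) (sinSign-+ i j))
                   (solve 6 (λ a b c d e f → (b :* c :+ a :* d) :* (e :* f)
                      := (b :* e) :* (c :* f) :+ (a :* e) :* (d :* f)) refl
                      (cosSign i) (sinSign i) (cosSign j) (sinSign j) (expTerm x i) (expTerm y j))))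
      expand : sinSum n (x + y) ≡ SC + CS
      expand = trans (sinSum≡ n (x + y)) (trans (Σ<-cong coeff N)
        (Σ<-+ (conv (sinCoeff x) (cosCoeff y)) (conv (cosCoeff x) (sinCoeff y)) N))

  addition-null : ∀ (b N : ℕ) (s : ℕ → ℚ) →
    (∀ n → N ℕ.≤ n → ¾ * ∣ s n ∣ ≤ addition-bound b * ½ ^ (2 ℕ.* n)) → IsNull s
  addition-null b N s h ε ε>0 =
    let K>0 = proj₁ (proj₂ (expTerm-bound b))
        B>0 = ℚₚ.+-mono-< (pos* K>0 K>0) (pos* K>0 K>0)
        δ , δ>0 , Bδ≡ = quotient (addition-bound b) (¾ * ε) B>0 (pos* {¾} (ℚₚ.positive⁻¹ ¾) ε>0)
        M , ½^M<δ = ^-vanishes ½ ½>0 ½≤1 δ δ>0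
    in N ℕ.+ M , λ n n≥ → *-cancelˡ< {¾} (ℚₚ.positive⁻¹ ¾) (begin-strict
      ¾ * ∣ s n ∣
        ≤⟨ h n (ℕₚ.≤-trans (ℕₚ.m≤m+n N M) n≥) ⟩
      addition-bound b * ½ ^ (2 ℕ.* n)
        ≤⟨ *-monoʳ (ℚₚ.<⇒≤ B>0) (½^-anti (ℕₚ.≤-trans (ℕₚ.m≤n+m M N) (ℕₚ.≤-trans n≥ (ℕₚ.m≤n*m n 2)))) ⟩
      addition-bound b * ½ ^ M
        <⟨ ℚₚ.*-monoʳ-<-pos (addition-bound b) {{ Rat.positive B>0 }} ½^M<δ ⟩
      addition-bound b * δ
        ≡⟨ Bδ≡ ⟩
      ¾ * ε ∎)

  -- Parity and values at zero

  neg-^-even : ∀ x k → (- x) ^ (2 ℕ.* k) ≡ x ^ (2 ℕ.* k)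
  neg-^-even x zero    = refl
  neg-^-even x (suc k) = subst (λ m → (- x) ^ m ≡ x ^ m) (sym (ℕₚ.*-suc 2 k))
    (trans (cong (λ z → - x * (- x * z)) (neg-^-even x k))
      (solve 2 (λ x p → (:- x) :* ((:- x) :* p) := x :* (x :* p)) refl x (x ^ (2 ℕ.* k))))

  cosSum-neg : ∀ n x → cosSum n (- x) ≡ cosSum n x
  cosSum-neg n x = Σ<-cong (λ k → cong (λ z → (- 1ℚ) ^ k * (z * 1/ (2 ℕ.* k) !)) (neg-^-even x k)) n

  sinSum-neg : ∀ n x → sinSum n (- x) ≡ - sinSum n x
  sinSum-neg n x = trans (Σ<-cong term n) (trans (Σ<-scale (- 1ℚ) (sinTerm x) n)
    (solve 1 (λ s → con (- 1ℚ) :* s := :- s) refl (sinSum n x)))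
    where
    term : ∀ k → sinTerm (- x) k ≡ - 1ℚ * sinTerm x k
    term k = trans (cong (λ z → (- 1ℚ) ^ k * ((- x * z) * 1/ suc (2 ℕ.* k) !)) (neg-^-even x k))
      (solve 4 (λ s x p u → s :* (((:- x) :* p) :* u) := con (- 1ℚ) :* (s :* ((x :* p) :* u))) refl
        ((- 1ℚ) ^ k) x (x ^ (2 ℕ.* k)) (1/ suc (2 ℕ.* k) !))

  sinSum-zero : ∀ n → sinSum n 0ℚ ≡ 0ℚ
  sinSum-zero n = trans (Σ<-cong (λ k → solve 3 (λ s p u → s :* ((con 0ℚ :* p) :* u) := con 0ℚ :* s) refl
      ((- 1ℚ) ^ k) (0ℚ ^ (2 ℕ.* k)) (1/ suc (2 ℕ.* k) !)) n)
    (trans (Σ<-scale 0ℚ ((- 1ℚ) ^_) n) (ℚₚ.*-zeroˡ (Σ< n ((- 1ℚ) ^_))))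

  cosSum-zero : ∀ n → cosSum (suc n) 0ℚ ≡ 1ℚ
  cosSum-zero zero    = refl
  cosSum-zero (suc n) = trans (cong₂ _+_ (cosSum-zero n)
    (trans (cong (λ m → (- 1ℚ) ^ suc n * (0ℚ ^ m * 1/ m !)) (ℕₚ.*-suc 2 n))
      (solve 3 (λ s p u → s :* ((con 0ℚ :* p) :* u) := con 0ℚ) refl
        ((- 1ℚ) ^ suc n) (0ℚ ^ suc (2 ℕ.* n)) (1/ (2 ℕ.+ 2 ℕ.* n) !)))) refl

  -- Alternating sums and a lower bound for the sine

  Σ<-alternating-suc : ∀ (a : ℕ → ℚ) n →
    Σ< (suc n) (λ k → (- 1ℚ) ^ k * a k) ≡ a 0 - Σ< n (λ k → (- 1ℚ) ^ k * a (suc k))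
  Σ<-alternating-suc a n = trans (Σ<-head n (λ k → (- 1ℚ) ^ k * a k))
    (trans (cong ((- 1ℚ) ^ 0 * a 0 +_) (trans
        (Σ<-cong (λ k → ℚₚ.*-assoc (- 1ℚ) ((- 1ℚ) ^ k) (a (suc k))) n)
        (Σ<-scale (- 1ℚ) (λ k → (- 1ℚ) ^ k * a (suc k)) n)))
      (solve 2 (λ a s → con 1ℚ :* a :+ con (- 1ℚ) :* s := a :- s) refl
        (a 0) (Σ< n (λ k → (- 1ℚ) ^ k * a (suc k)))))

  -- Splitting off the first term leaves `a 0` minus the alternating sum of the shifted sequence,
  -- which by induction lies between 0 and `a 1`.
  alternating : ∀ (a : ℕ → ℚ) → (∀ k → 0ℚ ≤ a k) → (∀ k → a (suc k) ≤ a k) → ∀ n →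
    0ℚ ≤ Σ< n (λ k → (- 1ℚ) ^ k * a k) × Σ< n (λ k → (- 1ℚ) ^ k * a k) ≤ a 0
  alternating a a≥0 a↓ zero    = ℚₚ.≤-refl , a≥0 0
  alternating a a≥0 a↓ (suc n) =
    let lower , upper = alternating (λ k → a (suc k)) (λ k → a≥0 (suc k)) (λ k → a↓ (suc k)) n
        A = Σ< n (λ k → (- 1ℚ) ^ k * a (suc k))
    in subst (λ z → 0ℚ ≤ z × z ≤ a 0) (sym (Σ<-alternating-suc a n))
      ( sub≥0 (ℚₚ.≤-trans upper (a↓ 0))
      , ≤-cert lower (solve 2 (λ a s → a :- (a :- s) := s) refl (a 0) A) )

  module _ (x : ℚ) (x≥0 : 0ℚ ≤ x) (x≤2 : x ≤ ι 2) where

    private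
      expTerm≥0 : ∀ k → 0ℚ ≤ expTerm x k
      expTerm≥0 k = nn* (^≥0 x≥0 k) (1/!≥0 k)

      -- The ratio of these terms is x/(k+2), at most 1 for x ≤ 2. The pair of indices 0 and 1 is
      -- left out because its ratio is x itself.
      expTerm-↓ : ∀ k → expTerm x (2 ℕ.+ k) ≤ expTerm x (1 ℕ.+ k)
      expTerm-↓ k = *-cancelˡ (ℚₚ.<-≤-trans 0<1 (ι-mono {1} {2 ℕ.+ k} (ℕ.s≤s ℕ.z≤n))) (begin
        ι (2 ℕ.+ k) * expTerm x (2 ℕ.+ k) ≡⟨ expTerm-suc x (suc k) ⟩
        x * expTerm x (suc k)             ≤⟨ *-monoˡ (expTerm≥0 (suc k))
                                               (ℚₚ.≤-trans x≤2 (ι-mono (ℕₚ.m≤m+n 2 k))) ⟩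
        ι (2 ℕ.+ k) * expTerm x (suc k)   ∎)

    -- The alternating sum is at least x - x³/6, which exceeds x/3 by x(4 - x²)/6.
    sinSum-lower : ∀ n → ℤ.+ 1 / 3 * x ≤ sinSum (suc n) x
    sinSum-lower n = begin
      ℤ.+ 1 / 3 * x
        ≤⟨ ≤-cert (nn* (nn* {ℤ.+ 1 / 6} (ℚₚ.≤ᵇ⇒≤ _) x≥0) (sub≥0 (*-mono x≥0 x≥0 x≤2 x≤2)))
             (solve 1 (λ x → ((x :* con 1ℚ) :* con (1/ 1 !) :- (x :* (x :* (x :* con 1ℚ))) :* con (1/ 3 !))
                 :- con (ℤ.+ 1 / 3) :* x
               := (con (ℤ.+ 1 / 6) :* x) :* (con (ι 2 * ι 2) :- x :* x)) refl x) ⟩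
      a 0 - a 1
        ≤⟨ ℚₚ.+-monoʳ-≤ (a 0) (ℚₚ.neg-antimono-≤ (proj₂ (alternating (λ k → a (suc k))
             (λ k → expTerm≥0 (suc (2 ℕ.* suc k))) (λ k → a↓ (suc k)) n))) ⟩
      a 0 - Σ< n (λ k → (- 1ℚ) ^ k * a (suc k))
        ≡⟨ sym (Σ<-alternating-suc a n) ⟩
      sinSum (suc n) x ∎
      where
      a : ℕ → ℚ
      a k = expTerm x (suc (2 ℕ.* k))
      a↓ : ∀ k → a (suc k) ≤ a k
      a↓ k = subst (λ m → expTerm x (suc m) ≤ a k) (sym (ℕₚ.*-suc 2 k))
        (ℚₚ.≤-trans (expTerm-↓ (suc (2 ℕ.* k))) (expTerm-↓ (2 ℕ.* k)))

  -- Null sequences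

  null-cong : ∀ {s t} → (∀ n → s n ≡ t n) → IsNull s → IsNull t
  null-cong e h ε ε>0 = proj₁ (h ε ε>0) , λ n n≥ → subst (λ z → ∣ z ∣ < ε) (e n) (proj₂ (h ε ε>0) n n≥)

  null-eventually : ∀ {s} N → (∀ n → N ℕ.≤ n → s n ≡ 0ℚ) → IsNull s
  null-eventually N e ε ε>0 = N , λ n n≥ → subst (λ z → ∣ z ∣ < ε) (sym (e n n≥)) ε>0

  null-neg : ∀ {s} → IsNull s → IsNull (λ n → - s n)
  null-neg {s} h ε ε>0 = proj₁ (h ε ε>0) , λ n n≥ →
    subst (_< ε) (sym (ℚₚ.∣-p∣≡∣p∣ (s n))) (proj₂ (h ε ε>0) n n≥)

  null-+ : ∀ s t → IsNull s → IsNull t → IsNull (λ n → s n + t n)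
  null-+ s t hs ht ε ε>0 =
    let δ>0 = pos* ½>0 ε>0
        M , hM = hs (½ * ε) δ>0
        N , hN = ht (½ * ε) δ>0
    in M ℕ.+ N , λ n n≥ → begin-strict
      ∣ s n + t n ∣     ≤⟨ ℚₚ.∣p+q∣≤∣p∣+∣q∣ (s n) (t n) ⟩
      ∣ s n ∣ + ∣ t n ∣ <⟨ ℚₚ.+-mono-< (hM n (ℕₚ.≤-trans (ℕₚ.m≤m+n M N) n≥))
                                       (hN n (ℕₚ.≤-trans (ℕₚ.m≤n+m N M) n≥)) ⟩
      ½ * ε + ½ * ε     ≡⟨ solve 1 (λ e → con ½ :* e :+ con ½ :* e := e) refl ε ⟩
      ε                 ∎

  null-* : ∀ s t → IsCauchy t → IsNull s → IsNull (λ n → t n * s n)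
  null-* s t ct hs ε ε>0 =
    let b , M , t≤b = bounded {t} ct
        -- The bound `b` may be 0, so `suc b` is taken as a positive divisor.
        B>0 = ℚₚ.<-≤-trans 0<1 (ι-mono {1} {suc b} (ℕ.s≤s ℕ.z≤n))
        δ , δ>0 , Bδ≡ε = quotient (ι (suc b)) ε B>0 ε>0
        N , hN = hs δ δ>0
    in M ℕ.+ N , λ n n≥ → begin-strict
      ∣ t n * s n ∣     ≡⟨ ℚₚ.∣p*q∣≡∣p∣*∣q∣ (t n) (s n) ⟩
      ∣ t n ∣ * ∣ s n ∣ ≤⟨ *-monoˡ (ℚₚ.0≤∣p∣ (s n)) (ℚₚ.≤-trans (t≤b n (ℕₚ.≤-trans (ℕₚ.m≤m+n M N) n≥))
                             (ι-mono (ℕₚ.n≤1+n b))) ⟩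
      ι (suc b) * ∣ s n ∣ <⟨ ℚₚ.*-monoʳ-<-pos (ι (suc b)) {{ Rat.positive B>0 }}
                             (hN n (ℕₚ.≤-trans (ℕₚ.m≤n+m N M) n≥)) ⟩
      ι (suc b) * δ     ≡⟨ Bδ≡ε ⟩
      ε                 ∎

  -- For a variable `k` the normalised fraction does not compute, so the equation is checked between
  -- unnormalised fractions.
  k/11 : ∀ k → ℤ.+ k / 11 ≡ ι k * (ℤ.+ 1 / 11)
  k/11 k = ℚₚ.toℚᵘ-injective (ℚᵘₚ.≃-trans (ℚₚ.toℚᵘ-fromℚᵘ (ℚᵘ.mkℚᵘ (ℤ.+ k) 10))
    (ℚᵘₚ.≃-trans (ℚᵘ.*≡* (cong (ℤ._* ℤ.+ 11) (sym (ℤₚ.*-identityʳ (ℤ.+ k)))))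
      (ℚᵘₚ.≃-sym (ℚᵘₚ.≃-trans (ℚₚ.toℚᵘ-homo-* (ι k) (ℤ.+ 1 / 11))
        (ℚᵘₚ.*-congʳ (ℚₚ.toℚᵘ-fromℚᵘ (ℚᵘ.mkℚᵘ (ℤ.+ k) 0)))))))

  suc-k/11 : ∀ k p → (ℤ.+ suc k / 11) * p ≡ (ℤ.+ k / 11) * p + (ℤ.+ 1 / 11) * p
  suc-k/11 k p = trans (cong (_* p) (trans (k/11 (suc k)) (cong (_* (ℤ.+ 1 / 11)) (ι-+ 1 k))))
    (trans (solve 2 (λ k p → (con 1ℚ :+ k) :* con (ℤ.+ 1 / 11) :* p
                      := k :* con (ℤ.+ 1 / 11) :* p :+ con (ℤ.+ 1 / 11) :* p) refl (ι k) p)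
      (cong (λ z → z * p + (ℤ.+ 1 / 11) * p) (sym (k/11 k))))

  -- The summand `0ℚ` makes this definitionally `fromℕ 0 < x` for a real number `x` with this
  -- sequence.
  Positive : (ℕ → ℚ) → Set
  Positive s = Σ[ δ ∈ ℚ ] 0ℚ < δ × ∃[ N ] (∀ n → N ℕ.≤ n → 0ℚ + δ ≤ s n)

  positive-+ : ∀ s t → Positive s → Positive t → Positive (λ n → s n + t n)
  positive-+ s t (δ , δ>0 , M , hM) (η , η>0 , N , hN) =
    δ + η , ℚₚ.+-mono-< δ>0 η>0 , M ℕ.+ N , λ n n≥ → begin
      0ℚ + (δ + η)          ≡⟨ solve 2 (λ d e → con 0ℚ :+ (d :+ e) := (con 0ℚ :+ d) :+ (con 0ℚ :+ e)) refl δ η ⟩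
      (0ℚ + δ) + (0ℚ + η)   ≤⟨ ℚₚ.+-mono-≤ (hM n (ℕₚ.≤-trans (ℕₚ.m≤m+n M N) n≥))
                                           (hN n (ℕₚ.≤-trans (ℕₚ.m≤n+m N M) n≥)) ⟩
      s n + t n             ∎

  positive-* : ∀ s t → Positive s → Positive t → Positive (λ n → s n * t n)
  positive-* s t (δ , δ>0 , M , hM) (η , η>0 , N , hN) =
    δ * η , pos* δ>0 η>0 , M ℕ.+ N , λ n n≥ → begin
      0ℚ + δ * η            ≡⟨ solve 2 (λ d e → con 0ℚ :+ d :* e := (con 0ℚ :+ d) :* (con 0ℚ :+ e)) refl δ η ⟩
      (0ℚ + δ) * (0ℚ + η)   ≤⟨ *-mono (nn+ ℚₚ.≤-refl (ℚₚ.<⇒≤ δ>0)) (nn+ ℚₚ.≤-refl (ℚₚ.<⇒≤ η>0))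
                                 (hM n (ℕₚ.≤-trans (ℕₚ.m≤m+n M N) n≥)) (hN n (ℕₚ.≤-trans (ℕₚ.m≤n+m N M) n≥)) ⟩
      s n * t n             ∎

  positive-null : ∀ s t → IsNull (λ n → s n - t n) → Positive t → Positive s
  positive-null s t h (δ , δ>0 , N , hN) =
    let M , hM = h (½ * δ) (pos* ½>0 δ>0) in
    ½ * δ , pos* ½>0 δ>0 , M ℕ.+ N , λ n n≥ → begin
      0ℚ + ½ * δ            ≡⟨ solve 1 (λ d → con 0ℚ :+ con ½ :* d := (con 0ℚ :+ d) :- con ½ :* d) refl δ ⟩
      (0ℚ + δ) - ½ * δ      ≤⟨ ℚₚ.+-mono-≤ (hN n (ℕₚ.≤-trans (ℕₚ.m≤n+m N M) n≥))
                                 (ℚₚ.neg-antimono-≤ (ℚₚ.≤-trans (-x≤∣x∣ (s n - t n))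
                                   (ℚₚ.<⇒≤ (hM n (ℕₚ.≤-trans (ℕₚ.m≤m+n M N) n≥))))) ⟩
      t n - (- (s n - t n)) ≡⟨ solve 2 (λ s t → t :- (:- (s :- t)) := s) refl (s n) (t n) ⟩
      s n                   ∎

  -- From index 3 on the approximations of π/2 lie in [1,2], so the arguments lie in [q,2] and
  -- `sinSum-lower` bounds the sums below by q/3.
  sinSum-positive : ∀ (x : ℕ → ℚ) q → 0ℚ < q → q ≤ 1ℚ → (∀ n → x n ≡ q * halfπApprox n) →
    Positive (λ n → sinSum n (x n))
  sinSum-positive x q q>0 q≤1 x≡ = ℤ.+ 1 / 3 * q , pos* {ℤ.+ 1 / 3} (ℚₚ.positive⁻¹ (ℤ.+ 1 / 3)) q>0 , 3 , bound
    where
    q≥0 : 0ℚ ≤ q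
    q≥0 = ℚₚ.<⇒≤ q>0
    bound : ∀ n → 3 ℕ.≤ n → 0ℚ + ℤ.+ 1 / 3 * q ≤ sinSum n (x n)
    bound n n≥ with ℕₚ.m≤n⇒∃[o]m+o≡n n≥
    ... | o , refl = begin
      0ℚ + ℤ.+ 1 / 3 * q              ≡⟨ solve 1 (λ q → con 0ℚ :+ con (ℤ.+ 1 / 3) :* q := con (ℤ.+ 1 / 3) :* (q :* con 1ℚ)) refl q ⟩
      ℤ.+ 1 / 3 * (q * 1ℚ)            ≤⟨ *-monoʳ {ℤ.+ 1 / 3} (ℚₚ.≤ᵇ⇒≤ _) (*-monoʳ q≥0 1≤h) ⟩
      ℤ.+ 1 / 3 * (q * h)             ≤⟨ sinSum-lower (q * h) (nn* q≥0 h≥0) (*-mono {q} {1ℚ} {h} {ι 2} q≥0 h≥0 q≤1 h≤2) (2 ℕ.+ o) ⟩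
      sinSum (3 ℕ.+ o) (q * h)        ≡⟨ cong (sinSum (3 ℕ.+ o)) (sym (x≡ (3 ℕ.+ o))) ⟩
      sinSum (3 ℕ.+ o) (x (3 ℕ.+ o))  ∎
      where
      h : ℚ
      h = halfπApprox (3 ℕ.+ o)
      1≤h : 1ℚ ≤ h
      1≤h = proj₁ (halfπ-range o)
      h≤2 : h ≤ ι 2
      h≤2 = proj₂ (halfπ-range o)
      h≥0 : 0ℚ ≤ h
      h≥0 = ℚₚ.≤-trans (ℚₚ.<⇒≤ 0<1) 1≤h

-- The Gauss sum in a commutative ℚ-algebra

module _ {c ℓ} (R : CommutativeRing c ℓ)
  (morphism : CommutativeRing.rawRing ℚₚ.+-*-commutativeRing
     ACR.-Raw-AlmostCommutative⟶ ACR.fromCommutativeRing R) where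

  open CommutativeRing R
  open ACR._-Raw-AlmostCommutative⟶_ morphism using (⟦_⟧)
  open Relation.Binary.Reasoning.Setoid setoid

  private
    -- Coefficients are compared in ℚ, since equality in `R` is not assumed decidable.
    _≈?_ : ∀ p q → Maybe.Maybe (⟦ p ⟧ ≈ ⟦ q ⟧)
    p ≈? q = Maybe.map (λ p≡q → reflexive (≡.cong ⟦_⟧ p≡q)) (dec⇒maybe (p ℚₚ.≟ q))

  open Algebra.Solver.Ring _ (ACR.fromCommutativeRing R) morphism _≈?_
    using (Polynomial; solve; con; _:+_; _:*_; _:-_; :-_; _:=_)

  -- Numerals are images of rationals, so under the embedding of ℚ into ℝ they become `fromℕ n` by
  -- definition.
  #_ : ℕ → Carrier
  # n = ⟦ ℤ.+ n / 1 ⟧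

  :#_ : ∀ {m} → ℕ → Polynomial m
  :# n = con (ℤ.+ n / 1)

  infix 9 #_ :#_

  -- Cancellation and consequences of the addition formulas

  cancel : ∀ {x y z} → y * z ≈ # 1 → x * y ≈ # 0 → x ≈ # 0
  cancel {x} {y} {z} yz≈1 xy≈0 = begin
    x           ≈⟨ solve 1 (λ x → x := x :* :# 1) refl x ⟩
    x * # 1     ≈⟨ *-congˡ yz≈1 ⟨
    x * (y * z) ≈⟨ *-assoc x y z ⟨
    x * y * z   ≈⟨ *-congʳ xy≈0 ⟩
    # 0 * z     ≈⟨ solve 1 (λ z → :# 0 :* z := :# 0) refl z ⟩
    # 0         ∎

  -- Here `c`, `s` are the cosine and sine at an angle, `c⁻`, `s⁻` those at its negative, and `d` is
  -- the cosine of their sum 0.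
  pythagorean : ∀ c s c⁻ s⁻ d → d ≈ c * c⁻ - s * s⁻ → c⁻ ≈ c → s⁻ ≈ - s → d ≈ # 1 →
    c * c + s * s ≈ # 1
  pythagorean c s c⁻ s⁻ d d≈ c⁻≈ s⁻≈ d≈1 = begin
    c * c + s * s       ≈⟨ solve 2 (λ c s → c :* c :+ s :* s := c :* c :- s :* (:- s)) refl c s ⟩
    c * c - s * (- s)   ≈⟨ +-cong (*-congˡ c⁻≈) (-‿cong (*-congˡ s⁻≈)) ⟨
    c * c⁻ - s * s⁻     ≈⟨ d≈ ⟨
    d                   ≈⟨ d≈1 ⟩
    # 1                 ∎

  -- Lower case letters are values at π/2, capitals values at π. The square of `s` is eliminated by
  -- c² - s² = 2c² - (c² + s²).
  double-right-angle : ∀ c s S C → c ≈ # 0 → c * c + s * s ≈ # 1 →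
    S ≈ s * c + c * s → C ≈ c * c - s * s → S ≈ # 0 × C ≈ - # 1
  double-right-angle c s S C c≈0 c²+s²≈1 S≈ C≈ = (begin
    S                   ≈⟨ S≈ ⟩
    s * c + c * s       ≈⟨ +-cong (*-congˡ c≈0) (*-congʳ c≈0) ⟩
    s * # 0 + # 0 * s   ≈⟨ solve 1 (λ s → s :* :# 0 :+ :# 0 :* s := :# 0) refl s ⟩
    # 0                 ∎) , (begin
    C                   ≈⟨ C≈ ⟩
    c * c - s * s
      ≈⟨ solve 2 (λ c s → c :* c :- s :* s := c :* (c :+ c) :- (c :* c :+ s :* s)) refl c s ⟩
    c * (c + c) - (c * c + s * s)
      ≈⟨ +-cong (*-congʳ c≈0) (-‿cong c²+s²≈1) ⟩
    # 0 * (c + c) - # 1 ≈⟨ solve 1 (λ c → :# 0 :* (c :+ c) :- :# 1 := :- :# 1) refl c ⟩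
    - # 1               ∎)

  supplement : ∀ S C c s s⁻ v → S ≈ # 0 → C ≈ - # 1 → s⁻ ≈ - s → v ≈ S * c + C * s⁻ → v ≈ s
  supplement S C c s s⁻ v S≈0 C≈-1 s⁻≈ v≈ = begin
    v                         ≈⟨ v≈ ⟩
    S * c + C * s⁻            ≈⟨ +-cong (*-congʳ S≈0) (*-cong C≈-1 s⁻≈) ⟩
    # 0 * c + - # 1 * (- s)   ≈⟨ solve 2 (λ c s → :# 0 :* c :+ (:- :# 1) :* (:- s) := s) refl c s ⟩
    s                         ∎

  -- With `C`, `S` the values at π/2 this is the cosine of π/2 - x. The factor `S` is kept: later
  -- arguments use only that it is positive.
  complement : ∀ C S c s s⁻ v → C ≈ # 0 → s⁻ ≈ - s → v ≈ C * c - S * s⁻ → v ≈ S * s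
  complement C S c s s⁻ v C≈0 s⁻≈ v≈ = begin
    v                         ≈⟨ v≈ ⟩
    C * c - S * s⁻            ≈⟨ +-cong (*-congʳ C≈0) (-‿cong (*-congˡ s⁻≈)) ⟩
    # 0 * c - S * (- s)       ≈⟨ solve 3 (λ S c s → :# 0 :* c :- S :* (:- s) := S :* s) refl S c s ⟩
    S * s                     ∎

  -- `S k` and `C k` stand for sin kθ and cos kθ. All hypotheses also hold for θ = -π/11, so they
  -- determine the Gauss sum only up to sign.
  module Elevenths (S C : ℕ → Carrier)
    (S-zero : S 0 ≈ # 0) (C-zero : C 0 ≈ # 1)
    (S-suc : ∀ k → S (suc k) ≈ S k * C 1 + C k * S 1)
    (C-suc : ∀ k → C (suc k) ≈ C k * C 1 - S k * S 1)
    (pythagoras : C 1 * C 1 + S 1 * S 1 ≈ # 1)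
    (reflection : S 6 ≈ S 5)
    (1/s : Carrier) (s-inverse : S 1 * 1/s ≈ # 1)
    where

    s x : Carrier
    s = S 1
    x = C 1

    -- Chebyshev polynomials: cos kθ = T k and sin kθ = sin θ · U k at x = cos θ.
    T U : ℕ → Carrier
    T zero    = # 1
    T (suc k) = T k * x - (# 1 - x * x) * U k
    U zero    = # 0
    U (suc k) = U k * x + T k

    :T :U : ∀ {m} → Polynomial m → ℕ → Polynomial m
    :T x zero    = :# 1
    :T x (suc k) = :T x k :* x :- (:# 1 :- x :* x) :* :U x k
    :U x zero    = :# 0
    :U x (suc k) = :U x k :* x :+ :T x k

    -- Chebyshev expressions and the quintic equation

    s²≈1-x² : s * s ≈ # 1 - x * x
    s²≈1-x² = begin
      s * s                   ≈⟨ solve 2 (λ s x → s :* s := (x :* x :+ s :* s) :- x :* x) refl s x ⟩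
      x * x + s * s - x * x   ≈⟨ +-congʳ pythagoras ⟩
      # 1 - x * x             ∎

    chebyshev : ∀ k → S k ≈ s * U k × C k ≈ T k
    chebyshev zero = trans S-zero (solve 1 (λ s → :# 0 := s :* :# 0) refl s) , C-zero
    chebyshev (suc k) with chebyshev k
    ... | S≈ , C≈ = (begin
      S (suc k)             ≈⟨ S-suc k ⟩
      S k * x + C k * s     ≈⟨ +-cong (*-congʳ S≈) (*-congʳ C≈) ⟩
      s * U k * x + T k * s ≈⟨ solve 4 (λ s x t u → s :* u :* x :+ t :* s := s :* (u :* x :+ t)) refl s x (T k) (U k) ⟩
      s * U (suc k)         ∎) , (begin
      C (suc k)                   ≈⟨ C-suc k ⟩
      C k * x - S k * s           ≈⟨ +-cong (*-congʳ C≈) (-‿cong (*-congʳ S≈)) ⟩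
      T k * x - s * U k * s       ≈⟨ solve 4 (λ s x t u → t :* x :- s :* u :* s := t :* x :- s :* s :* u) refl s x (T k) (U k) ⟩
      T k * x - s * s * U k       ≈⟨ +-congˡ (-‿cong (*-congʳ s²≈1-x²)) ⟩
      T (suc k)                   ∎)

    S≈ : ∀ k → S k ≈ s * U k
    S≈ k = proj₁ (chebyshev k)

    C≈ : ∀ k → C k ≈ T k
    C≈ k = proj₂ (chebyshev k)

    -- Dividing `reflection` by the invertible `s` leaves 32x⁵ - 16x⁴ - 32x³ + 12x² + 6x - 1 = 0.
    minimal : U 6 - U 5 ≈ # 0
    minimal = cancel s-inverse (begin
      (U 6 - U 5) * s   ≈⟨ solve 3 (λ s u v → (u :- v) :* s := s :* u :- s :* v) refl s (U 6) (U 5) ⟩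
      s * U 6 - s * U 5 ≈⟨ +-cong (S≈ 6) (-‿cong (S≈ 5)) ⟨
      S 6 - S 5         ≈⟨ +-congʳ reflection ⟩
      S 5 - S 5         ≈⟨ solve 1 (λ u → u :- u := :# 0) refl (S 5) ⟩
      # 0               ∎)

    -- Twice the sum of sin (2πa/11) over the quadratic residues a modulo 11.
    gauss : Carrier
    gauss = # 2 * (S 1 + S 2 + S 3 - S 4 + S 5)

    P : Carrier
    P = # 2 * (U 1 + U 2 + U 3 - U 4 + U 5)

    :P : ∀ {m} → Polynomial m → Polynomial m
    :P x = :# 2 :* (:U x 1 :+ :U x 2 :+ :U x 3 :- :U x 4 :+ :U x 5)

    gauss≈ : gauss ≈ s * P
    gauss≈ = trans
      (*-congˡ (+-cong (+-cong (+-cong (+-cong (S≈ 1) (S≈ 2)) (S≈ 3)) (-‿cong (S≈ 4))) (S≈ 5)))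
      (solve 6 (λ s u₁ u₂ u₃ u₄ u₅ →
        :# 2 :* (s :* u₁ :+ s :* u₂ :+ s :* u₃ :- s :* u₄ :+ s :* u₅)
        := s :* (:# 2 :* (u₁ :+ u₂ :+ u₃ :- u₄ :+ u₅))) refl s (U 1) (U 2) (U 3) (U 4) (U 5))

    -- The arguments q below are the quotients of polynomial division by U 6 - U 5.
    modulo : ∀ {u v} q → u ≈ v + (U 6 - U 5) * q → u ≈ v
    modulo {u} {v} q u≈ = begin
      u                     ≈⟨ u≈ ⟩
      v + (U 6 - U 5) * q   ≈⟨ +-congˡ (*-congʳ minimal) ⟩
      v + # 0 * q           ≈⟨ solve 2 (λ v q → v :+ :# 0 :* q := v) refl v q ⟩
      v                     ∎

    gauss² : gauss * gauss ≈ # 11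
    gauss² = begin
      gauss * gauss       ≈⟨ *-cong gauss≈ gauss≈ ⟩
      s * P * (s * P)     ≈⟨ solve 2 (λ s p → s :* p :* (s :* p) := s :* s :* (p :* p)) refl s P ⟩
      s * s * (P * P)     ≈⟨ *-congʳ s²≈1-x² ⟩
      (# 1 - x * x) * (P * P)
        ≈⟨ modulo (# 7 - x * (# 6 + x * (# 28 - x * (# 32 + x * (# 16 - x * # 32)))))
            (solve 1 (λ x → (:# 1 :- x :* x) :* (:P x :* :P x)
               := :# 11 :+ (:U x 6 :- :U x 5)
                    :* (:# 7 :- x :* (:# 6 :+ x :* (:# 28 :- x :* (:# 32 :+ x :* (:# 16 :- x :* :# 32))))))
              refl x) ⟩
      # 11 ∎

    -- Once sin θ is factored out, both sides are polynomials in `x`, so equality modulo the quintic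
    -- suffices. In the applications `e` is 4 or -4 and `g` is 1 or -1.
    product : ∀ k j (e g q : Carrier) →
      U k + e * U j * T k ≈ g * P * T k + (U 6 - U 5) * q →
      S k + e * S j * C k ≈ g * gauss * C k
    product k j e g q h = begin
      S k + e * S j * C k               ≈⟨ +-cong (S≈ k) (*-cong (*-congˡ (S≈ j)) (C≈ k)) ⟩
      s * U k + e * (s * U j) * T k
        ≈⟨ solve 5 (λ s u e v t → s :* u :+ e :* (s :* v) :* t := s :* (u :+ e :* v :* t)) refl s (U k) e (U j) (T k) ⟩
      s * (U k + e * U j * T k)         ≈⟨ *-congˡ (modulo q h) ⟩
      s * (g * P * T k)
        ≈⟨ solve 4 (λ s g p t → s :* (g :* p :* t) := g :* (s :* p) :* t) refl s g P (T k) ⟩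
      g * (s * P) * T k                 ≈⟨ *-cong (*-congˡ gauss≈) (C≈ k) ⟨
      g * gauss * C k                   ∎

    -- The five identities multiplied by cos kθ

    product₁ : S 1 + # 4 * S 3 * C 1 ≈ # 1 * gauss * C 1
    product₁ = product 1 3 (# 4) (# 1) (- # 1)
      (solve 1 (λ x → :U x 1 :+ :# 4 :* :U x 3 :* :T x 1
        := :# 1 :* :P x :* :T x 1 :+ (:U x 6 :- :U x 5) :* (:- :# 1)) refl x)

    product₂ : S 2 + - # 4 * S 5 * C 2 ≈ - # 1 * gauss * C 2
    product₂ = product 2 5 (- # 4) (- # 1) (- # 2 - # 2 * x)
      (solve 1 (λ x → :U x 2 :+ (:- :# 4) :* :U x 5 :* :T x 2
        := (:- :# 1) :* :P x :* :T x 2 :+ (:U x 6 :- :U x 5) :* (:- :# 2 :- :# 2 :* x)) refl x)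

    product₃ : S 3 + # 4 * S 2 * C 3 ≈ # 1 * gauss * C 3
    product₃ = product 3 2 (# 4) (# 1) (# 1 - # 4 * (x * x))
      (solve 1 (λ x → :U x 3 :+ :# 4 :* :U x 2 :* :T x 3
        := :# 1 :* :P x :* :T x 3 :+ (:U x 6 :- :U x 5) :* (:# 1 :- :# 4 :* (x :* x))) refl x)

    product₄ : S 4 + # 4 * S 1 * C 4 ≈ # 1 * gauss * C 4
    product₄ = product 4 1 (# 4) (# 1) (- # 2 + x * (# 4 - # 8 * (x * x)))
      (solve 1 (λ x → :U x 4 :+ :# 4 :* :U x 1 :* :T x 4
        := :# 1 :* :P x :* :T x 4 :+ (:U x 6 :- :U x 5) :* (:- :# 2 :+ x :* (:# 4 :- :# 8 :* (x :* x)))) refl x)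

    product₅ : S 5 + - # 4 * S 4 * C 5 ≈ # 1 * gauss * C 5
    product₅ = product 5 4 (- # 4) (# 1) (- # 1 + x * (# 4 + x * (# 4 - x * (# 16 + # 16 * x))))
      (solve 1 (λ x → :U x 5 :+ (:- :# 4) :* :U x 4 :* :T x 5
        := :# 1 :* :P x :* :T x 5 :+ (:U x 6 :- :U x 5)
             :* (:- :# 1 :+ x :* (:# 4 :+ x :* (:# 4 :- x :* (:# 16 :+ :# 16 :* x))))) refl x)

    -- The invertible element is written through `S` and `C` instead of `gauss`: over the reals all
    -- its summands are then visibly positive, while `gauss` contains -sin 4θ.
    module _ (r : Carrier) (r² : r * r ≈ # 11)
      (w : Carrier) (w-inverse : (S 1 + # 4 * S 3 * C 1 + r * C 1) * w ≈ # 1) where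

      -- gauss² ≈ r², and the factor gauss + r can be cancelled because it is
      -- invertible after multiplication by C 1.
      gauss≈r : gauss ≈ r
      gauss≈r = begin
        gauss           ≈⟨ solve 2 (λ g r → g := (g :- r) :+ r) refl gauss r ⟩
        gauss - r + r   ≈⟨ +-congʳ (cancel w-inverse (begin
          (gauss - r) * (S 1 + # 4 * S 3 * C 1 + r * C 1) ≈⟨ *-congˡ (+-congʳ product₁) ⟩
          (gauss - r) * (# 1 * gauss * C 1 + r * C 1)
            ≈⟨ solve 3 (λ g r c → (g :- r) :* (:# 1 :* g :* c :+ r :* c) := (g :* g :- r :* r) :* c) refl gauss r (C 1) ⟩
          (gauss * gauss - r * r) * C 1      ≈⟨ *-congʳ (+-cong gauss² (-‿cong r²)) ⟩
          (# 11 - # 11) * C 1                ≈⟨ solve 1 (λ c → (:# 11 :- :# 11) :* c := :# 0) refl (C 1) ⟩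
          # 0                                ∎)) ⟩
        # 0 + r         ≈⟨ solve 1 (λ r → :# 0 :+ r := r) refl r ⟩
        r               ∎

      -- `i` is an inverse of `C k`, so `S k * i` is the tangent; multiplying the hypothesis by `i`
      -- cancels the cosine.
      quotient : ∀ {i} k j e g → S k + e * S j * C k ≈ g * gauss * C k → C k * i ≈ # 1 →
        S k * i + e * S j ≈ g * r
      quotient {i} k j e g h ci≈1 = begin
        S k * i + e * S j                 ≈⟨ solve 3 (λ a e b → a :+ e :* b := a :+ e :* b :* :# 1) refl (S k * i) e (S j) ⟩
        S k * i + e * S j * # 1           ≈⟨ +-congˡ (*-congˡ ci≈1) ⟨
        S k * i + e * S j * (C k * i)
          ≈⟨ solve 5 (λ a i e b c → a :* i :+ e :* b :* (c :* i) := (a :+ e :* b :* c) :* i) refl (S k) i e (S j) (C k) ⟩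
        (S k + e * S j * C k) * i         ≈⟨ *-congʳ h ⟩
        g * gauss * C k * i               ≈⟨ *-assoc (g * gauss) (C k) i ⟩
        g * gauss * (C k * i)             ≈⟨ *-cong (*-congˡ gauss≈r) ci≈1 ⟩
        g * r * # 1                       ≈⟨ solve 1 (λ a → a :* :# 1 := a) refl (g * r) ⟩
        g * r                             ∎

      sum : ∀ {i} k j → S k + # 4 * S j * C k ≈ # 1 * gauss * C k → C k * i ≈ # 1 →
        S k * i + # 4 * S j ≈ r
      sum k j h ci≈1 = trans (quotient k j (# 4) (# 1) h ci≈1) (solve 1 (λ r → :# 1 :* r := r) refl r)

      difference : ∀ {i} k j g → S k + - # 4 * S j * C k ≈ g * gauss * C k → C k * i ≈ # 1 →
        S k * i - # 4 * S j ≈ g * r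
      difference {i} k j g h ci≈1 = trans
        (solve 2 (λ a b → a :- :# 4 :* b := a :+ (:- :# 4) :* b) refl (S k * i) (S j))
        (quotient k j (- # 4) g h ci≈1)

      -- The five identities in the ring

      identity₁ : ∀ {i} → C 1 * i ≈ # 1 → S 1 * i + # 4 * S 3 ≈ r
      identity₁ = sum 1 3 product₁

      identity₂ : ∀ {i} → C 2 * i ≈ # 1 → S 2 * i - # 4 * S 5 ≈ - r
      identity₂ h = trans (difference 2 5 (- # 1) product₂ h) (solve 1 (λ r → (:- :# 1) :* r := :- r) refl r)

      identity₃ : ∀ {i} → C 3 * i ≈ # 1 → S 3 * i + # 4 * S 2 ≈ r
      identity₃ = sum 3 2 product₃

      identity₄ : ∀ {i} → C 4 * i ≈ # 1 → S 4 * i + # 4 * S 1 ≈ r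
      identity₄ = sum 4 1 product₄

      identity₅ : ∀ {i} → C 5 * i ≈ # 1 → S 5 * i - # 4 * S 4 ≈ r
      identity₅ h = trans (difference 5 4 (# 1) product₅ h) (solve 1 (λ r → :# 1 :* r := r) refl r)

-- Trigonometry of the real numbers

open ≡ using (_≡_; refl; sym; trans; cong)
open PartialSums
open Defs
open RationalSequences using (ι; ι-mono; bounded; sinSum; cosSum; halfπApprox)
open +-*-Solver using (solve; con; _:+_; _:*_; _:-_; :-_; _:=_)

-- The real arguments are explicit because _≃_ unfolds to a statement about the
-- sequences, from which they cannot be inferred.
≡⇒≃ : ∀ x y → (∀ n → seq x n ≡ seq y n) → x ≃ y
≡⇒≃ x y e = null-eventually 0 λ n _ →
  trans (cong (Rat._- seq y n) (e n)) (ℚₚ.+-inverseʳ (seq y n))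

≃-sym : ∀ x y → x ≃ y → y ≃ x
≃-sym x y h = null-cong
  (λ n → solve 2 (λ x y → :- (x :- y) := y :- x) refl (seq x n) (seq y n)) (null-neg h)

≃-trans : ∀ x y z → x ≃ y → y ≃ z → x ≃ z
≃-trans x y z h k = null-cong
  (λ n → solve 3 (λ x y z → (x :- y) :+ (y :- z) := x :- z) refl (seq x n) (seq y n) (seq z n))
  (null-+ (λ n → seq x n Rat.- seq y n) (λ n → seq y n Rat.- seq z n) h k)

+-cong : ∀ x y u v → x ≃ y → u ≃ v → x + u ≃ y + v
+-cong x y u v h k = null-cong
  (λ n → solve 4 (λ x y u v → (x :- y) :+ (u :- v) := (x :+ u) :- (y :+ v)) refl
    (seq x n) (seq y n) (seq u n) (seq v n))
  (null-+ (λ n → seq x n Rat.- seq y n) (λ n → seq u n Rat.- seq v n) h k)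

-‿cong : ∀ x y → x ≃ y → - x ≃ - y
-‿cong x y h = null-cong
  (λ n → solve 2 (λ x y → :- (x :- y) := (:- x) :- (:- y)) refl (seq x n) (seq y n)) (null-neg h)

*-cong : ∀ x y u v → x ≃ y → u ≃ v → x * u ≃ y * v
*-cong x y u v h k = null-cong
  (λ n → solve 4 (λ x y u v → u :* (x :- y) :+ y :* (u :- v) := x :* u :- y :* v) refl
    (seq x n) (seq y n) (seq u n) (seq v n))
  (null-+ (λ n → seq u n Rat.* (seq x n Rat.- seq y n)) (λ n → seq y n Rat.* (seq u n Rat.- seq v n))
    (null-* (λ n → seq x n Rat.- seq y n) (seq u) (cauchy u) h)
    (null-* (λ n → seq u n Rat.- seq v n) (seq y) (cauchy y) k))

-- The real numbers as a commutative ℚ-algebra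

ℝ-commutativeRing : CommutativeRing 0ℓ 0ℓ
ℝ-commutativeRing = record
  { Carrier = ℝ
  ; _≈_ = _≃_
  ; _+_ = _+_
  ; _*_ = _*_
  ; -_ = -_
  ; 0# = fromℕ 0
  ; 1# = fromℕ 1
  ; isCommutativeRing = record
    { isRing = record
      { +-isAbelianGroup = record
        { isGroup = record
          { isMonoid = record
            { isSemigroup = record
              { isMagma = record
                { isEquivalence = record
                  { refl  = λ {x} → ≡⇒≃ x x (λ _ → refl)
                  ; sym   = λ {x} {y} → ≃-sym x y
                  ; trans = λ {x} {y} {z} → ≃-trans x y z
                  }
                ; ∙-cong = λ {x} {y} {u} {v} → +-cong x y u v
                }
              ; assoc = λ x y z → ≡⇒≃ (x + y + z) (x + (y + z)) λ n → ℚₚ.+-assoc (seq x n) (seq y n) (seq z n)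
              }
            ; identity = (λ x → ≡⇒≃ (fromℕ 0 + x) x λ n → ℚₚ.+-identityˡ (seq x n))
                       , (λ x → ≡⇒≃ (x + fromℕ 0) x λ n → ℚₚ.+-identityʳ (seq x n))
            }
          ; inverse = (λ x → ≡⇒≃ (- x + x) (fromℕ 0) λ n → ℚₚ.+-inverseˡ (seq x n))
                    , (λ x → ≡⇒≃ (x - x) (fromℕ 0) λ n → ℚₚ.+-inverseʳ (seq x n))
          ; ⁻¹-cong = λ {x} {y} → -‿cong x y
          }
        ; comm = λ x y → ≡⇒≃ (x + y) (y + x) λ n → ℚₚ.+-comm (seq x n) (seq y n)
        }
      ; *-cong = λ {x} {y} {u} {v} → *-cong x y u v
      ; *-assoc = λ x y z → ≡⇒≃ (x * y * z) (x * (y * z)) λ n → ℚₚ.*-assoc (seq x n) (seq y n) (seq z n)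
      ; *-identity = (λ x → ≡⇒≃ (fromℕ 1 * x) x λ n → ℚₚ.*-identityˡ (seq x n))
                   , (λ x → ≡⇒≃ (x * fromℕ 1) x λ n → ℚₚ.*-identityʳ (seq x n))
      ; distrib = (λ x y z → ≡⇒≃ (x * (y + z)) (x * y + x * z) λ n → ℚₚ.*-distribˡ-+ (seq x n) (seq y n) (seq z n))
                , (λ x y z → ≡⇒≃ ((y + z) * x) (y * x + z * x) λ n → ℚₚ.*-distribʳ-+ (seq x n) (seq y n) (seq z n))
      }
    ; *-comm = λ x y → ≡⇒≃ (x * y) (y * x) λ n → ℚₚ.*-comm (seq x n) (seq y n)
    }
  }

ℚ⟶ℝ : CommutativeRing.rawRing ℚₚ.+-*-commutativeRing
  ACR.-Raw-AlmostCommutative⟶ ACR.fromCommutativeRing ℝ-commutativeRing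
ℚ⟶ℝ = record
  { ⟦_⟧    = fromℚ
  ; +-homo = λ p q → ≡⇒≃ (fromℚ (p Rat.+ q)) (fromℚ p + fromℚ q) λ _ → refl
  ; *-homo = λ p q → ≡⇒≃ (fromℚ (p Rat.* q)) (fromℚ p * fromℚ q) λ _ → refl
  ; -‿homo = λ p → ≡⇒≃ (fromℚ (Rat.- p)) (- fromℚ p) λ _ → refl
  ; 0-homo = ≡⇒≃ (fromℕ 0) (fromℕ 0) λ _ → refl
  ; 1-homo = ≡⇒≃ (fromℕ 1) (fromℕ 1) λ _ → refl
  }

-- Addition formulas and special values of sine and cosine

common-bound-ℕ : ∀ x y → Σ[ b ∈ ℕ ] ∃[ N ] (∀ n → N ℕ.≤ n →
  ∣ seq x n ∣ Rat.≤ ι b × ∣ seq y n ∣ Rat.≤ ι b)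
common-bound-ℕ x y =
  let b , M , hM = bounded (cauchy x)
      c , N , hN = bounded (cauchy y)
  in b ℕ.+ c , M ℕ.+ N , λ n n≥ →
    ℚₚ.≤-trans (hM n (ℕₚ.≤-trans (ℕₚ.m≤m+n M N) n≥)) (ι-mono (ℕₚ.m≤m+n b c)) ,
    ℚₚ.≤-trans (hN n (ℕₚ.≤-trans (ℕₚ.m≤n+m N M) n≥)) (ι-mono (ℕₚ.m≤n+m c b))

sin-+ : ∀ x y → sin (x + y) ≃ sin x * cos y + cos x * sin y
sin-+ x y = let b , N , h = common-bound-ℕ x y in
  addition-null b N
    (λ n → sinSum n (seq x n Rat.+ seq y n)
      Rat.- (sinSum n (seq x n) Rat.* cosSum n (seq y n) Rat.+ cosSum n (seq x n) Rat.* sinSum n (seq y n)))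
    λ n n≥ → sinSum-+ b (seq x n) (seq y n) (proj₁ (h n n≥)) (proj₂ (h n n≥)) n

cos-+ : ∀ x y → cos (x + y) ≃ cos x * cos y - sin x * sin y
cos-+ x y = let b , N , h = common-bound-ℕ x y in
  addition-null b N
    (λ n → cosSum n (seq x n Rat.+ seq y n)
      Rat.- (cosSum n (seq x n) Rat.* cosSum n (seq y n) Rat.- sinSum n (seq x n) Rat.* sinSum n (seq y n)))
    λ n n≥ → cosSum-+ b (seq x n) (seq y n) (proj₁ (h n n≥)) (proj₂ (h n n≥)) n

cos-neg : ∀ x → cos (- x) ≃ cos x
cos-neg x = ≡⇒≃ (cos (- x)) (cos x) λ n → cosSum-neg n (seq x n)

sin-neg : ∀ x → sin (- x) ≃ - sin x
sin-neg x = ≡⇒≃ (sin (- x)) (- sin x) λ n → sinSum-neg n (seq x n)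

sin-≡ : ∀ x y → (∀ n → seq x n ≡ seq y n) → sin x ≃ sin y
sin-≡ x y e = ≡⇒≃ (sin x) (sin y) λ n → cong (sinSum n) (e n)

cos-≡ : ∀ x y → (∀ n → seq x n ≡ seq y n) → cos x ≃ cos y
cos-≡ x y e = ≡⇒≃ (cos x) (cos y) λ n → cong (cosSum n) (e n)

sin-0 : ∀ x → (∀ n → seq x n ≡ 0ℚ) → sin x ≃ fromℕ 0
sin-0 x e = ≡⇒≃ (sin x) (fromℕ 0) λ n → trans (cong (sinSum n) (e n)) (sinSum-zero n)

cos-0 : ∀ x → (∀ n → seq x n ≡ 0ℚ) → cos x ≃ fromℕ 1
-- The index starts at 1 because the empty sum `cosSum 0` is 0.
cos-0 x e = null-eventually 1 λ
  { (suc n) _ → trans (cong (Rat._- 1ℚ) (trans (cong (cosSum (suc n)) (e (suc n))) (cosSum-zero n))) refl }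


cos²+sin² : ∀ x → cos x * cos x + sin x * sin x ≃ fromℕ 1
cos²+sin² x = pythagorean ℝ-commutativeRing ℚ⟶ℝ (cos x) (sin x) (cos (- x)) (sin (- x)) (cos (x + - x))
  (cos-+ x (- x)) (cos-neg x) (sin-neg x) (cos-0 (x + - x) (λ n → ℚₚ.+-inverseʳ (seq x n)))

π-angle : sin (half-π + half-π) ≃ fromℕ 0 × cos (half-π + half-π) ≃ - fromℕ 1
π-angle = double-right-angle ℝ-commutativeRing ℚ⟶ℝ (cos half-π) (sin half-π)
  (sin (half-π + half-π)) (cos (half-π + half-π))
  cos-half-π (cos²+sin² half-π) (sin-+ half-π half-π) (cos-+ half-π half-π)

sin-supplement : ∀ x → sin ((half-π + half-π) + - x) ≃ sin x
sin-supplement x = supplement ℝ-commutativeRing ℚ⟶ℝ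
  (sin (half-π + half-π)) (cos (half-π + half-π)) (cos (- x)) (sin x) (sin (- x)) (sin ((half-π + half-π) + - x))
  (proj₁ π-angle) (proj₂ π-angle) (sin-neg x) (sin-+ (half-π + half-π) (- x))

cos-complement : ∀ x → cos (half-π + - x) ≃ sin half-π * sin x
cos-complement x = complement ℝ-commutativeRing ℚ⟶ℝ
  (cos half-π) (sin half-π) (cos (- x)) (sin x) (sin (- x)) (cos (half-π + - x))
  cos-half-π (sin-neg x) (cos-+ half-π (- x))

-- Positivity of sine and cosine

+-positive : ∀ x y → fromℕ 0 < x → fromℕ 0 < y → fromℕ 0 < x + y
+-positive x y = positive-+ (seq x) (seq y)

*-positive : ∀ x y → fromℕ 0 < x → fromℕ 0 < y → fromℕ 0 < x * y
*-positive x y = positive-* (seq x) (seq y)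

sin-positive : ∀ x q → 0ℚ Rat.< q → q Rat.≤ 1ℚ → (∀ n → seq x n ≡ q Rat.* halfπApprox n) → fromℕ 0 < sin x
sin-positive x = sinSum-positive (seq x)

cos-positive : ∀ x q → 0ℚ Rat.< q → q Rat.≤ 1ℚ →
  (∀ n → halfπApprox n Rat.- seq x n ≡ q Rat.* halfπApprox n) → fromℕ 0 < cos x
cos-positive x q q>0 q≤1 e = positive-null (seq (cos x)) (seq (sin half-π * sin (half-π + - x)))
  (≃-trans (cos x) (cos (half-π + - (half-π + - x))) (sin half-π * sin (half-π + - x))
    -- The argument x is written as π/2 - (π/2 - x), so that `cos-complement` turns its cosine into
    -- a sine of π/2 - x.
    (cos-≡ x (half-π + - (half-π + - x)) λ n →
      solve 2 (λ h x → x := h :- (h :- x)) refl (halfπApprox n) (seq x n))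
    (cos-complement (half-π + - x)))
  (*-positive (sin half-π) (sin (half-π + - x))
    (sin-positive half-π 1ℚ (ℚₚ.positive⁻¹ 1ℚ) ℚₚ.≤-refl (λ n → sym (ℚₚ.*-identityˡ (halfπApprox n))))
    (sin-positive (half-π + - x) q q>0 q≤1 e))

-- Multiples of π/11

S C : ℕ → ℝ
S k = sin (k π/11)
C k = cos (k π/11)

S-zero : S 0 ≃ fromℕ 0
S-zero = sin-0 (0 π/11) (λ n → ℚₚ.*-zeroˡ (seq π n))

C-zero : C 0 ≃ fromℕ 1
C-zero = cos-0 (0 π/11) (λ n → ℚₚ.*-zeroˡ (seq π n))

S-suc : ∀ k → S (suc k) ≃ S k * C 1 + C k * S 1
S-suc k = ≃-trans (S (suc k)) (sin (k π/11 + 1 π/11)) (S k * C 1 + C k * S 1)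
  (sin-≡ (suc k π/11) (k π/11 + 1 π/11) (λ n → suc-k/11 k (seq π n))) (sin-+ (k π/11) (1 π/11))

C-suc : ∀ k → C (suc k) ≃ C k * C 1 - S k * S 1
C-suc k = ≃-trans (C (suc k)) (cos (k π/11 + 1 π/11)) (C k * C 1 - S k * S 1)
  (cos-≡ (suc k π/11) (k π/11 + 1 π/11) (λ n → suc-k/11 k (seq π n))) (cos-+ (k π/11) (1 π/11))

-- The angles 6π/11 and 5π/11 are supplementary. The two forms `fromℕ 2 * half-π` and
-- `half-π + half-π` of π agree term by term.
S-reflection : S 6 ≃ S 5
S-reflection = ≃-trans (S 6) (sin ((half-π + half-π) + - 5 π/11)) (S 5)
  (sin-≡ (6 π/11) ((half-π + half-π) + - 5 π/11) λ n →
    solve 1 (λ h → con (ℤ.+ 6 / 11) :* (con (ι 2) :* h) := (h :+ h) :+ (:- (con (ℤ.+ 5 / 11) :* (con (ι 2) :* h)))) refl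
      (halfπApprox n))
  (sin-supplement (5 π/11))

S1>0 : fromℕ 0 < S 1
-- For sines the constant is 2k/11, since kπ/11 is 2k/11 times π/2.
S1>0 = sin-positive (1 π/11) (ℤ.+ 2 / 11) (ℚₚ.positive⁻¹ (ℤ.+ 2 / 11)) (ℚₚ.≤ᵇ⇒≤ _) λ n →
  solve 1 (λ h → con (ℤ.+ 1 / 11) :* (con (ι 2) :* h) := con (ℤ.+ 2 / 11) :* h) refl (halfπApprox n)

S3>0 : fromℕ 0 < S 3
S3>0 = sin-positive (3 π/11) (ℤ.+ 6 / 11) (ℚₚ.positive⁻¹ (ℤ.+ 6 / 11)) (ℚₚ.≤ᵇ⇒≤ _) λ n →
  solve 1 (λ h → con (ℤ.+ 3 / 11) :* (con (ι 2) :* h) := con (ℤ.+ 6 / 11) :* h) refl (halfπApprox n)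

C1>0 : fromℕ 0 < C 1
-- For cosines the constant is (11 - 2k)/11, the ratio of π/2 - kπ/11 to π/2.
C1>0 = cos-positive (1 π/11) (ℤ.+ 9 / 11) (ℚₚ.positive⁻¹ (ℤ.+ 9 / 11)) (ℚₚ.≤ᵇ⇒≤ _) λ n →
  solve 1 (λ h → h :- con (ℤ.+ 1 / 11) :* (con (ι 2) :* h) := con (ℤ.+ 9 / 11) :* h) refl (halfπApprox n)

C2>0 : fromℕ 0 < C 2
C2>0 = cos-positive (2 π/11) (ℤ.+ 7 / 11) (ℚₚ.positive⁻¹ (ℤ.+ 7 / 11)) (ℚₚ.≤ᵇ⇒≤ _) λ n →
  solve 1 (λ h → h :- con (ℤ.+ 2 / 11) :* (con (ι 2) :* h) := con (ℤ.+ 7 / 11) :* h) refl (halfπApprox n)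

C3>0 : fromℕ 0 < C 3
C3>0 = cos-positive (3 π/11) (ℤ.+ 5 / 11) (ℚₚ.positive⁻¹ (ℤ.+ 5 / 11)) (ℚₚ.≤ᵇ⇒≤ _) λ n →
  solve 1 (λ h → h :- con (ℤ.+ 3 / 11) :* (con (ι 2) :* h) := con (ℤ.+ 5 / 11) :* h) refl (halfπApprox n)

C4>0 : fromℕ 0 < C 4
C4>0 = cos-positive (4 π/11) (ℤ.+ 3 / 11) (ℚₚ.positive⁻¹ (ℤ.+ 3 / 11)) (ℚₚ.≤ᵇ⇒≤ _) λ n →
  solve 1 (λ h → h :- con (ℤ.+ 4 / 11) :* (con (ι 2) :* h) := con (ℤ.+ 3 / 11) :* h) refl (halfπApprox n)

C5>0 : fromℕ 0 < C 5
C5>0 = cos-positive (5 π/11) (ℤ.+ 1 / 11) (ℚₚ.positive⁻¹ (ℤ.+ 1 / 11)) (ℚₚ.≤ᵇ⇒≤ _) λ n →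
  solve 1 (λ h → h :- con (ℤ.+ 5 / 11) :* (con (ι 2) :* h) := con (ℤ.+ 1 / 11) :* h) refl (halfπApprox n)

-- Reciprocals and the choice of sign

reciprocal : ∀ x → fromℕ 0 < x → ℝ
reciprocal x x>0 = inverse x (inj₂ x>0)

*-reciprocal : ∀ x x>0 → x * reciprocal x x>0 ≃ fromℕ 1
*-reciprocal x x>0 = *-inverse x (inj₂ x>0)

-- By `E.product₁` this is (`E.gauss` + √11) cos(π/11). It is positive, hence invertible, which
-- rules out the value -√11 for the Gauss sum.
W : ℝ
W = S 1 + fromℕ 4 * S 3 * C 1 + √11 * C 1

W>0 : fromℕ 0 < W
W>0 = +-positive (S 1 + fromℕ 4 * S 3 * C 1) (√11 * C 1)
  (+-positive (S 1) (fromℕ 4 * S 3 * C 1) S1>0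
    (*-positive (fromℕ 4 * S 3) (C 1)
      (*-positive (fromℕ 4) (S 3)
        (1ℚ , ℚₚ.positive⁻¹ 1ℚ , 0 , λ _ _ → ℚₚ.≤ᵇ⇒≤ _) S3>0) C1>0))
  (*-positive √11 (C 1) √11>0 C1>0)

module E = Elevenths ℝ-commutativeRing ℚ⟶ℝ S C S-zero C-zero S-suc C-suc (cos²+sin² (1 π/11)) S-reflection
  (reciprocal (S 1) S1>0) (*-reciprocal (S 1) S1>0)

theorem3p1 : (Σ[ d ∈ cos (1 π/11) # fromℕ 0 ] tan (1 π/11) d + fromℕ 4 * sin (3 π/11) ≃ √11)
    × (Σ[ d ∈ cos (2 π/11) # fromℕ 0 ] tan (2 π/11) d - fromℕ 4 * sin (5 π/11) ≃ - √11)
    × (Σ[ d ∈ cos (3 π/11) # fromℕ 0 ] tan (3 π/11) d + fromℕ 4 * sin (2 π/11) ≃ √11)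
    × (Σ[ d ∈ cos (4 π/11) # fromℕ 0 ] tan (4 π/11) d + fromℕ 4 * sin (1 π/11) ≃ √11)
    × (Σ[ d ∈ cos (5 π/11) # fromℕ 0 ] tan (5 π/11) d - fromℕ 4 * sin (4 π/11) ≃ √11)
theorem3p1 =
    (inj₂ C1>0 , E.identity₁ √11 √11² 1/W W-inverse {reciprocal (C 1) C1>0} (*-reciprocal (C 1) C1>0))
  , (inj₂ C2>0 , E.identity₂ √11 √11² 1/W W-inverse {reciprocal (C 2) C2>0} (*-reciprocal (C 2) C2>0))
  , (inj₂ C3>0 , E.identity₃ √11 √11² 1/W W-inverse {reciprocal (C 3) C3>0} (*-reciprocal (C 3) C3>0))
  , (inj₂ C4>0 , E.identity₄ √11 √11² 1/W W-inverse {reciprocal (C 4) C4>0} (*-reciprocal (C 4) C4>0))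
  , (inj₂ C5>0 , E.identity₅ √11 √11² 1/W W-inverse {reciprocal (C 5) C5>0} (*-reciprocal (C 5) C5>0))
  where
  1/W : ℝ
  1/W = reciprocal W W>0
  W-inverse : W * 1/W ≃ fromℕ 1
  W-inverse = *-reciprocal W W>0
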